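{- Let $d$ be a positive integer. There do not exist $d^2$ DRACKN lines spanning $\mathbb{C}^d$. There exist $d^2$ DRACKN lines spanning $\mathbb{C}^{d^2-d}$ only if $d=3$.
   Context: A roux for a finite abelian group $\Gamma$ (identified with its image in $\mathbb{C}[\Gamma]$) is a matrix $B\in\mathbb{C}[\Gamma]^{n\times n}$ such that (R1) $B_{ii}=0$; (R2) $B_{ij}\in\Gamma$ for $i\ne j$; (R3) $B_{ji}=(B_{ij})^{ -1}$ for $i\ne j$; (R4) $\{gI\}_{g\in\Gamma}$ and $\{gB\}_{g\in\Gamma}$ span an algebra. $\hat\alpha(B)$ applies the linear extension of the character $\alpha\in\hat\Gamma$ to each entry of $B$. $\lceil B\rfloor$ applies the Cayley representation of $\Gamma$ to each entry of $B$ (for $x\in\Gamma$, the $(g,h)$ entry of the image is $1$ if $xh=g$ and $0$ otherwise). The roux graph of $B$ is the graph on $[n]\times\Gamma$ with adjacency matrix $\lceil B\rfloor$; its fibres are the sets $\{i\}\times\Gamma$. Graphs are finite and simple. A graph is distance-regular if for every ordered pair $(u,v)$ of vertices the number of vertices at distance $i$ from $u$ and $j$ from $v$ depends only on $i$, $j$ and the distance between $u$ and $v$. A cover of the complete graph is a graph with a partition of its vertices into independent sets (fibres) such that the union of any two distinct fibres induces a perfect matching. A DRACKN is a connected, distance-regular cover of the complete graph in which two distinct vertices are at distance equal to the diameter if and only if they lie in the same fibre. Writing the adjacency matrix $A$ of a cover with fibres of size $r$ in $r\times r$ blocks $A_{ij}$, normalize it to $DAD^{ -1}$ with $D$ block diagonal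 with first block $I$ and $j$th block $A_{1j}$ ($j>1$); let $\Pi\le S_r$ be generated by the permutations represented by the off-diagonal blocks. The cover is regular if $\Pi$ acts regularly on $[r]$ and abelian if $\Pi$ is abelian. Unit vectors have signature matrix $\mathcal S$ (self-adjoint, zero diagonal, unit-modulus off-diagonal entries) if their Gram matrix $(\langle\varphi_j,\varphi_i\rangle)_{ij}$ equals $I+\mu\mathcal S$ with $\mu>0$. DRACKN lines: a sequence of $n$ linearly dependent lines through the origin (their span has dimension less than $n$) for which there exist unit-norm representatives with signature matrix $\hat\alpha(B)$ for some $\alpha\in\hat\Gamma$ and some $n\times n$ roux $B$ for a finite abelian group $\Gamma$ whose roux graph is a regular abelian DRACKN. Roux have size $n\ge2$. -}

module Defs where

open import Level using (0ℓ)
open import Algebra.Bundles using (AbelianGroup; RawRing)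
open import Algebra.Definitions.RawMonoid using (sum)
open import Algebra.Morphism.Structures using (module MonoidMorphisms)
open import Algebra.Structures using (IsAbelianGroup)
open import Data.Bool.Base using (if_then_else_)
open import Data.Fin.Base using (Fin; zero; suc)
import Data.Fin.Properties as Fin
open import Data.List.Base using (map; filter; length; allFin)
open import Data.Nat.Base as ℕ using (ℕ; zero; suc)
import Data.Nat.Properties as ℕ
open import Data.Product.Base using (∃; ∃₂; _×_; _,_; proj₁; proj₂)
open import Data.Product using (∃!)
open import Data.Product.Function.NonDependent.Propositional using (_×-↔_)
open import Data.Rational.Base as ℚ using (ℚ; 0ℚ; 1ℚ)
import Data.Rational.Properties as ℚ
open import Data.Rational.Solver using (module +-*-Solver)
open import Data.Sum.Base using (_⊎_)
open import Function.Base using (_∘_)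
open import Function.Bundles using (_↔_; _⇔_; module Inverse)
open import Function.Construct.Composition using (_↔-∘_)
open import Function.Construct.Identity using (↔-id)
open import Function.Construct.Symmetry using (↔-sym)
open import Function.Definitions using (Surjective)
open import Function.Properties.Inverse using (↔⇒↣)
open import Relation.Binary.Core using (Rel)
open import Relation.Binary.Definitions using (Decidable; DecidableEquality; Symmetric; Irreflexive)
open import Relation.Binary.PropositionalEquality using (_≡_; _≢_; refl; sym; trans; cong; subst)
open import Relation.Nullary using (¬_; Dec; does; ¬?; _×-dec_)
import Relation.Nullary.Decidable as Dec

IsCauchy : (ℕ → ℚ) → Set
IsCauchy x = ∀ ε → 0ℚ ℚ.< ε →
  ∃ λ N → ∀ m n → N ℕ.≤ m → N ℕ.≤ n → ℚ.∣ x m ℚ.- x n ∣ ℚ.< ε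

-- A real number is a Cauchy sequence of rationals; equality of reals is _≈ᴿ_.
-- Without η, applications of the operations below do not unfold.
record ℝ : Set where
  no-eta-equality
  field
    seq    : ℕ → ℚ
    cauchy : IsCauchy seq

open ℝ public

private
  module Bounds where
    open ℚ.≤-Reasoning
    open +-*-Solver

    pos⇒1/> : ∀ {b} (b>0 : 0ℚ ℚ.< b) →
              0ℚ ℚ.< (ℚ.1/ b) {{ℚ.>-nonZero b>0}}
    pos⇒1/> {b} b>0 =
      ℚ.positive⁻¹ _ {{ℚ.1/pos⇒pos b {{ℚ.positive b>0}}}}

    *-pos : ∀ {a b} → 0ℚ ℚ.< a → 0ℚ ℚ.< b → 0ℚ ℚ.< a ℚ.* b
    *-pos {a} {b} a>0 b>0 =
      ℚ.positive⁻¹ _ {{ℚ.pos*pos⇒pos a {{ℚ.positive a>0}} b {{ℚ.positive b>0}}}}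

    half-pos : ∀ {ε} → 0ℚ ℚ.< ε → 0ℚ ℚ.< ℚ.½ ℚ.* ε
    half-pos {ε} = *-pos {ℚ.½} {ε} (ℚ.positive⁻¹ ℚ.½)

    -- A bound b on |x m| valid for all large m.
    bound : ∀ x → IsCauchy x →
            ∃₂ λ b N → 0ℚ ℚ.< b × (∀ m → N ℕ.≤ m → ℚ.∣ x m ∣ ℚ.≤ b)
    bound x cx with cx 1ℚ (ℚ.positive⁻¹ 1ℚ)
    ... | N , close = ℚ.∣ x N ∣ ℚ.+ 1ℚ , N , b>0 , λ m N≤m → begin
            ℚ.∣ x m ∣                           ≡⟨ cong ℚ.∣_∣ (split (x m) (x N)) ⟩
            ℚ.∣ x N ℚ.+ (x m ℚ.- x N) ∣         ≤⟨ ℚ.∣p+q∣≤∣p∣+∣q∣ (x N) (x m ℚ.- x N) ⟩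
            ℚ.∣ x N ∣ ℚ.+ ℚ.∣ x m ℚ.- x N ∣     ≤⟨ ℚ.+-monoʳ-≤ ℚ.∣ x N ∣ (ℚ.<⇒≤ (close m N N≤m ℕ.≤-refl)) ⟩
            ℚ.∣ x N ∣ ℚ.+ 1ℚ                    ∎
      where
      split : ∀ p q → p ≡ q ℚ.+ (p ℚ.- q)
      split = solve 2 (λ p q → p := q :+ (p :- q)) refl
      b>0 : 0ℚ ℚ.< ℚ.∣ x N ∣ ℚ.+ 1ℚ
      b>0 = ℚ.+-mono-≤-< {0ℚ} {ℚ.∣ x N ∣} {0ℚ} {1ℚ}
              (ℚ.nonNegative⁻¹ _ {{ℚ.∣-∣-nonNeg (x N)}}) (ℚ.positive⁻¹ 1ℚ)

    +-cauchy : ∀ x y → IsCauchy x → IsCauchy y → IsCauchy (λ n → x n ℚ.+ y n)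
    +-cauchy x y cx cy ε ε>0
      with cx (ℚ.½ ℚ.* ε) (half-pos ε>0) | cy (ℚ.½ ℚ.* ε) (half-pos ε>0)
    ... | M , px | N , py = M ℕ.⊔ N , λ m n le-m le-n → begin-strict
            ℚ.∣ (x m ℚ.+ y m) ℚ.- (x n ℚ.+ y n) ∣
              ≡⟨ cong ℚ.∣_∣ (regroup (x m) (y m) (x n) (y n)) ⟩
            ℚ.∣ (x m ℚ.- x n) ℚ.+ (y m ℚ.- y n) ∣
              ≤⟨ ℚ.∣p+q∣≤∣p∣+∣q∣ (x m ℚ.- x n) (y m ℚ.- y n) ⟩
            ℚ.∣ x m ℚ.- x n ∣ ℚ.+ ℚ.∣ y m ℚ.- y n ∣
              <⟨ ℚ.+-mono-< {ℚ.∣ x m ℚ.- x n ∣} {ℚ.½ ℚ.* ε} {ℚ.∣ y m ℚ.- y n ∣} {ℚ.½ ℚ.* ε}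
                            (px m n (ℕ.m⊔n≤o⇒m≤o M N le-m) (ℕ.m⊔n≤o⇒m≤o M N le-n))
                            (py m n (ℕ.m⊔n≤o⇒n≤o M N le-m) (ℕ.m⊔n≤o⇒n≤o M N le-n)) ⟩
            ℚ.½ ℚ.* ε ℚ.+ ℚ.½ ℚ.* ε
              ≡⟨ halves ε ⟩
            ε ∎
      where
      regroup : ∀ a b c d → (a ℚ.+ b) ℚ.- (c ℚ.+ d) ≡ (a ℚ.- c) ℚ.+ (b ℚ.- d)
      regroup = solve 4 (λ a b c d → (a :+ b) :- (c :+ d) := (a :- c) :+ (b :- d)) refl
      halves : ∀ e → ℚ.½ ℚ.* e ℚ.+ ℚ.½ ℚ.* e ≡ e
      halves = solve 1 (λ e → con ℚ.½ :* e :+ con ℚ.½ :* e := e) refl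

    neg-cauchy : ∀ x → IsCauchy x → IsCauchy (λ n → ℚ.- x n)
    neg-cauchy x cx ε ε>0 with cx ε ε>0
    ... | N , px = N , λ m n le-m le-n →
            subst (ℚ._< ε) (trans (sym (ℚ.∣-p∣≡∣p∣ (x m ℚ.- x n)))
                                  (cong ℚ.∣_∣ (flip (x m) (x n))))
                  (px m n le-m le-n)
      where
      flip : ∀ a b → ℚ.- (a ℚ.- b) ≡ ℚ.- a ℚ.- (ℚ.- b)
      flip = solve 2 (λ a b → :- (a :- b) := :- a :- (:- b)) refl

    divide : ∀ {c ε} → 0ℚ ℚ.< c → 0ℚ ℚ.< ε → ∃ λ δ → 0ℚ ℚ.< δ × c ℚ.* δ ≡ ε
    divide {c} {ε} c>0 ε>0 = 1/c ℚ.* ε , *-pos {1/c} {ε} (pos⇒1/> c>0) ε>0 ,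
      trans (sym (ℚ.*-assoc c 1/c ε))
            (trans (cong (ℚ._* ε) (ℚ.*-inverseʳ c {{ℚ.>-nonZero c>0}})) (ℚ.*-identityˡ ε))
      where
      1/c : ℚ
      1/c = (ℚ.1/ c) {{ℚ.>-nonZero c>0}}

    estimate : ∀ {k δ} p q → 0ℚ ℚ.< k → ℚ.∣ p ∣ ℚ.≤ k → ℚ.∣ q ∣ ℚ.< δ →
               ℚ.∣ p ℚ.* q ∣ ℚ.< k ℚ.* δ
    estimate {k} {δ} p q k>0 p≤k q<δ = begin-strict
      ℚ.∣ p ℚ.* q ∣          ≡⟨ ℚ.∣p*q∣≡∣p∣*∣q∣ p q ⟩
      ℚ.∣ p ∣ ℚ.* ℚ.∣ q ∣    ≤⟨ ℚ.*-monoʳ-≤-nonNeg ℚ.∣ q ∣ {{ℚ.∣-∣-nonNeg q}} p≤k ⟩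
      k ℚ.* ℚ.∣ q ∣          <⟨ ℚ.*-monoʳ-<-pos k {{ℚ.positive k>0}} q<δ ⟩
      k ℚ.* δ                ∎

    *-estimate : ∀ {a b δ} p q r s → 0ℚ ℚ.< a → 0ℚ ℚ.< b →
                 ℚ.∣ p ∣ ℚ.≤ a → ℚ.∣ s ∣ ℚ.≤ b →
                 ℚ.∣ p ℚ.- r ∣ ℚ.< δ → ℚ.∣ q ℚ.- s ∣ ℚ.< δ →
                 ℚ.∣ p ℚ.* q ℚ.- r ℚ.* s ∣ ℚ.< (a ℚ.+ b) ℚ.* δ
    *-estimate {a} {b} {δ} p q r s a>0 b>0 p≤a s≤b p-r<δ q-s<δ = begin-strict
      ℚ.∣ p ℚ.* q ℚ.- r ℚ.* s ∣
        ≡⟨ cong ℚ.∣_∣ (regroup p q r s) ⟩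
      ℚ.∣ p ℚ.* (q ℚ.- s) ℚ.+ s ℚ.* (p ℚ.- r) ∣
        ≤⟨ ℚ.∣p+q∣≤∣p∣+∣q∣ (p ℚ.* (q ℚ.- s)) (s ℚ.* (p ℚ.- r)) ⟩
      ℚ.∣ p ℚ.* (q ℚ.- s) ∣ ℚ.+ ℚ.∣ s ℚ.* (p ℚ.- r) ∣
        <⟨ ℚ.+-mono-< {ℚ.∣ p ℚ.* (q ℚ.- s) ∣} {a ℚ.* δ} {ℚ.∣ s ℚ.* (p ℚ.- r) ∣} {b ℚ.* δ}
             (estimate p (q ℚ.- s) a>0 p≤a q-s<δ) (estimate s (p ℚ.- r) b>0 s≤b p-r<δ) ⟩
      a ℚ.* δ ℚ.+ b ℚ.* δ
        ≡⟨ ℚ.*-distribʳ-+ δ a b ⟨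
      (a ℚ.+ b) ℚ.* δ ∎
      where
      regroup : ∀ p q r s → p ℚ.* q ℚ.- r ℚ.* s ≡ p ℚ.* (q ℚ.- s) ℚ.+ s ℚ.* (p ℚ.- r)
      regroup = solve 4 (λ p q r s → p :* q :- r :* s := p :* (q :- s) :+ s :* (p :- r)) refl

    *-cauchy : ∀ x y → IsCauchy x → IsCauchy y → IsCauchy (λ n → x n ℚ.* y n)
    *-cauchy x y cx cy ε ε>0 =
      let (a , K , a>0 , x≤a) = bound x cx
          (b , L , b>0 , y≤b) = bound y cy
          (δ , δ>0 , [a+b]δ≡ε) =
            divide {a ℚ.+ b} {ε} (ℚ.+-mono-< {0ℚ} {a} {0ℚ} {b} a>0 b>0) ε>0
          (M , px) = cx δ δ>0
          (N , py) = cy δ δ>0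
      in (K ℕ.⊔ L) ℕ.⊔ (M ℕ.⊔ N) , λ m n le-m le-n →
      let M⊔N≤m = ℕ.m⊔n≤o⇒n≤o (K ℕ.⊔ L) (M ℕ.⊔ N) le-m
          M⊔N≤n = ℕ.m⊔n≤o⇒n≤o (K ℕ.⊔ L) (M ℕ.⊔ N) le-n
          K≤m   = ℕ.m⊔n≤o⇒m≤o K L (ℕ.m⊔n≤o⇒m≤o (K ℕ.⊔ L) (M ℕ.⊔ N) le-m)
          L≤n   = ℕ.m⊔n≤o⇒n≤o K L (ℕ.m⊔n≤o⇒m≤o (K ℕ.⊔ L) (M ℕ.⊔ N) le-n)
      in subst (ℚ.∣ x m ℚ.* y m ℚ.- x n ℚ.* y n ∣ ℚ.<_) [a+b]δ≡ε
           (*-estimate {a} {b} {δ} (x m) (y m) (x n) (y n) a>0 b>0 (x≤a m K≤m) (y≤b n L≤n)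
             (px m n (ℕ.m⊔n≤o⇒m≤o M N M⊔N≤m) (ℕ.m⊔n≤o⇒m≤o M N M⊔N≤n))
             (py m n (ℕ.m⊔n≤o⇒n≤o M N M⊔N≤m) (ℕ.m⊔n≤o⇒n≤o M N M⊔N≤n)))

infix  4 _≈ᴿ_ _<ᴿ_
infixl 6 _+ᴿ_
infixl 7 _*ᴿ_
infix  8 -ᴿ_

record _≈ᴿ_ (x y : ℝ) : Set where
  constructor mk≈ᴿ
  field
    close : ∀ ε → 0ℚ ℚ.< ε → ∃ λ N → ∀ n → N ℕ.≤ n → ℚ.∣ seq x n ℚ.- seq y n ∣ ℚ.< ε

record _<ᴿ_ (x y : ℝ) : Set where
  constructor mk<ᴿ
  field
    gap   : ℚ
    gap>0 : 0ℚ ℚ.< gap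
    above : ∃ λ N → ∀ n → N ℕ.≤ n → seq x n ℚ.+ gap ℚ.< seq y n

fromℚ : ℚ → ℝ
seq    (fromℚ q) _     = q
cauchy (fromℚ q) ε ε>0 = 0 , λ _ _ _ _ →
  subst (λ p → ℚ.∣ p ∣ ℚ.< ε) (sym (ℚ.+-inverseʳ q)) ε>0

0ᴿ 1ᴿ : ℝ
0ᴿ = fromℚ 0ℚ
1ᴿ = fromℚ 1ℚ

_+ᴿ_ _*ᴿ_ : ℝ → ℝ → ℝ
seq    (x +ᴿ y) n = seq x n ℚ.+ seq y n
cauchy (x +ᴿ y)   = Bounds.+-cauchy (seq x) (seq y) (cauchy x) (cauchy y)
seq    (x *ᴿ y) n = seq x n ℚ.* seq y n
cauchy (x *ᴿ y)   = Bounds.*-cauchy (seq x) (seq y) (cauchy x) (cauchy y)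

-ᴿ_ : ℝ → ℝ
seq    (-ᴿ x) n = ℚ.- seq x n
cauchy (-ᴿ x)   = Bounds.neg-cauchy (seq x) (cauchy x)

infix  4 _≈_
infixl 6 _+_
infixl 7 _*_
infix  8 -_

record ℂ : Set where
  no-eta-equality
  field
    re im : ℝ

open ℂ public

record _≈_ (z w : ℂ) : Set where
  constructor mk≈
  field
    re≈ : re z ≈ᴿ re w
    im≈ : im z ≈ᴿ im w

_+_ _*_ : ℂ → ℂ → ℂ
re (z + w) = re z +ᴿ re w
im (z + w) = im z +ᴿ im w
re (z * w) = re z *ᴿ re w +ᴿ -ᴿ (im z *ᴿ im w)
im (z * w) = re z *ᴿ im w +ᴿ im z *ᴿ re w

-_ : ℂ → ℂ
re (- z) = -ᴿ re z
im (- z) = -ᴿ im z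

fromℝ : ℝ → ℂ
re (fromℝ a) = a
im (fromℝ a) = 0ᴿ

0# 1# : ℂ
0# = fromℝ 0ᴿ
1# = fromℝ 1ᴿ

conj : ℂ → ℂ
re (conj z) = re z
im (conj z) = -ᴿ im z

ℂ-rawRing : RawRing 0ℓ 0ℓ
ℂ-rawRing = record
  { Carrier = ℂ ; _≈_ = _≈_ ; _+_ = _+_ ; _*_ = _*_ ; -_ = -_ ; 0# = 0# ; 1# = 1# }

∑ : ∀ {n} → (Fin n → ℂ) → ℂ
∑ = sum (RawRing.+-rawMonoid ℂ-rawRing)

UnitModulus : ℂ → Set
UnitModulus z = z * conj z ≈ 1#

[_] : ∀ {p} {P : Set p} → Dec P → ℂ
[ P? ] = if does P? then 1# else 0#

record FiniteSet : Set₁ where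
  field
    Carrier     : Set
    size        : ℕ
    enumeration : Fin size ↔ Carrier

  elem : Fin size → Carrier
  elem = Inverse.to enumeration

  infix 4 _≟_
  _≟_ : DecidableEquality Carrier
  _≟_ = Dec.via-injection (↔⇒↣ (↔-sym enumeration)) Fin._≟_

  any? : ∀ {P : Carrier → Set} → (∀ x → Dec (P x)) → Dec (∃ P)
  any? {P} P? = Dec.map′
    (λ (i , p) → elem i , p)
    (λ (x , p) → Inverse.from enumeration x ,
                 subst P (sym (Inverse.strictlyInverseˡ enumeration x)) p)
    (Fin.any? (P? ∘ elem))

  ∑ˢ : (Carrier → ℂ) → ℂ
  ∑ˢ f = ∑ (f ∘ elem)

  count : ∀ {P : Carrier → Set} → (∀ x → Dec (P x)) → ℕ
  count P? = length (filter P? (map elem (allFin size)))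

open FiniteSet using (Carrier; size)

⟨_⟩ : ℕ → FiniteSet
⟨ n ⟩ = record { Carrier = Fin n ; size = n ; enumeration = ↔-id (Fin n) }

infixr 2 _⊠_
_⊠_ : FiniteSet → FiniteSet → FiniteSet
V ⊠ W = record
  { Carrier     = Carrier V × Carrier W
  ; size        = size V ℕ.* size W
  ; enumeration = (FiniteSet.enumeration V ×-↔ FiniteSet.enumeration W) ↔-∘ Fin.*↔×
  }

Mat : FiniteSet → Set
Mat V = Carrier V → Carrier V → ℂ

module Matrices (V : FiniteSet) where
  open FiniteSet V using (_≟_; ∑ˢ)

  infix  4 _≈ᴹ_
  infixl 7 _·_

  _≈ᴹ_ : Rel (Mat V) 0ℓ
  M ≈ᴹ N = ∀ u v → M u v ≈ N u v

  𝕀 : Mat V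
  𝕀 u v = [ u ≟ v ]

  _·_ : Mat V → Mat V → Mat V
  (M · N) u v = ∑ˢ λ w → M u w * N w v

  AreInverse : Mat V → Mat V → Set
  AreInverse M N = M · N ≈ᴹ 𝕀 × N · M ≈ᴹ 𝕀

record Graph (V : FiniteSet) : Set₁ where
  field
    Adj    : Rel (Carrier V) 0ℓ
    adj?   : Decidable Adj
    symm   : Symmetric Adj
    irrefl : Irreflexive _≡_ Adj

  open FiniteSet V using (_≟_; any?; count)

  adjacency : Mat V
  adjacency u v = [ adj? u v ]

  Walk : ℕ → Rel (Carrier V) 0ℓ
  Walk zero    u v = u ≡ v
  Walk (suc k) u v = ∃ λ w → Adj u w × Walk k w v

  walk? : ∀ k → Decidable (Walk k)
  walk? zero    u v = u ≟ v
  walk? (suc k) u v = any? λ w → adj? u w ×-dec walk? k w v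

  Dist : ℕ → Rel (Carrier V) 0ℓ
  Dist k u v = Walk k u v × (∀ {j} → j ℕ.< k → ¬ Walk j u v)

  dist? : ∀ k → Decidable (Dist k)
  dist? k u v = walk? k u v ×-dec ℕ.allUpTo? (λ j → ¬? (walk? j u v)) k

  Connected : Set
  Connected = ∀ u v → ∃ λ k → Walk k u v

  -- Pairs at infinite distance are not constrained; the definition is only
  -- used together with Connected.
  DistanceRegular : Set
  DistanceRegular = ∃ λ (p : ℕ → ℕ → ℕ → ℕ) → ∀ {k} u v → Dist k u v →
    ∀ i j → count (λ w → dist? i u w ×-dec dist? j v w) ≡ p k i j

  IsDiameter : ℕ → Set
  IsDiameter D = (∀ {k} u v → Dist k u v → k ℕ.≤ D) × ∃₂ λ u v → Dist D u v

  -- The partition into fibres is given by the map sending a vertex to the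
  -- index of its fibre.
  record IsCoverOfComplete {n} (fibre : Carrier V → Fin n) : Set where
    field
      nonempty    : Surjective _≡_ _≡_ fibre
      independent : ∀ {u v} → fibre u ≡ fibre v → ¬ Adj u v
      matching    : ∀ {i j} → i ≢ j →
                    let InUnion = λ u → fibre u ≡ i ⊎ fibre u ≡ j in
                    ∀ u → InUnion u → ∃! _≡_ λ v → InUnion v × Adj u v

  record IsDRACKN {n} (fibre : Carrier V → Fin n) : Set where
    field
      connected       : Connected
      distanceRegular : DistanceRegular
      cover           : IsCoverOfComplete fibre
      antipodal       : ∃ λ D → IsDiameter D ×
                        (∀ u v → u ≢ v → (Dist D u v ⇔ fibre u ≡ fibre v))

-- The first element of Fin n, for n known to be nonzero.
first : ∀ {n} → Fin n → Fin n
first {suc n} _ = zero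

-- Covers with vertex set [n] × F and fibres {i} × F.
module BlockCover (n : ℕ) (F : FiniteSet) where
  private V = ⟨ n ⟩ ⊠ F
  open Matrices V
  open FiniteSet F using () renaming (_≟_ to _≟ᶠ_)

  -- Block diagonal, with first block I and j-th block A₁ⱼ for j > 1.
  normalizer : Mat V → Mat V
  normalizer A (i , x) (j , y) with i Fin.≟ j | j Fin.≟ first j
  ... | Dec.no _  | _         = 0#
  ... | Dec.yes _ | Dec.yes _ = [ x ≟ᶠ y ]
  ... | Dec.yes _ | Dec.no _  = A (first j , x) (j , y)

  IsNormalization : Mat V → Mat V → Set
  IsNormalization A N = ∃ λ E →
    AreInverse (normalizer A) E × N ≈ᴹ normalizer A · A · E

  -- σ is the permutation represented by the (i, j) block of N.
  Represents : Mat V → Fin n → Fin n → (Carrier F ↔ Carrier F) → Set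
  Represents N i j σ = ∀ x y → N (i , x) (j , y) ≈ [ x ≟ᶠ Inverse.to σ y ]

  data Π (N : Mat V) : (Carrier F ↔ Carrier F) → Set where
    block : ∀ {i j σ} → i ≢ j → Represents N i j σ → Π N σ
    ident : Π N (↔-id _)
    comp  : ∀ {σ τ} → Π N σ → Π N τ → Π N (σ ↔-∘ τ)
    inv   : ∀ {σ} → Π N σ → Π N (↔-sym σ)

  ActsRegularly : ((Carrier F ↔ Carrier F) → Set) → Set
  ActsRegularly P =
    (∀ x y → ∃ λ σ → P σ × Inverse.to σ x ≡ y) ×
    (∀ {σ} → P σ → ∀ x → Inverse.to σ x ≡ x → ∀ y → Inverse.to σ y ≡ y)

  Commutes : ((Carrier F ↔ Carrier F) → Set) → Set
  Commutes P = ∀ {σ τ} → P σ → P τ → ∀ x →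
    Inverse.to σ (Inverse.to τ x) ≡ Inverse.to τ (Inverse.to σ x)

  IsRegular IsAbelian : Graph V → Set
  IsRegular G = ∃ λ N → IsNormalization (Graph.adjacency G) N × ActsRegularly (Π N)
  IsAbelian G = ∃ λ N → IsNormalization (Graph.adjacency G) N × Commutes (Π N)

  IsRegularAbelianDRACKN : Graph V → Set
  IsRegularAbelianDRACKN G = Graph.IsDRACKN G proj₁ × IsRegular G × IsAbelian G

record FiniteAbelianGroup : Set₁ where
  field
    finiteSet : FiniteSet

  open FiniteSet finiteSet public renaming (Carrier to Element)

  infixl 7 _∙_
  field
    _∙_            : Element → Element → Element
    ε              : Element
    _⁻¹            : Element → Element
    isAbelianGroup : IsAbelianGroup _≡_ _∙_ ε _⁻¹

  abelianGroup : AbelianGroup 0ℓ 0ℓ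
  abelianGroup = record { isAbelianGroup = isAbelianGroup }

module GroupAlgebra (Γ : FiniteAbelianGroup) where
  open FiniteAbelianGroup Γ

  infix  4 _≈ᴬ_
  infixl 7 _⋆_

  -- x g is the coefficient of g.
  ℂ[Γ] : Set
  ℂ[Γ] = Element → ℂ

  _≈ᴬ_ : Rel ℂ[Γ] 0ℓ
  x ≈ᴬ y = ∀ g → x g ≈ y g

  ι : Element → ℂ[Γ]
  ι g h = [ g ≟ h ]

  0ᴬ 1ᴬ : ℂ[Γ]
  0ᴬ _ = 0#
  1ᴬ = ι ε

  _⋆_ : ℂ[Γ] → ℂ[Γ] → ℂ[Γ]
  (x ⋆ y) g = ∑ˢ λ h → x h * y (h ⁻¹ ∙ g)

  record Character : Set where
    field
      ⟦_⟧ : Element → ℂ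
      -- Values are roots of unity, since Γ is finite.
      isMonoidHomomorphism : MonoidMorphisms.IsMonoidHomomorphism
        (AbelianGroup.rawMonoid abelianGroup)
        (RawRing.*-rawMonoid ℂ-rawRing) ⟦_⟧

  extend : Character → ℂ[Γ] → ℂ
  extend α x = ∑ˢ λ g → x g * Character.⟦_⟧ α g

  cayley : ℂ[Γ] → Mat finiteSet
  cayley x g h = ∑ˢ λ k → x k * [ k ∙ h ≟ g ]

  Matᴬ : ℕ → Set
  Matᴬ n = Fin n → Fin n → ℂ[Γ]

  infixl 7 _·ᴬ_ _▸_

  _·ᴬ_ : ∀ {n} → Matᴬ n → Matᴬ n → Matᴬ n
  (M ·ᴬ N) i j g = ∑ λ k → (M i k ⋆ N k j) g

  𝕀ᴬ : ∀ {n} → Matᴬ n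
  𝕀ᴬ i j = if does (i Fin.≟ j) then 1ᴬ else 0ᴬ

  _▸_ : ∀ {n} → Element → Matᴬ n → Matᴬ n
  (g ▸ M) i j = ι g ⋆ M i j

  -- Membership of M in the ℂ-span of {gI} ∪ {gB}.
  InSpan : ∀ {n} → Matᴬ n → Matᴬ n → Set
  InSpan B M = ∃₂ λ (a b : Element → ℂ) → ∀ i j h →
    M i j h ≈ (∑ˢ λ g → a g * (g ▸ 𝕀ᴬ) i j h) + (∑ˢ λ g → b g * (g ▸ B) i j h)

  record IsRoux {n} (B : Matᴬ n) : Set where
    field
      2≤n          : 2 ℕ.≤ n
      zeroDiagonal : ∀ i → B i i ≈ᴬ 0ᴬ
      offDiagonal  : ∀ {i j} → i ≢ j → ∃ λ g → B i j ≈ᴬ ι g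
      inverse      : ∀ {i j} → i ≢ j → B j i ⋆ B i j ≈ᴬ 1ᴬ
      -- The span is a subspace containing I, so it is an algebra exactly
      -- when it is closed under products.
      algebra      : ∀ M N → InSpan B M → InSpan B N → InSpan B (M ·ᴬ N)

  applyCharacter : ∀ {n} → Character → Matᴬ n → Mat ⟨ n ⟩
  applyCharacter α B i j = extend α (B i j)

  cayleyMatrix : ∀ {n} → Matᴬ n → Mat (⟨ n ⟩ ⊠ finiteSet)
  cayleyMatrix B (i , g) (j , h) = cayley (B i j) g h

  IsRouxGraph : ∀ {n} → Matᴬ n → Graph (⟨ n ⟩ ⊠ finiteSet) → Set
  IsRouxGraph {n} B G = Graph.adjacency G ≈ᴹ cayleyMatrix B
    where open Matrices (⟨ n ⟩ ⊠ finiteSet)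

ℂ^_ : ℕ → Set
ℂ^ m = Fin m → ℂ

module _ {m : ℕ} where
  infix 4 _≈ⱽ_

  _≈ⱽ_ : Rel (ℂ^ m) 0ℓ
  v ≈ⱽ w = ∀ k → v k ≈ w k

  0ⱽ : ℂ^ m
  0ⱽ _ = 0#

  ⟪_,_⟫ : ℂ^ m → ℂ^ m → ℂ
  ⟪ v , w ⟫ = ∑ λ k → v k * conj (w k)

  lincomb : ∀ {n} → (Fin n → ℂ) → (Fin n → ℂ^ m) → ℂ^ m
  lincomb c v k = ∑ λ i → c i * v i k

  _∈span_ : ∀ {n} → ℂ^ m → (Fin n → ℂ^ m) → Set
  w ∈span v = ∃ λ c → w ≈ⱽ lincomb c v

  LinearlyIndependent : ∀ {n} → (Fin n → ℂ^ m) → Set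
  LinearlyIndependent v = ∀ c → lincomb c v ≈ⱽ 0ⱽ → ∀ i → c i ≈ 0#

-- A line through the origin, given by a nonzero vector spanning it.
record Line (m : ℕ) : Set where
  field
    direction : ℂ^ m
    nonzero   : ¬ direction ≈ⱽ 0ⱽ

open Line public

module _ {m : ℕ} where
  _∈ˡ_ : ℂ^ m → Line m → Set
  w ∈ˡ ℓ = ∃ λ c → ∀ k → w k ≈ c * direction ℓ k

  _∈spanˡ_ : ∀ {n} → ℂ^ m → (Fin n → Line m) → Set
  w ∈spanˡ ℓ = w ∈span (direction ∘ ℓ)

  SpanHasDimension : ∀ {n} → (Fin n → Line m) → ℕ → Set
  SpanHasDimension ℓ k = ∃ λ (e : Fin k → ℂ^ m) →
    LinearlyIndependent e × (∀ w → w ∈spanˡ ℓ ⇔ w ∈span e)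

  LinearlyDependentLines : ∀ {n} → (Fin n → Line m) → Set
  LinearlyDependentLines {n} ℓ = ∃ λ k → k ℕ.< n × SpanHasDimension ℓ k

  SpanAll : ∀ {n} → (Fin n → Line m) → Set
  SpanAll ℓ = ∀ w → w ∈spanˡ ℓ

  UnitRepresentatives : ∀ {n} → (Fin n → ℂ^ m) → (Fin n → Line m) → Set
  UnitRepresentatives φ ℓ = ∀ i → φ i ∈ˡ ℓ i × ⟪ φ i , φ i ⟫ ≈ 1#

  gram : ∀ {n} → (Fin n → ℂ^ m) → Mat ⟨ n ⟩
  gram φ i j = ⟪ φ j , φ i ⟫

  record HasSignatureMatrix {n} (φ : Fin n → ℂ^ m) (S : Mat ⟨ n ⟩) : Set where
    field
      selfAdjoint  : ∀ i j → S i j ≈ conj (S j i)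
      zeroDiagonal : ∀ i → S i i ≈ 0#
      unimodular   : ∀ {i j} → i ≢ j → UnitModulus (S i j)
      gram-eq      : ∃ λ μ → 0ᴿ <ᴿ μ ×
                     (∀ i j → gram φ i j ≈ Matrices.𝕀 ⟨ n ⟩ i j + fromℝ μ * S i j)

record DRACKNLines {n m : ℕ} (ℓ : Fin n → Line m) : Set₁ where
  field
    dependent : LinearlyDependentLines ℓ
    Γ         : FiniteAbelianGroup

  open GroupAlgebra Γ

  field
    B         : Matᴬ n
    isRoux    : IsRoux B
    G         : Graph (⟨ n ⟩ ⊠ FiniteAbelianGroup.finiteSet Γ)
    rouxGraph : IsRouxGraph B G
    isDRACKN  : BlockCover.IsRegularAbelianDRACKN n (FiniteAbelianGroup.finiteSet Γ) G
    α         : Character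
    φ         : Fin n → ℂ^ m
    represent : UnitRepresentatives φ ℓ
    signature : HasSignatureMatrix φ (applyCharacter α B)

{-# OPTIONS --safe #-}

-- In a DRACKN, two vertices in different fibres have a₁ or c₂ common neighbours, according as they are
-- adjacent or not. Hence the image S of the roux under any nontrivial character satisfies
-- S² = (n - 1) I + δ S with the same δ = a₁ - c₂. Comparing traces, the Gram matrix I + μ S of d² lines spanning
-- a space of dimension d or d² - d yields a real ν, equal to μ or -(d - 1) μ respectively, for which M = I + ν S
-- satisfies M² = d M, 2 + ν δ = d and ν² (d + 1) = 1. So M is the Gram matrix of d² equiangular vectors in
-- dimension d, which attain the second-order Welch bound, and T = M ∘ M satisfies (d + 1) T² = 2 d T. Since
-- T = I + ν² S′ for the image S′ of the roux under the squared character, this forces (S′²)ᵢⱼ = -2 S′ᵢⱼ off the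
-- diagonal. The squared character is therefore nontrivial and δ = -2, so d = 2 - 2 ν. This contradicts μ > 0
-- when ν = μ, and gives (d - 2)² (d + 1) = 4, that is d = 3, in the other case.

module Submission where

open import Data.Nat using (ℕ; _^_; _∸_; _≥_)
open import Data.Fin using (Fin)
open import Data.Product using (∃; _×_)
open import Relation.Nullary using (¬_)
open import Relation.Binary.PropositionalEquality using (_≡_)
open import Defs using (Line; DRACKNLines; SpanAll)

open import Algebra.Bundles using (AbelianGroup; CommutativeRing)
open import Algebra.Morphism.Structures using (module MonoidMorphisms)
import Algebra.Properties.Group
import Algebra.Properties.Semiring.Mult
import Algebra.Properties.Semiring.Sum
import Algebra.Solver.Ring
import Algebra.Solver.Ring.AlmostCommutativeRing as ACR
open import Algebra.Structures using (IsAbelianGroup; IsCommutativeRing)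
open import Data.Empty using (⊥)
open import Data.Fin.Base using (zero; suc; _↑ˡ_; _↑ʳ_; combine)
import Data.Fin.Properties as Fin
open import Data.List.Base using (filter; length; tabulate)
open import Data.List.Properties using (map-tabulate)
open import Data.Maybe.Base using (Maybe; just; nothing)
open import Data.Nat.Base as ℕ using (zero; suc; pred; s≤s; z≤n)
open import Data.Nat.Induction using (<-rec)
import Data.Nat.Properties as ℕ
open import Data.Product.Base using (∃₂; _,_; proj₁; proj₂)
open import Data.Rational.Base as ℚ using (ℚ; 0ℚ; 1ℚ; ½)
import Data.Rational.Properties as ℚ
import Data.Rational.Solver as ℚ-Solver
open import Data.Sum.Base using (_⊎_; inj₁; inj₂)
open import Defs hiding (Line; DRACKNLines; SpanAll)
open import Function.Base using (_∘_; _$_; id)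
open import Function.Bundles using (_↔_; mk↔ₛ′; module Equivalence; module Inverse)
open import Function.Construct.Composition using (_↔-∘_)
open import Function.Construct.Symmetry using (↔-sym)
open import Level using (0ℓ)
open import Relation.Binary.PropositionalEquality as ≡ using (_≢_; cong; subst)
import Relation.Binary.Reasoning.Setoid
open import Relation.Binary.Structures using (IsEquivalence)
open import Relation.Nullary using (Dec; yes; no; contradiction; _×-dec_)
open import Relation.Nullary.Decidable using (decidable-stable)

-- Real and complex numbers

-- The crux is that δ is read off from a character other than the one that defines the lines.
-- Distance-regularity gives the character and its square the same δ, while tightness of the tensor
-- squares prescribes the value -2 for the square alone.
--
-- The obstacle is that equality of real numbers is undecidable, so that ranks, eigenvalues and case
-- distinctions on numbers are not directly available. Ranks are replaced by traces of products with
-- one-sided inverses, division by cancellation of factors known to be nonzero, and the equality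
-- case of the Welch bound by the vanishing of a Hermitian matrix F for which tr F² is a multiple of
-- the defect in the bound. Whether a character is trivial is settled only under a double negation.
-- This loses nothing: the first claim is a negation, and the second an equation between natural
-- numbers, which is stable.

Null : (ℕ → ℚ) → Set
Null x = ∀ ε → 0ℚ ℚ.< ε → ∃ λ N → ∀ n → N ℕ.≤ n → ℚ.∣ x n ∣ ℚ.< ε

Null-resp : ∀ {x y} → (∀ n → x n ≡ y n) → Null x → Null y
Null-resp x≡y x→0 ε ε>0 =
  let N , x<ε = x→0 ε ε>0 in N , λ n N≤n → subst (λ q → ℚ.∣ q ∣ ℚ.< ε) (x≡y n) (x<ε n N≤n)

½*-pos : ∀ {ε} → 0ℚ ℚ.< ε → 0ℚ ℚ.< ½ ℚ.* ε
½*-pos {ε} ε>0 = ℚ.positive⁻¹ _ {{ℚ.pos*pos⇒pos ½ ε {{ℚ.positive ε>0}}}}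

½+½ : ∀ ε → ½ ℚ.* ε ℚ.+ ½ ℚ.* ε ≡ ε
½+½ = solve 1 (λ e → con ½ :* e :+ con ½ :* e := e) ≡.refl
  where open ℚ-Solver.+-*-Solver

Null-+ : ∀ {x y} → Null x → Null y → Null (λ n → x n ℚ.+ y n)
Null-+ {x} {y} x→0 y→0 ε ε>0 =
  let M , px = x→0 (½ ℚ.* ε) (½*-pos ε>0)
      N , py = y→0 (½ ℚ.* ε) (½*-pos ε>0)
  in M ℕ.⊔ N , λ n le → begin-strict
       ℚ.∣ x n ℚ.+ y n ∣          ≤⟨ ℚ.∣p+q∣≤∣p∣+∣q∣ (x n) (y n) ⟩
       ℚ.∣ x n ∣ ℚ.+ ℚ.∣ y n ∣    <⟨ ℚ.+-mono-< (px n (ℕ.m⊔n≤o⇒m≤o M N le)) (py n (ℕ.m⊔n≤o⇒n≤o M N le)) ⟩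
       ½ ℚ.* ε ℚ.+ ½ ℚ.* ε        ≡⟨ ½+½ ε ⟩
       ε                          ∎
  where open ℚ.≤-Reasoning

Null-neg : ∀ {x} → Null x → Null (λ n → ℚ.- x n)
Null-neg {x} x→0 ε ε>0 =
  let N , p = x→0 ε ε>0 in N , λ n le → subst (ℚ._< ε) (≡.sym (ℚ.∣-p∣≡∣p∣ (x n))) (p n le)

eventuallyBounded : ∀ (x : ℝ) → ∃₂ λ b N → 0ℚ ℚ.< b × (∀ n → N ℕ.≤ n → ℚ.∣ seq x n ∣ ℚ.≤ b)
eventuallyBounded x with cauchy x 1ℚ (ℚ.positive⁻¹ 1ℚ)
... | N , close = ℚ.∣ seq x N ∣ ℚ.+ 1ℚ , N , b>0 , λ n N≤n → begin
        ℚ.∣ seq x n ∣                                     ≡⟨ cong ℚ.∣_∣ (split (seq x n) (seq x N)) ⟩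
        ℚ.∣ seq x N ℚ.+ (seq x n ℚ.- seq x N) ∣           ≤⟨ ℚ.∣p+q∣≤∣p∣+∣q∣ (seq x N) (seq x n ℚ.- seq x N) ⟩
        ℚ.∣ seq x N ∣ ℚ.+ ℚ.∣ seq x n ℚ.- seq x N ∣
          ≤⟨ ℚ.+-monoʳ-≤ ℚ.∣ seq x N ∣ (ℚ.<⇒≤ (close n N N≤n ℕ.≤-refl)) ⟩
        ℚ.∣ seq x N ∣ ℚ.+ 1ℚ                              ∎
  where
  open ℚ.≤-Reasoning
  split : ∀ p q → p ≡ q ℚ.+ (p ℚ.- q)
  split = solve 2 (λ p q → p := q :+ (p :- q)) ≡.refl
    where open ℚ-Solver.+-*-Solver
  b>0 : 0ℚ ℚ.< ℚ.∣ seq x N ∣ ℚ.+ 1ℚ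
  b>0 = ℚ.+-mono-≤-< (ℚ.0≤∣p∣ (seq x N)) (ℚ.positive⁻¹ 1ℚ)

-- If b eventually bounds a, then it suffices that x falls below ε / b. Congruence of multiplication
-- rests on this.
Null-*ˡ : ∀ (a : ℝ) {x} → Null x → Null (λ n → seq a n ℚ.* x n)
Null-*ˡ a {x} x→0 ε ε>0 =
  let b , M , b>0 , a≤b = eventuallyBounded a
      instance
        bpos = ℚ.positive b>0
        bnz  = ℚ.pos⇒nonZero b
        b⁻¹pos = ℚ.1/pos⇒pos b
        εpos = ℚ.positive ε>0
      N , p = x→0 (ℚ.1/ b ℚ.* ε) (ℚ.positive⁻¹ _ {{ℚ.pos*pos⇒pos (ℚ.1/ b) ε}})
  in M ℕ.⊔ N , λ n le → begin-strict
       ℚ.∣ seq a n ℚ.* x n ∣          ≡⟨ ℚ.∣p*q∣≡∣p∣*∣q∣ (seq a n) (x n) ⟩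
       ℚ.∣ seq a n ∣ ℚ.* ℚ.∣ x n ∣
         ≤⟨ ℚ.*-monoʳ-≤-nonNeg ℚ.∣ x n ∣ {{ℚ.∣-∣-nonNeg (x n)}} (a≤b n (ℕ.m⊔n≤o⇒m≤o M N le)) ⟩
       b ℚ.* ℚ.∣ x n ∣                <⟨ ℚ.*-monoʳ-<-pos b (p n (ℕ.m⊔n≤o⇒n≤o M N le)) ⟩
       b ℚ.* (ℚ.1/ b ℚ.* ε)           ≡⟨ ℚ.*-assoc b (ℚ.1/ b) ε ⟨
       b ℚ.* ℚ.1/ b ℚ.* ε             ≡⟨ cong (ℚ._* ε) (ℚ.*-inverseʳ b) ⟩
       1ℚ ℚ.* ε                       ≡⟨ ℚ.*-identityˡ ε ⟩
       ε                              ∎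
  where open ℚ.≤-Reasoning

private
  difference : ∀ {x y} → x ≈ᴿ y → Null (λ n → seq x n ℚ.- seq y n)
  difference = _≈ᴿ_.close

pointwise : ∀ {x y} → (∀ n → seq x n ≡ seq y n) → x ≈ᴿ y
pointwise {x} {y} x≡y = mk≈ᴿ λ ε ε>0 → 0 , λ n _ →
  subst (λ q → ℚ.∣ q ∣ ℚ.< ε)
    (≡.sym (≡.trans (cong (ℚ._- seq y n) (x≡y n)) (ℚ.+-inverseʳ (seq y n)))) ε>0

module ℝ-cong where
  open ℚ-Solver.+-*-Solver

  ≈ᴿ-refl : ∀ {x} → x ≈ᴿ x
  ≈ᴿ-refl = pointwise λ _ → ≡.refl

  ≈ᴿ-sym : ∀ {x y} → x ≈ᴿ y → y ≈ᴿ x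
  ≈ᴿ-sym {x} {y} p = mk≈ᴿ $ Null-resp
    (λ n → solve 2 (λ a b → :- (a :- b) := b :- a) ≡.refl (seq x n) (seq y n))
    (Null-neg (difference p))

  ≈ᴿ-trans : ∀ {x y z} → x ≈ᴿ y → y ≈ᴿ z → x ≈ᴿ z
  ≈ᴿ-trans {x} {y} {z} p q = mk≈ᴿ $ Null-resp
    (λ n → solve 3 (λ a b c → (a :- b) :+ (b :- c) := a :- c) ≡.refl (seq x n) (seq y n) (seq z n))
    (Null-+ (difference p) (difference q))

  +ᴿ-cong : ∀ {x x′ y y′} → x ≈ᴿ x′ → y ≈ᴿ y′ → x +ᴿ y ≈ᴿ x′ +ᴿ y′
  +ᴿ-cong {x} {x′} {y} {y′} p q = mk≈ᴿ $ Null-resp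
    (λ n → solve 4 (λ a a′ b b′ → (a :- a′) :+ (b :- b′) := (a :+ b) :- (a′ :+ b′)) ≡.refl
             (seq x n) (seq x′ n) (seq y n) (seq y′ n))
    (Null-+ (difference p) (difference q))

  -ᴿ-cong : ∀ {x y} → x ≈ᴿ y → -ᴿ x ≈ᴿ -ᴿ y
  -ᴿ-cong {x} {y} p = mk≈ᴿ $ Null-resp
    (λ n → solve 2 (λ a b → :- (a :- b) := (:- a) :- (:- b)) ≡.refl (seq x n) (seq y n))
    (Null-neg (difference p))

  *ᴿ-cong : ∀ {x x′ y y′} → x ≈ᴿ x′ → y ≈ᴿ y′ → x *ᴿ y ≈ᴿ x′ *ᴿ y′
  *ᴿ-cong {x} {x′} {y} {y′} p q = mk≈ᴿ $ Null-resp
    (λ n → solve 4 (λ a a′ b b′ → a :* (b :- b′) :+ b′ :* (a :- a′) := a :* b :- a′ :* b′) ≡.refl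
             (seq x n) (seq x′ n) (seq y n) (seq y′ n))
    (Null-+ (Null-*ˡ x (difference q)) (Null-*ˡ y′ (difference p)))

open ℝ-cong

≈-refl : ∀ {z} → z ≈ z
≈-refl = mk≈ ≈ᴿ-refl ≈ᴿ-refl

≈-sym : ∀ {z w} → z ≈ w → w ≈ z
≈-sym (mk≈ p q) = mk≈ (≈ᴿ-sym p) (≈ᴿ-sym q)

≈-trans : ∀ {z w v} → z ≈ w → w ≈ v → z ≈ v
≈-trans (mk≈ p q) (mk≈ p′ q′) = mk≈ (≈ᴿ-trans p p′) (≈ᴿ-trans q q′)

+-cong : ∀ {z z′ w w′} → z ≈ z′ → w ≈ w′ → z + w ≈ z′ + w′
+-cong (mk≈ p q) (mk≈ p′ q′) = mk≈ (+ᴿ-cong p p′) (+ᴿ-cong q q′)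

*-cong : ∀ {z z′ w w′} → z ≈ z′ → w ≈ w′ → z * w ≈ z′ * w′
*-cong (mk≈ p q) (mk≈ p′ q′) =
  mk≈ (+ᴿ-cong (*ᴿ-cong p p′) (-ᴿ-cong (*ᴿ-cong q q′))) (+ᴿ-cong (*ᴿ-cong p q′) (*ᴿ-cong q p′))

-‿cong : ∀ {z w} → z ≈ w → - z ≈ - w
-‿cong (mk≈ p q) = mk≈ (-ᴿ-cong p) (-ᴿ-cong q)

conj-cong : ∀ {z w} → z ≈ w → conj z ≈ conj w
conj-cong (mk≈ p q) = mk≈ p (-ᴿ-cong q)

pointwiseᶜ : ∀ {z w} → (∀ n → seq (re z) n ≡ seq (re w) n) → (∀ n → seq (im z) n ≡ seq (im w) n) → z ≈ w
pointwiseᶜ p q = mk≈ (pointwise p) (pointwise q)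

-- Every ring law already holds term by term for the representing sequences, so `pointwiseᶜ` reduces
-- it to an identity in ℚ.
ℂ-isCommutativeRing : IsCommutativeRing _≈_ _+_ _*_ -_ 0# 1#
ℂ-isCommutativeRing = record
  { isRing = record
    { +-isAbelianGroup = record
      { isGroup = record
        { isMonoid = record
          { isSemigroup = record
            { isMagma = record { isEquivalence = isEq ; ∙-cong = +-cong }
            ; assoc = λ x y z → pointwiseᶜ
                (λ n → ℚ.+-assoc (seq (re x) n) (seq (re y) n) (seq (re z) n))
                (λ n → ℚ.+-assoc (seq (im x) n) (seq (im y) n) (seq (im z) n)) }
          ; identity = (λ x → pointwiseᶜ (λ n → ℚ.+-identityˡ _) (λ n → ℚ.+-identityˡ _))
                     , (λ x → pointwiseᶜ (λ n → ℚ.+-identityʳ _) (λ n → ℚ.+-identityʳ _)) }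
        ; inverse = (λ x → pointwiseᶜ (λ n → ℚ.+-inverseˡ (seq (re x) n)) (λ n → ℚ.+-inverseˡ (seq (im x) n)))
                  , (λ x → pointwiseᶜ (λ n → ℚ.+-inverseʳ (seq (re x) n)) (λ n → ℚ.+-inverseʳ (seq (im x) n)))
        ; ⁻¹-cong = -‿cong }
      ; comm = λ x y → pointwiseᶜ (λ n → ℚ.+-comm (seq (re x) n) _) (λ n → ℚ.+-comm (seq (im x) n) _) }
    ; *-cong = *-cong
    ; *-assoc = λ x y z → pointwiseᶜ
        (λ n → solve 6 (λ a b c d e f → (a :* c :- b :* d) :* e :- (a :* d :+ b :* c) :* f
                                     := a :* (c :* e :- d :* f) :- b :* (c :* f :+ d :* e)) ≡.refl
                 (seq (re x) n) (seq (im x) n) (seq (re y) n) (seq (im y) n) (seq (re z) n) (seq (im z) n))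
        (λ n → solve 6 (λ a b c d e f → (a :* c :- b :* d) :* f :+ (a :* d :+ b :* c) :* e
                                     := a :* (c :* f :+ d :* e) :+ b :* (c :* e :- d :* f)) ≡.refl
                 (seq (re x) n) (seq (im x) n) (seq (re y) n) (seq (im y) n) (seq (re z) n) (seq (im z) n))
    ; *-identity =
        (λ x → pointwiseᶜ
          (λ n → solve 2 (λ a b → con 1ℚ :* a :- con 0ℚ :* b := a) ≡.refl (seq (re x) n) (seq (im x) n))
          (λ n → solve 2 (λ a b → con 1ℚ :* b :+ con 0ℚ :* a := b) ≡.refl (seq (re x) n) (seq (im x) n)))
      , (λ x → pointwiseᶜ
          (λ n → solve 2 (λ a b → a :* con 1ℚ :- b :* con 0ℚ := a) ≡.refl (seq (re x) n) (seq (im x) n))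
          (λ n → solve 2 (λ a b → a :* con 0ℚ :+ b :* con 1ℚ := b) ≡.refl (seq (re x) n) (seq (im x) n)))
    ; distrib =
        (λ x y z → pointwiseᶜ
          (λ n → solve 6 (λ a b c d e f → a :* (c :+ e) :- b :* (d :+ f)
                                       := (a :* c :- b :* d) :+ (a :* e :- b :* f)) ≡.refl
                   (seq (re x) n) (seq (im x) n) (seq (re y) n) (seq (im y) n) (seq (re z) n) (seq (im z) n))
          (λ n → solve 6 (λ a b c d e f → a :* (d :+ f) :+ b :* (c :+ e)
                                       := (a :* d :+ b :* c) :+ (a :* f :+ b :* e)) ≡.refl
                   (seq (re x) n) (seq (im x) n) (seq (re y) n) (seq (im y) n) (seq (re z) n) (seq (im z) n)))
      , (λ x y z → pointwiseᶜ
          (λ n → solve 6 (λ a b c d e f → (c :+ e) :* a :- (d :+ f) :* b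
                                       := (c :* a :- d :* b) :+ (e :* a :- f :* b)) ≡.refl
                   (seq (re x) n) (seq (im x) n) (seq (re y) n) (seq (im y) n) (seq (re z) n) (seq (im z) n))
          (λ n → solve 6 (λ a b c d e f → (c :+ e) :* b :+ (d :+ f) :* a
                                       := (c :* b :+ d :* a) :+ (e :* b :+ f :* a)) ≡.refl
                   (seq (re x) n) (seq (im x) n) (seq (re y) n) (seq (im y) n) (seq (re z) n) (seq (im z) n)))
    }
  ; *-comm = λ x y → pointwiseᶜ
      (λ n → solve 4 (λ a b c d → a :* c :- b :* d := c :* a :- d :* b) ≡.refl
               (seq (re x) n) (seq (im x) n) (seq (re y) n) (seq (im y) n))
      (λ n → solve 4 (λ a b c d → a :* d :+ b :* c := c :* b :+ d :* a) ≡.refl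
               (seq (re x) n) (seq (im x) n) (seq (re y) n) (seq (im y) n))
  }
  where
  open ℚ-Solver.+-*-Solver
  isEq : IsEquivalence _≈_
  isEq = record { refl = ≈-refl ; sym = ≈-sym ; trans = ≈-trans }

ℂ-commutativeRing : CommutativeRing 0ℓ 0ℓ
ℂ-commutativeRing = record { isCommutativeRing = ℂ-isCommutativeRing }

fromℚᶜ : ℚ → ℂ
fromℚᶜ q = fromℝ (fromℚ q)

fromℚᶜ-+ : ∀ p q → fromℚᶜ (p ℚ.+ q) ≈ fromℚᶜ p + fromℚᶜ q
fromℚᶜ-+ p q = pointwiseᶜ (λ _ → ≡.refl) (λ _ → ≡.refl)

fromℚᶜ-* : ∀ p q → fromℚᶜ (p ℚ.* q) ≈ fromℚᶜ p * fromℚᶜ q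
fromℚᶜ-* p q = pointwiseᶜ
  (λ _ → solve 2 (λ p q → p :* q := p :* q :- con 0ℚ :* con 0ℚ) ≡.refl p q)
  (λ _ → solve 2 (λ p q → con 0ℚ := p :* con 0ℚ :+ con 0ℚ :* q) ≡.refl p q)
  where open ℚ-Solver.+-*-Solver

ℂ-almostCommutativeRing : ACR.AlmostCommutativeRing 0ℓ 0ℓ
ℂ-almostCommutativeRing = ACR.fromCommutativeRing ℂ-commutativeRing

private
  ℚ⟶ℂ : CommutativeRing.rawRing ℚ.+-*-commutativeRing ACR.-Raw-AlmostCommutative⟶ ℂ-almostCommutativeRing
  ℚ⟶ℂ = record
    { ⟦_⟧    = fromℚᶜ
    ; +-homo = fromℚᶜ-+
    ; *-homo = fromℚᶜ-*
    ; -‿homo = λ _ → pointwiseᶜ (λ _ → ≡.refl) (λ _ → ≡.refl)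
    ; 0-homo = ≈-refl
    ; 1-homo = ≈-refl
    }

  coefficient≟ : ∀ p q → Maybe (fromℚᶜ p ≈ fromℚᶜ q)
  coefficient≟ p q with p ℚ.≟ q
  ... | yes ≡.refl = just ≈-refl
  ... | no  _      = nothing

-- Coefficients are taken in ℚ, where the solver can compare them; equality in ℂ itself is
-- undecidable.
module ℂ-Solver = Algebra.Solver.Ring
  (CommutativeRing.rawRing ℚ.+-*-commutativeRing) ℂ-almostCommutativeRing ℚ⟶ℂ coefficient≟

open CommutativeRing ℂ-commutativeRing
  using ( setoid; semiring; +-identityˡ; +-identityʳ; +-comm; +-congˡ; +-congʳ; -‿inverseʳ
        ; *-identityˡ; *-identityʳ; *-assoc; *-comm; *-congˡ; *-congʳ; zeroˡ; zeroʳ)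
  renaming (reflexive to ≈-reflexive)
open Algebra.Properties.Semiring.Sum semiring
  using (sum-cong-≋; ∑-distrib-+; ∑-comm; sum-permute; *-distribˡ-sum; *-distribʳ-sum; sum-replicate-zero)
open Algebra.Properties.Group (CommutativeRing.+-group ℂ-commutativeRing)
  using () renaming (x∙y⁻¹≈ε⇒x≈y to -≈0⇒≈; x≈y⇒x∙y⁻¹≈ε to ≈⇒-≈0)

-- Zero, apartness and cancellation

Null⇒≈0 : ∀ {x} → Null (seq x) → x ≈ᴿ 0ᴿ
Null⇒≈0 {x} p = mk≈ᴿ $ Null-resp (λ n → ≡.sym (≡.trans (cong (seq x n ℚ.+_) ≡.refl) (ℚ.+-identityʳ
     (seq x n)))) p

≈0⇒Null : ∀ {x} → x ≈ᴿ 0ᴿ → Null (seq x)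
≈0⇒Null {x} p = Null-resp (λ n → ℚ.+-identityʳ (seq x n)) (_≈ᴿ_.close p)

-- The positive form of being nonzero: it carries an explicit lower bound by which one can divide,
-- which `¬ x ≈ᴿ 0ᴿ` does not.
Apart : ℝ → Set
Apart x = ∃₂ λ ε N → 0ℚ ℚ.< ε × (∀ n → N ℕ.≤ n → ε ℚ.≤ ℚ.∣ seq x n ∣)

-- Let N be a Cauchy modulus for ε / 2. A single term of absolute value at least ε beyond N would
-- keep all terms beyond N at least ε / 2 away from 0, so x would be apart from 0.
¬Apart⇒≈0 : ∀ x → ¬ Apart x → x ≈ᴿ 0ᴿ
¬Apart⇒≈0 x ¬apart = Null⇒≈0 λ ε ε>0 → close ε ε>0 (cauchy x (½ ℚ.* ε) (½*-pos ε>0))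
  where
  open ℚ.≤-Reasoning
  split : ∀ p q → p ≡ q ℚ.+ (p ℚ.- q)
  split = solve 2 (λ p q → p := q :+ (p :- q)) ≡.refl
    where open ℚ-Solver.+-*-Solver
  close : ∀ ε → 0ℚ ℚ.< ε →
          (∃ λ N → ∀ m n → N ℕ.≤ m → N ℕ.≤ n → ℚ.∣ seq x m ℚ.- seq x n ∣ ℚ.< ½ ℚ.* ε) →
          ∃ λ N → ∀ n → N ℕ.≤ n → ℚ.∣ seq x n ∣ ℚ.< ε
  close ε ε>0 (N , p) = N , λ n N≤n → ℚ.≰⇒> λ ε≤xₙ → ¬apart
    (½ ℚ.* ε , N , ½*-pos ε>0 , λ m N≤m → ℚ.≮⇒≥ λ xₘ<½ε → ℚ.<-irrefl ≡.refl $ begin-strict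
      ε                                               ≤⟨ ε≤xₙ ⟩
      ℚ.∣ seq x n ∣                                   ≡⟨ cong ℚ.∣_∣ (split (seq x n) (seq x m)) ⟩
      ℚ.∣ seq x m ℚ.+ (seq x n ℚ.- seq x m) ∣         ≤⟨ ℚ.∣p+q∣≤∣p∣+∣q∣ (seq x m) (seq x n ℚ.- seq x m) ⟩
      ℚ.∣ seq x m ∣ ℚ.+ ℚ.∣ seq x n ℚ.- seq x m ∣     <⟨ ℚ.+-mono-< xₘ<½ε (p n m N≤n N≤m) ⟩
      ½ ℚ.* ε ℚ.+ ½ ℚ.* ε                             ≡⟨ ½+½ ε ⟩
      ε                                               ∎)

Apart-cancel : ∀ {x y} → Apart x → x *ᴿ y ≈ᴿ 0ᴿ → y ≈ᴿ 0ᴿ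
Apart-cancel {x} {y} (δ , M , δ>0 , δ≤x) xy≈0 = Null⇒≈0 λ ε ε>0 →
  let instance
        δpos = ℚ.positive δ>0
        δnn  = ℚ.pos⇒nonNeg δ
        εpos = ℚ.positive ε>0
      N , p = ≈0⇒Null xy≈0 (δ ℚ.* ε) (ℚ.positive⁻¹ _ {{ℚ.pos*pos⇒pos δ ε}})
  in M ℕ.⊔ N , λ n le → ℚ.*-cancelˡ-<-nonNeg δ $ begin-strict
       δ ℚ.* ℚ.∣ seq y n ∣
         ≤⟨ ℚ.*-monoʳ-≤-nonNeg ℚ.∣ seq y n ∣ {{ℚ.∣-∣-nonNeg (seq y n)}} (δ≤x n (ℕ.m⊔n≤o⇒m≤o M N le)) ⟩
       ℚ.∣ seq x n ∣ ℚ.* ℚ.∣ seq y n ∣    ≡⟨ ℚ.∣p*q∣≡∣p∣*∣q∣ (seq x n) (seq y n) ⟨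
       ℚ.∣ seq x n ℚ.* seq y n ∣          <⟨ p n (ℕ.m⊔n≤o⇒n≤o M N le) ⟩
       δ ℚ.* ε                            ∎
  where open ℚ.≤-Reasoning

Apart⇒≉0 : ∀ {x} → Apart x → ¬ x ≈ᴿ 0ᴿ
Apart⇒≉0 (δ , M , δ>0 , δ≤x) x≈0 =
  let N , p = ≈0⇒Null x≈0 δ δ>0
  in ℚ.<-irrefl ≡.refl (ℚ.<-≤-trans (p (M ℕ.⊔ N) (ℕ.m≤n⊔m M N)) (δ≤x (M ℕ.⊔ N) (ℕ.m≤m⊔n M N)))

-- Stability is what allows classical case distinctions in proofs of equations.
≈0-stableᴿ : ∀ x → ¬ ¬ x ≈ᴿ 0ᴿ → x ≈ᴿ 0ᴿ
≈0-stableᴿ x ¬¬p = ¬Apart⇒≈0 x λ apart → ¬¬p (Apart⇒≉0 apart)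

-- Being merely nonzero, x offers nothing to divide by. The roles are exchanged: if y were apart
-- from 0, then y could be cancelled and x would be zero.
*-cancelˡᴿ : ∀ x y → ¬ x ≈ᴿ 0ᴿ → x *ᴿ y ≈ᴿ 0ᴿ → y ≈ᴿ 0ᴿ
*-cancelˡᴿ x y x≉0 xy≈0 = ¬Apart⇒≈0 y λ apart → x≉0 $ Apart-cancel {y} {x} apart
  (≈ᴿ-trans (pointwise λ n → ℚ.*-comm (seq y n) (seq x n)) xy≈0)

≈-stable : ∀ z w → ¬ ¬ z ≈ w → z ≈ w
≈-stable z w ¬¬p = -≈0⇒≈ z w $ mk≈
  (≈0-stableᴿ _ λ ¬q → ¬¬p λ p → ¬q (_≈_.re≈ (≈⇒-≈0 p)))
  (≈0-stableᴿ _ λ ¬q → ¬¬p λ p → ¬q (_≈_.im≈ (≈⇒-≈0 p)))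

-- A property of the representing sequence, stronger than nonnegativity of the number and not
-- invariant under `_≈_`. It suffices because z times its conjugate is represented by termwise sums
-- of two squares, and it lets sums be compared term by term.
NonNeg : ℂ → Set
NonNeg z = ∀ n → 0ℚ ℚ.≤ seq (re z) n

squeeze : ∀ {x y} → (∀ n → 0ℚ ℚ.≤ seq x n) → (∀ n → seq x n ℚ.≤ seq y n) → y ≈ᴿ 0ᴿ → x ≈ᴿ 0ᴿ
squeeze {x} {y} 0≤x x≤y y≈0 = Null⇒≈0 λ ε ε>0 → let N , p = ≈0⇒Null y≈0 ε ε>0 in N , λ n N≤n →
  ℚ.≤-<-trans (ℚ.≤-trans (ℚ.≤-reflexive (ℚ.0≤p⇒∣p∣≡p (0≤x n)))
                 (ℚ.≤-trans (x≤y n) (ℚ.≤-reflexive (≡.sym (ℚ.0≤p⇒∣p∣≡p (ℚ.≤-trans (0≤x n) (x≤y n)))))))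
              (p n N≤n)

∑-nonNeg : ∀ {n} (f : Fin n → ℂ) → (∀ i → NonNeg (f i)) → NonNeg (∑ f)
∑-nonNeg {zero}  f 0≤f k = ℚ.≤-refl
∑-nonNeg {suc n} f 0≤f k = ℚ.+-mono-≤ (0≤f zero k) (∑-nonNeg (f ∘ suc) (0≤f ∘ suc) k)

∑-bound : ∀ {n} (f : Fin n → ℂ) → (∀ i → NonNeg (f i)) → ∀ i k → seq (re (f i)) k ℚ.≤ seq (re (∑ f)) k
∑-bound f 0≤f zero    k = ℚ.≤-trans (ℚ.≤-reflexive (≡.sym (ℚ.+-identityʳ _)))
                                    (ℚ.+-monoʳ-≤ (seq (re (f zero)) k) (∑-nonNeg (f ∘ suc) (0≤f ∘ suc) k))
∑-bound f 0≤f (suc i) k = ℚ.≤-trans (∑-bound (f ∘ suc) (0≤f ∘ suc) i k)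
  (ℚ.≤-trans (ℚ.≤-reflexive (≡.sym (ℚ.+-identityˡ _))) (ℚ.+-monoˡ-≤ (seq (re (∑ (f ∘ suc))) k) (0≤f zero k)))

∑-nonNeg≈0 : ∀ {n} (f : Fin n → ℂ) → (∀ i → NonNeg (f i)) → re (∑ f) ≈ᴿ 0ᴿ → ∀ i → re (f i) ≈ᴿ 0ᴿ
∑-nonNeg≈0 f 0≤f ∑≈0 i = squeeze (0≤f i) (∑-bound f 0≤f i) ∑≈0

module _ where
  open ℚ.≤-Reasoning

  0≤p² : ∀ p → 0ℚ ℚ.≤ p ℚ.* p
  0≤p² p with ℚ.≤-total 0ℚ p
  ... | inj₁ 0≤p = ℚ.nonNegative⁻¹ _ {{ℚ.nonNeg*nonNeg⇒nonNeg p {{ℚ.nonNegative 0≤p}} p {{ℚ.nonNegative 0≤p}}}}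
  ... | inj₂ p≤0 = ℚ.nonNegative⁻¹ _ {{ℚ.nonPos*nonPos⇒nonPos p {{ℚ.nonPositive p≤0}} p {{ℚ.nonPositive p≤0}}}}

  ∣p∣²≡p² : ∀ p → ℚ.∣ p ∣ ℚ.* ℚ.∣ p ∣ ≡ ℚ.∣ p ℚ.* p ∣
  ∣p∣²≡p² p = ≡.sym (ℚ.∣p*q∣≡∣p∣*∣q∣ p p)

  square≈0 : ∀ x → x *ᴿ x ≈ᴿ 0ᴿ → x ≈ᴿ 0ᴿ
  square≈0 x xx≈0 = Null⇒≈0 λ ε ε>0 →
    let instance
          εpos = ℚ.positive ε>0
          εnn  = ℚ.pos⇒nonNeg ε
        N , p = ≈0⇒Null xx≈0 (ε ℚ.* ε) (ℚ.positive⁻¹ _ {{ℚ.pos*pos⇒pos ε ε}})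
    in N , λ n N≤n → ℚ.≰⇒> λ ε≤x → ℚ.<-irrefl ≡.refl $ begin-strict
         ε ℚ.* ε                            ≤⟨ ℚ.*-monoʳ-≤-nonNeg ε ε≤x ⟩
         ℚ.∣ seq x n ∣ ℚ.* ε                ≤⟨ ℚ.*-monoˡ-≤-nonNeg ℚ.∣ seq x n ∣ {{ℚ.∣-∣-nonNeg (seq x n)}} ε≤x ⟩
         ℚ.∣ seq x n ∣ ℚ.* ℚ.∣ seq x n ∣    ≡⟨ ∣p∣²≡p² (seq x n) ⟩
         ℚ.∣ seq x n ℚ.* seq x n ∣          <⟨ p n N≤n ⟩
         ε ℚ.* ε                            ∎

  normSquare : ∀ z n → seq (re (z * conj z)) n ≡ seq (re z) n ℚ.* seq (re z) n ℚ.+ seq (im z) n ℚ.* seq (im z) n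
  normSquare z n = solve 2 (λ a b → a :* a :- b :* (:- b) :=
       a :* a :+ b :* b) ≡.refl (seq (re z) n) (seq (im z) n)
    where open ℚ-Solver.+-*-Solver

  normSquare-nonNeg : ∀ z → NonNeg (z * conj z)
  normSquare-nonNeg z n = subst (0ℚ ℚ.≤_) (≡.sym (normSquare z n))
    (ℚ.+-mono-≤ (0≤p² (seq (re z) n)) (0≤p² (seq (im z) n)))

  normSquare≈0 : ∀ z → re (z * conj z) ≈ᴿ 0ᴿ → z ≈ 0#
  normSquare≈0 z p = mk≈
    (square≈0 (re z) (squeeze (λ n → 0≤p² (seq (re z) n)) (λ n → begin
      seq (re z *ᴿ re z) n                                    ≡⟨ ℚ.+-identityʳ _ ⟨
      seq (re z *ᴿ re z) n ℚ.+ 0ℚ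
        ≤⟨ ℚ.+-monoʳ-≤ (seq (re z *ᴿ re z) n) (0≤p² (seq (im z) n)) ⟩
      seq (re z *ᴿ re z) n ℚ.+ seq (im z *ᴿ im z) n           ≡⟨ normSquare z n ⟨
      seq (re (z * conj z)) n                                 ∎) p))
    (square≈0 (im z) (squeeze (λ n → 0≤p² (seq (im z) n)) (λ n → begin
      seq (im z *ᴿ im z) n                                    ≡⟨ ℚ.+-identityˡ _ ⟨
      0ℚ ℚ.+ seq (im z *ᴿ im z) n
        ≤⟨ ℚ.+-monoˡ-≤ (seq (im z *ᴿ im z) n) (0≤p² (seq (re z) n)) ⟩
      seq (re z *ᴿ re z) n ℚ.+ seq (im z *ᴿ im z) n           ≡⟨ normSquare z n ⟨
      seq (re (z * conj z)) n                                 ∎) p))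

-- Multiplication by the conjugate of z turns the factor into the real number |z|², which is nonzero
-- by `normSquare≈0` and can be cancelled from the real and the imaginary part separately.
*-cancelˡ-≈0 : ∀ z w → ¬ z ≈ 0# → z * w ≈ 0# → w ≈ 0#
*-cancelˡ-≈0 z w z≉0 zw≈0 = mk≈
  (*-cancelˡᴿ (re (z * conj z)) (re w) norm≉0
    (≈ᴿ-trans (pointwise λ n → solve 4 (λ a b c d → (a :* a :- b :* (:- b)) :* c :=
                  a :* (a :* c :- b :* d) :- (:- b) :* (a :* d :+ b :* c)) ≡.refl
                   (seq (re z) n) (seq (im z) n) (seq (re w) n) (seq (im w) n))
                (_≈_.re≈ vanish)))
  (*-cancelˡᴿ (re (z * conj z)) (im w) norm≉0
    (≈ᴿ-trans (pointwise λ n → solve 4 (λ a b c d → (a :* a :- b :* (:- b)) :* d :=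
                  a :* (a :* d :+ b :* c) :+ (:- b) :* (a :* c :- b :* d)) ≡.refl
                   (seq (re z) n) (seq (im z) n) (seq (re w) n) (seq (im w) n))
                (_≈_.im≈ vanish)))
  where
  open ℚ-Solver.+-*-Solver
  norm≉0 : ¬ re (z * conj z) ≈ᴿ 0ᴿ
  norm≉0 p = z≉0 (normSquare≈0 z p)
  vanish : conj z * (z * w) ≈ 0#
  vanish = ≈-trans (*-congˡ zw≈0) (zeroʳ (conj z))

conj-+ : ∀ z w → conj (z + w) ≈ conj z + conj w
conj-+ z w = pointwiseᶜ (λ _ → ≡.refl) (λ n → ℚ.neg-distrib-+ (seq (im z) n) (seq (im w) n))

conj-* : ∀ z w → conj (z * w) ≈ conj z * conj w
conj-* z w = pointwiseᶜ
  (λ n → solve 4 (λ a b c d → a :* c :- b :* d := a :* c :- (:- b) :* (:- d)) ≡.refl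
           (seq (re z) n) (seq (im z) n) (seq (re w) n) (seq (im w) n))
  (λ n → solve 4 (λ a b c d → :- (a :* d :+ b :* c) := a :* (:- d) :+ (:- b) :* c) ≡.refl
           (seq (re z) n) (seq (im z) n) (seq (re w) n) (seq (im w) n))
  where open ℚ-Solver.+-*-Solver

conj-neg : ∀ z → conj (- z) ≈ - conj z
conj-neg z = pointwiseᶜ (λ _ → ≡.refl) (λ _ → ≡.refl)

conj-fromℝ : ∀ x → conj (fromℝ x) ≈ fromℝ x
conj-fromℝ x = pointwiseᶜ (λ _ → ≡.refl) (λ _ → ≡.refl)

-- Natural numbers as complex numbers

module Natℚ = Algebra.Properties.Semiring.Mult (CommutativeRing.semiring ℚ.+-*-commutativeRing)
open Natℚ using () renaming (_×_ to _×ℚ_)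

-- Opaque, so that `nat k` stays an atom instead of unfolding to a rational sum; `nat≡` exposes the
-- value where it matters.
opaque
  nat : ℕ → ℂ
  nat k = fromℚᶜ (k ×ℚ 1ℚ)

  nat≡ : ∀ k → nat k ≡ fromℚᶜ (k ×ℚ 1ℚ)
  nat≡ k = ≡.refl

nat-0 : nat 0 ≈ 0#
nat-0 rewrite nat≡ 0 = ≈-refl

nat-suc : ∀ k → nat (suc k) ≈ 1# + nat k
nat-suc k rewrite nat≡ (suc k) | nat≡ k = fromℚᶜ-+ 1ℚ (k ×ℚ 1ℚ)

nat-+ : ∀ m n → nat (m ℕ.+ n) ≈ nat m + nat n
nat-+ m n rewrite nat≡ (m ℕ.+ n) | nat≡ m | nat≡ n | Natℚ.×-homo-+ 1ℚ m n = fromℚᶜ-+ (m ×ℚ 1ℚ) (n ×ℚ 1ℚ)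

nat-* : ∀ m n → nat (m ℕ.* n) ≈ nat m * nat n
nat-* m n rewrite nat≡ (m ℕ.* n) | nat≡ m | nat≡ n | Natℚ.×1-homo-* m n = fromℚᶜ-* (m ×ℚ 1ℚ) (n ×ℚ 1ℚ)

conj-nat : ∀ k → conj (nat k) ≈ nat k
conj-nat k rewrite nat≡ k = conj-fromℝ _

0≤×1 : ∀ k → 0ℚ ℚ.≤ k ×ℚ 1ℚ
0≤×1 zero    = ℚ.≤-refl
0≤×1 (suc k) = ℚ.+-mono-≤ (ℚ.nonNegative⁻¹ 1ℚ) (0≤×1 k)

0<suc×1 : ∀ k → 0ℚ ℚ.< suc k ×ℚ 1ℚ
0<suc×1 k = ℚ.+-mono-<-≤ (ℚ.positive⁻¹ 1ℚ) (0≤×1 k)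

×1-injective : ∀ m n → m ×ℚ 1ℚ ≡ n ×ℚ 1ℚ → m ≡ n
×1-injective zero    zero    _  = ≡.refl
×1-injective zero    (suc n) eq = contradiction (0<suc×1 n) (ℚ.<-irrefl eq)
×1-injective (suc m) zero    eq = contradiction (0<suc×1 m) (ℚ.<-irrefl (≡.sym eq))
×1-injective (suc m) (suc n) eq = cong suc $ ×1-injective m n $
  Algebra.Properties.Group.∙-cancelˡ ℚ.+-0-group 1ℚ (m ×ℚ 1ℚ) (n ×ℚ 1ℚ) eq

fromℚᶜ-injective : ∀ {p q} → fromℚᶜ p ≈ fromℚᶜ q → p ≡ q
fromℚᶜ-injective {p} {q} (mk≈ re≈ _) with p ℚ.≟ q
... | yes p≡q = p≡q
... | no  p≢q =
  let N , close = _≈ᴿ_.close re≈ ℚ.∣ p ℚ.- q ∣ 0<∣p-q∣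
  in contradiction (close N ℕ.≤-refl) (ℚ.<-irrefl ≡.refl)
  where
  0<∣p-q∣ : 0ℚ ℚ.< ℚ.∣ p ℚ.- q ∣
  0<∣p-q∣ = ℚ.≰⇒> λ ≤0 → p≢q $ Algebra.Properties.Group.x∙y⁻¹≈ε⇒x≈y ℚ.+-0-group p q $
    ℚ.∣p∣≡0⇒p≡0 (p ℚ.- q) (ℚ.≤-antisym ≤0 (ℚ.0≤∣p∣ (p ℚ.- q)))

nat-injective : ∀ {m n} → nat m ≈ nat n → m ≡ n
nat-injective {m} {n} p rewrite nat≡ m | nat≡ n = ×1-injective m n (fromℚᶜ-injective p)

nat-suc-cancel : ∀ k z → nat (suc k) * z ≈ 0# → z ≈ 0#
nat-suc-cancel k z = *-cancelˡ-≈0 (nat (suc k)) z λ p → contradiction (nat-injective (≈-trans p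
     (≈-sym nat-0))) λ ()

∑-one : ∀ n → ∑ {n} (λ _ → 1#) ≈ nat n
∑-one zero    = ≈-sym nat-0
∑-one (suc n) = ≈-trans (+-congˡ (∑-one n)) (≈-sym (nat-suc n))

-- Excludes d = 2 - 2 μ for d = k + 2. Eventually every term of 2 μ + k exceeds the gap that
-- witnesses 0 < μ, so the sequence is not null.
2μ+k≉0 : ∀ {μ} k → 0ᴿ <ᴿ μ → ¬ fromℝ μ + (fromℝ μ + nat k) ≈ 0#
2μ+k≉0 {μ} k (mk<ᴿ gap gap>0 (N , above)) 2μ+k≈0 =
  let mk≈ re≈ _ = subst (λ z → fromℝ μ + (fromℝ μ + z) ≈ 0#) (nat≡ k) 2μ+k≈0
      M , close = ≈0⇒Null re≈ gap gap>0
      n = M ℕ.⊔ N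
      gap<μ = subst (ℚ._< seq μ n) (ℚ.+-identityˡ gap) (above n (ℕ.m≤n⊔m M N))
      μ+k = seq μ n ℚ.+ k ×ℚ 1ℚ
      0≤μ+k = ℚ.+-mono-≤ (ℚ.≤-trans (ℚ.<⇒≤ gap>0) (ℚ.<⇒≤ gap<μ)) (0≤×1 k)
      0≤2μ+k = ℚ.+-mono-≤ (ℚ.≤-trans (ℚ.<⇒≤ gap>0) (ℚ.<⇒≤ gap<μ)) 0≤μ+k
  in ℚ.<-irrefl ≡.refl $ begin-strict
       gap                          <⟨ gap<μ ⟩
       seq μ n                      ≡⟨ ℚ.+-identityʳ (seq μ n) ⟨
       seq μ n ℚ.+ 0ℚ               ≤⟨ ℚ.+-monoʳ-≤ (seq μ n) 0≤μ+k ⟩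
       seq μ n ℚ.+ μ+k              ≡⟨ ℚ.0≤p⇒∣p∣≡p 0≤2μ+k ⟨
       ℚ.∣ seq μ n ℚ.+ μ+k ∣        <⟨ close n (ℕ.m≤m⊔n M N) ⟩
       gap                          ∎
  where open ℚ.≤-Reasoning

open FiniteSet using (Carrier; size; elem; enumeration; ∑ˢ; count)
open Matrices using (𝕀)
open Relation.Binary.Reasoning.Setoid setoid

-- Finite sums and matrices

[]-yes : ∀ {p} {P : Set p} (P? : Dec P) → P → [ P? ] ≈ 1#
[]-yes (yes _) _ = ≈-refl
[]-yes (no ¬p) p = contradiction p ¬p

[]-no : ∀ {p} {P : Set p} (P? : Dec P) → ¬ P → [ P? ] ≈ 0#
[]-no (yes p) ¬p = contradiction p ¬p
[]-no (no _)  _  = ≈-refl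

[]-cong : ∀ {p q} {P : Set p} {Q : Set q} (P? : Dec P) (Q? : Dec Q) → (P → Q) → (Q → P) → [ P? ] ≈ [ Q? ]
[]-cong P? (yes q) P→Q Q→P = []-yes P? (Q→P q)
[]-cong P? (no ¬q) P→Q Q→P = []-no P? (¬q ∘ P→Q)

∑-single : ∀ {n} (f : Fin n → ℂ) j → (∀ i → i ≢ j → f i ≈ 0#) → ∑ f ≈ f j
∑-single {suc n} f zero    f≈0 = begin
  f zero + ∑ (f ∘ suc)    ≈⟨ +-congˡ (sum-cong-≋ λ i → f≈0 (suc i) λ ()) ⟩
  f zero + ∑ {n} (λ _ → 0#)  ≈⟨ +-congˡ (sum-replicate-zero n) ⟩
  f zero + 0#             ≈⟨ +-identityʳ _ ⟩
  f zero                  ∎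
∑-single {suc n} f (suc j) f≈0 = begin
  f zero + ∑ (f ∘ suc)
    ≈⟨ +-cong (f≈0 zero λ ()) (∑-single (f ∘ suc) j λ i i≢j → f≈0 (suc i) (i≢j ∘ Fin.suc-injective)) ⟩
  0# + f (suc j)          ≈⟨ +-identityˡ _ ⟩
  f (suc j)               ∎

∑-splitAt : ∀ m {n} (f : Fin (m ℕ.+ n) → ℂ) → ∑ f ≈ ∑ (λ i → f (i ↑ˡ n)) + ∑ (λ j → f (m ↑ʳ j))
∑-splitAt zero    f = ≈-sym (+-identityˡ _)
∑-splitAt (suc m) f = ≈-trans (+-congˡ (∑-splitAt m (f ∘ suc)))
  (solve 3 (λ a b c → a :+ (b :+ c) := (a :+ b) :+ c) ≈-refl _ _ _)
  where open ℂ-Solver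

∑-combine : ∀ m {n} (f : Fin (m ℕ.* n) → ℂ) → ∑ f ≈ ∑ λ (i : Fin m) → ∑ λ (j : Fin n) → f (combine i j)
∑-combine zero    f = ≈-refl
∑-combine (suc m) {n} f = ≈-trans (∑-splitAt n f) (+-congˡ (∑-combine m (f ∘ (n ↑ʳ_))))

-- Opaque, so that the summand of a sum can be inferred.
opaque
  ∑ᵛ : (V : FiniteSet) → (Carrier V → ℂ) → ℂ
  ∑ᵛ = ∑ˢ

  ∑ˢ≡∑ᵛ : ∀ V f → ∑ˢ V f ≡ ∑ᵛ V f
  ∑ˢ≡∑ᵛ V f = ≡.refl

module _ (V : FiniteSet) where

  elem-from : ∀ x → elem V (Inverse.from (enumeration V) x) ≡ x
  elem-from = Inverse.strictlyInverseˡ (enumeration V)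

  opaque
    unfolding ∑ᵛ
    ∑ᵛ-cong : ∀ {f g} → (∀ x → f x ≈ g x) → ∑ᵛ V f ≈ ∑ᵛ V g
    ∑ᵛ-cong f≈g = sum-cong-≋ (f≈g ∘ elem V)

  opaque
    unfolding ∑ᵛ
    ∑ᵛ-+ : ∀ f g → ∑ᵛ V (λ x → f x + g x) ≈ ∑ᵛ V f + ∑ᵛ V g
    ∑ᵛ-+ f g = ∑-distrib-+ (f ∘ elem V) (g ∘ elem V)

  opaque
    unfolding ∑ᵛ
    ∑ᵛ-*ˡ : ∀ c f → ∑ᵛ V (λ x → c * f x) ≈ c * ∑ᵛ V f
    ∑ᵛ-*ˡ c f = ≈-sym (*-distribˡ-sum c (f ∘ elem V))

  opaque
    unfolding ∑ᵛ
    ∑ᵛ-*ʳ : ∀ c f → ∑ᵛ V (λ x → f x * c) ≈ ∑ᵛ V f * c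
    ∑ᵛ-*ʳ c f = ≈-sym (*-distribʳ-sum c (f ∘ elem V))

  ∑ᵛ-linear : ∀ a f b g → ∑ᵛ V (λ x → a * f x + b * g x) ≈ a * ∑ᵛ V f + b * ∑ᵛ V g
  ∑ᵛ-linear a f b g = ≈-trans (∑ᵛ-+ _ _) (+-cong (∑ᵛ-*ˡ a f) (∑ᵛ-*ˡ b g))

  opaque
    unfolding ∑ᵛ
    ∑ᵛ-single : ∀ f y → (∀ x → x ≢ y → f x ≈ 0#) → ∑ᵛ V f ≈ f y
    ∑ᵛ-single f y f≈0 = ≈-trans
      (∑-single (f ∘ elem V) (Inverse.from (enumeration V) y) λ i i≢ → f≈0 (elem V i) λ eq →
        i≢ (≡.trans (≡.sym (Inverse.strictlyInverseʳ (enumeration V) i)) (cong (Inverse.from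
             (enumeration V)) eq)))
      (≈-reflexive (cong f (elem-from y)))

  open FiniteSet V using (_≟_)

  ∑ᵛ-δˡ : ∀ y (f : Carrier V → ℂ) → ∑ᵛ V (λ x → [ y ≟ x ] * f x) ≈ f y
  ∑ᵛ-δˡ y f = begin
    ∑ᵛ V (λ x → [ y ≟ x ] * f x)
      ≈⟨ ∑ᵛ-single _ y (λ x x≢y → ≈-trans (*-congʳ ([]-no (y ≟ x) (x≢y ∘ ≡.sym))) (zeroˡ _)) ⟩
    [ y ≟ y ] * f y                ≈⟨ *-congʳ ([]-yes (y ≟ y) ≡.refl) ⟩
    1# * f y                       ≈⟨ *-identityˡ _ ⟩
    f y                            ∎

  ∑ᵛ-δʳ : ∀ y (f : Carrier V → ℂ) → ∑ᵛ V (λ x → f x * [ x ≟ y ]) ≈ f y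
  ∑ᵛ-δʳ y f = begin
    ∑ᵛ V (λ x → f x * [ x ≟ y ])
      ≈⟨ ∑ᵛ-single _ y (λ x x≢y → ≈-trans (*-congˡ ([]-no (x ≟ y) x≢y)) (zeroʳ _)) ⟩
    f y * [ y ≟ y ]                ≈⟨ *-congˡ ([]-yes (y ≟ y) ≡.refl) ⟩
    f y * 1#                       ≈⟨ *-identityʳ _ ⟩
    f y                            ∎

  opaque
    unfolding ∑ᵛ
    ∑ᵛ-one : ∑ᵛ V (λ _ → 1#) ≈ nat (size V)
    ∑ᵛ-one = ∑-one (size V)

  ∑ᵛ-const : ∀ c → ∑ᵛ V (λ _ → c) ≈ c * nat (size V)
  ∑ᵛ-const c = begin
    ∑ᵛ V (λ _ → c)        ≈⟨ ∑ᵛ-cong (λ _ → ≈-sym (*-identityʳ c)) ⟩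
    ∑ᵛ V (λ _ → c * 1#)   ≈⟨ ∑ᵛ-*ˡ c _ ⟩
    c * ∑ᵛ V (λ _ → 1#)   ≈⟨ *-congˡ ∑ᵛ-one ⟩
    c * nat (size V)      ∎

  opaque
    unfolding ∑ᵛ
    conj-∑ᵛ : ∀ f → conj (∑ᵛ V f) ≈ ∑ᵛ V (conj ∘ f)
    conj-∑ᵛ f = go (f ∘ elem V)
      where
      go : ∀ {n} (f : Fin n → ℂ) → conj (∑ f) ≈ ∑ (conj ∘ f)
      go {zero}  f = conj-fromℝ 0ᴿ
      go {suc n} f = ≈-trans (conj-+ _ _) (+-congˡ (go (f ∘ suc)))

  opaque
    unfolding ∑ᵛ
    ∑ᵛ-reindex : ∀ (π : Carrier V ↔ Carrier V) f → ∑ᵛ V f ≈ ∑ᵛ V (f ∘ Inverse.to π)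
    ∑ᵛ-reindex π f = begin
      ∑ (f ∘ elem V)
        ≈⟨ sum-permute (f ∘ elem V) (↔-sym (enumeration V) ↔-∘ (π ↔-∘ enumeration V)) ⟩
      ∑ (λ i → f (elem V (Inverse.from (enumeration V) (Inverse.to π (elem V i)))))
        ≈⟨ sum-cong-≋ (λ i → ≈-reflexive (cong f (elem-from (Inverse.to π (elem V i))))) ⟩
      ∑ (f ∘ Inverse.to π ∘ elem V) ∎

  opaque
    unfolding ∑ᵛ
    ∑ᵛ-count : ∀ {P : Carrier V → Set} (P? : ∀ x → Dec (P x)) → ∑ᵛ V (λ x → [ P? x ]) ≈ nat (count V P?)
    ∑ᵛ-count {P} P? = subst (λ xs → ∑ᵛ V (λ x → [ P? x ]) ≈ nat (length (filter P? xs)))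
      (≡.sym (map-tabulate id (elem V))) (go (elem V))
      where
      go : ∀ {n} (f : Fin n → Carrier V) → ∑ (λ i → [ P? (f i) ]) ≈ nat (length (filter P? (tabulate f)))
      go {zero}  f = ≈-sym nat-0
      go {suc n} f with P? (f zero)
      ... | yes _ = ≈-trans (+-congˡ (go (f ∘ suc))) (≈-sym (nat-suc _))
      ... | no  _ = ≈-trans (+-identityˡ _) (go (f ∘ suc))

opaque
  unfolding ∑ᵛ
  ∑ᵛ-comm : ∀ U V (f : Carrier U → Carrier V → ℂ) → ∑ᵛ U (λ u → ∑ᵛ V (f u)) ≈ ∑ᵛ V (λ v → ∑ᵛ U λ u → f u v)
  ∑ᵛ-comm U V f = ∑-comm λ i j → f (elem U i) (elem V j)

opaque
  unfolding ∑ᵛ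
  ∑ᵛ-⊠ : ∀ U V (f : Carrier (U ⊠ V) → ℂ) → ∑ᵛ (U ⊠ V) f ≈ ∑ᵛ U λ u → ∑ᵛ V λ v → f (u , v)
  ∑ᵛ-⊠ U V f = ≈-trans (∑-combine (size U) _) (sum-cong-≋ λ i → sum-cong-≋ λ j →
    ≈-reflexive (cong (λ (k , l) → f (elem U k , elem V l)) (Fin.remQuot-combine i j)))

∑ᵛ-× : ∀ U V f g → ∑ᵛ (U ⊠ V) (λ (u , v) → f u * g v) ≈ ∑ᵛ U f * ∑ᵛ V g
∑ᵛ-× U V f g = begin
  ∑ᵛ (U ⊠ V) (λ (u , v) → f u * g v)       ≈⟨ ∑ᵛ-⊠ U V _ ⟩
  ∑ᵛ U (λ u → ∑ᵛ V λ v → f u * g v)        ≈⟨ ∑ᵛ-cong U (λ u → ∑ᵛ-*ˡ V (f u) g) ⟩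
  ∑ᵛ U (λ u → f u * ∑ᵛ V g)                ≈⟨ ∑ᵛ-*ʳ U (∑ᵛ V g) f ⟩
  ∑ᵛ U f * ∑ᵛ V g                          ∎

-- V is explicit because it cannot be inferred from Carrier V.
mul : ∀ {A B : Set} (V : FiniteSet) → (A → Carrier V → ℂ) → (Carrier V → B → ℂ) → A → B → ℂ
mul V M N a b = ∑ᵛ V λ v → M a v * N v b

infixl 7 mul
syntax mul V M N = M ·⟨ V ⟩ N

mul-assoc : ∀ {A B : Set} V W (M : A → Carrier V → ℂ) N (P : Carrier W → B → ℂ) a b →
            (M ·⟨ V ⟩ N ·⟨ W ⟩ P) a b ≈ (M ·⟨ V ⟩ (N ·⟨ W ⟩ P)) a b
mul-assoc V W M N P a b = begin
  ∑ᵛ W (λ w → ∑ᵛ V (λ v → M a v * N v w) * P w b)     ≈⟨ ∑ᵛ-cong W (λ w → ∑ᵛ-*ʳ V (P w b) _) ⟨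
  ∑ᵛ W (λ w → ∑ᵛ V λ v → M a v * N v w * P w b)       ≈⟨ ∑ᵛ-comm W V _ ⟩
  ∑ᵛ V (λ v → ∑ᵛ W λ w → M a v * N v w * P w b)       ≈⟨ ∑ᵛ-cong V (λ v → ∑ᵛ-cong W λ w → *-assoc _ _ _) ⟩
  ∑ᵛ V (λ v → ∑ᵛ W λ w → M a v * (N v w * P w b))     ≈⟨ ∑ᵛ-cong V (λ v → ∑ᵛ-*ˡ W (M a v) _) ⟩
  ∑ᵛ V (λ v → M a v * ∑ᵛ W (λ w → N v w * P w b))     ∎

mul-cong : ∀ {A B : Set} V {M M′ : A → Carrier V → ℂ} {N N′ : Carrier V → B → ℂ} →
           (∀ a v → M a v ≈ M′ a v) → (∀ v b → N v b ≈ N′ v b) → ∀ a b → (M ·⟨ V ⟩ N) a b ≈ (M′ ·⟨ V ⟩ N′) a b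
mul-cong V M≈M′ N≈N′ a b = ∑ᵛ-cong V λ v → *-cong (M≈M′ a v) (N≈N′ v b)

mul-congˡ : ∀ {A B : Set} V (M : A → Carrier V → ℂ) {N N′ : Carrier V → B → ℂ} →
            (∀ v b → N v b ≈ N′ v b) → ∀ a b → (M ·⟨ V ⟩ N) a b ≈ (M ·⟨ V ⟩ N′) a b
mul-congˡ V M N≈N′ a b = ∑ᵛ-cong V λ v → *-congˡ (N≈N′ v b)

mul-congʳ : ∀ {A B : Set} V {M M′ : A → Carrier V → ℂ} (N : Carrier V → B → ℂ) →
            (∀ a v → M a v ≈ M′ a v) → ∀ a b → (M ·⟨ V ⟩ N) a b ≈ (M′ ·⟨ V ⟩ N) a b
mul-congʳ V N M≈M′ a b = ∑ᵛ-cong V λ v → *-congʳ (M≈M′ a v)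

-- Traces

tr : ∀ V → Mat V → ℂ
tr V M = ∑ᵛ V λ v → M v v

tr-cong : ∀ V {M N} → (∀ u v → M u v ≈ N u v) → tr V M ≈ tr V N
tr-cong V M≈N = ∑ᵛ-cong V λ v → M≈N v v

tr-comm : ∀ U V M N → tr U (M ·⟨ V ⟩ N) ≈ tr V (N ·⟨ U ⟩ M)
tr-comm U V M N = ≈-trans (∑ᵛ-comm U V _) (∑ᵛ-cong V λ v → ∑ᵛ-cong U λ u → *-comm _ _)

tr-linearˡ : ∀ V a M b N P → tr V ((λ u v → a * M u v + b * N u v) ·⟨ V ⟩ P) ≈
                              a * tr V (M ·⟨ V ⟩ P) + b * tr V (N ·⟨ V ⟩ P)
tr-linearˡ V a M b N P = ≈-trans
  (∑ᵛ-cong V λ u → ≈-trans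
    (∑ᵛ-cong V λ v → solve 5 (λ a b m n p → (a :* m :+ b :* n) :* p := a :* (m :* p) :+ b :* (n :* p)) ≈-refl
                       a b (M u v) (N u v) (P v u))
    (∑ᵛ-linear V a _ b _))
  (∑ᵛ-linear V a _ b _)
  where open ℂ-Solver

opaque
  unfolding ∑ᵛ
  ∑ᵛ-nonNeg : ∀ V f → (∀ x → NonNeg (f x)) → NonNeg (∑ᵛ V f)
  ∑ᵛ-nonNeg V f 0≤f = ∑-nonNeg (f ∘ elem V) (0≤f ∘ elem V)

  ∑ᵛ-nonNeg≈0 : ∀ V f → (∀ x → NonNeg (f x)) → re (∑ᵛ V f) ≈ᴿ 0ᴿ → ∀ x → re (f x) ≈ᴿ 0ᴿ
  ∑ᵛ-nonNeg≈0 V f 0≤f ∑≈0 x = subst (λ x → re (f x) ≈ᴿ 0ᴿ) (elem-from V x) $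
    ∑-nonNeg≈0 (f ∘ elem V) (0≤f ∘ elem V) ∑≈0 (Inverse.from (enumeration V) x)

-- The trace of the square of a Hermitian matrix is the sum of the squared moduli of its entries.
hermitian-tr≈0 : ∀ V F → (∀ u v → F v u ≈ conj (F u v)) → tr V (F ·⟨ V ⟩ F) ≈ 0# → ∀ u v → F u v ≈ 0#
hermitian-tr≈0 V F herm tr≈0 u v = normSquare≈0 (F u v) $
  ∑ᵛ-nonNeg≈0 V _ (λ v → normSquare-nonNeg (F u v)) row≈0 v
  where
  row : Carrier V → ℂ
  row u = ∑ᵛ V λ v → F u v * conj (F u v)
  row≈0 : re (row u) ≈ᴿ 0ᴿ
  row≈0 = ∑ᵛ-nonNeg≈0 V row (λ u → ∑ᵛ-nonNeg V _ λ v → normSquare-nonNeg (F u v))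
    (_≈_.re≈ $ ≈-trans (≈-sym $ ∑ᵛ-cong V λ u → ∑ᵛ-cong V λ v → *-congˡ (herm u v)) tr≈0) u

-- Second-order Welch bound

2# : ℂ
2# = 1# + 1#

:0 :1 :2 : ∀ {n} → ℂ-Solver.Polynomial n
:0 = ℂ-Solver.con 0ℚ
:1 = ℂ-Solver.con 1ℚ
:2 = :1 ℂ-Solver.:+ :1

-- `hermitian` and `square` make M / d an orthogonal projection, of rank tr M / d = d. The columns
-- mᵢ of M have Gram matrix d M, so they can stand for the d² vectors, and no coordinates in a
-- d-dimensional space are needed.
module Welch (V : FiniteSet) (M : Mat V) (d : ℂ)
  (real      : conj d ≈ d)
  (hermitian : ∀ u v → M v u ≈ conj (M u v))
  (square    : ∀ u v → (M ·⟨ V ⟩ M) u v ≈ d * M u v)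
  (diagonal  : ∀ u → M u u ≈ 1#)
  (size≈d²   : nat (size V) ≈ d * d)
  where

  open ℂ-Solver

  T : Mat V
  T u v = M u v * M u v

  W : FiniteSet
  W = V ⊠ V

  Ψ : Carrier W → Carrier V → ℂ
  Ψ (a , b) i = M a i * M b i

  Ψ* : Carrier V → Carrier W → ℂ
  Ψ* i (a , b) = M i a * M i b

  -- X is the frame operator of the vectors mᵢ ⊗ mᵢ. Y is M ⊗ M composed with 1 + swap, hence 2 d²
  -- times the projection onto the symmetric square of the range of M, which has dimension d (d + 1)
  -- / 2. If X is a multiple c Y, then tr X = d⁴ and tr Y = d³ (d + 1) force c = d / (d + 1); F is X
  -- - c Y cleared of denominators.
  X Y F : Mat W
  X = Ψ ·⟨ V ⟩ Ψ*
  Y (a , b) (c , e) = M a c * M b e + M a e * M b c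
  F x y = (d + 1#) * X x y + - d * Y x y

  contract : ∀ a x b y → ∑ᵛ W (λ (c , e) → (M a c * M c x) * (M b e * M e y)) ≈ d * d * (M a x * M b y)
  contract a x b y = begin
    ∑ᵛ W (λ (c , e) → (M a c * M c x) * (M b e * M e y))
      ≈⟨ ∑ᵛ-× V V (λ c → M a c * M c x) (λ e → M b e * M e y) ⟩
    (M ·⟨ V ⟩ M) a x * (M ·⟨ V ⟩ M) b y                     ≈⟨ *-cong (square a x) (square b y) ⟩
    (d * M a x) * (d * M b y)
      ≈⟨ solve 3 (λ d p q → (d :* p) :* (d :* q) := d :* d :* (p :* q)) ≈-refl d (M a x) (M b y) ⟩
    d * d * (M a x * M b y)                                 ∎

  Ψ*Ψ : ∀ i j → (Ψ* ·⟨ W ⟩ Ψ) i j ≈ d * d * T i j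
  Ψ*Ψ i j = ≈-trans
    (∑ᵛ-cong W λ (a , b) → solve 4 (λ p q r s → (p :* q) :* (r :* s) := (p :* r) :* (q :* s)) ≈-refl
       (M i a) (M i b) (M a j) (M b j))
    (contract i j i j)

  -- The columns of Ψ are symmetric tensors in the range of M ⊗ M, so Y acts on them by its nonzero
  -- eigenvalue 2 d².
  YΨ : ∀ x j → (Y ·⟨ W ⟩ Ψ) x j ≈ 2# * (d * d) * Ψ x j
  YΨ (a , b) j = begin
    ∑ᵛ W (λ (c , e) → (M a c * M b e + M a e * M b c) * (M c j * M e j))
      ≈⟨ ∑ᵛ-cong W (λ (c , e) → solve 6 (λ p q r s t u → (p :* q :+ r :* s) :* (t :* u)
                                                    := (p :* t) :* (q :* u) :+ (s :* t) :* (r :* u)) ≈-refl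
           (M a c) (M b e) (M a e) (M b c) (M c j) (M e j)) ⟩
    ∑ᵛ W (λ (c , e) → (M a c * M c j) * (M b e * M e j) + (M b c * M c j) * (M a e * M e j))
      ≈⟨ ≈-trans (∑ᵛ-+ W _ _) (+-cong (contract a j b j) (contract b j a j)) ⟩
    d * d * (M a j * M b j) + d * d * (M b j * M a j)
      ≈⟨ solve 3 (λ d p q → d :* d :* (p :* q) :+ d :* d :* (q :* p) := :2 :* (d :* d) :* (p :* q)) ≈-refl
           d (M a j) (M b j) ⟩
    2# * (d * d) * (M a j * M b j) ∎

  YY : ∀ x y → (Y ·⟨ W ⟩ Y) x y ≈ 2# * (d * d) * Y x y
  YY (a , b) (x , y) = begin
    ∑ᵛ W (λ (c , e) → (M a c * M b e + M a e * M b c) * (M c x * M e y + M c y * M e x))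
      ≈⟨ ∑ᵛ-cong W (λ (c , e) → solve 8 (λ ac be ae bc cx ey cy ex →
           (ac :* be :+ ae :* bc) :* (cx :* ey :+ cy :* ex) :=
           ((ac :* cx) :* (be :* ey) :+ (ac :* cy) :* (be :* ex)) :+ ((bc :* cx) :* (ae :* ey) :+
                (bc :* cy) :* (ae :* ex))) ≈-refl
           (M a c) (M b e) (M a e) (M b c) (M c x) (M e y) (M c y) (M e x)) ⟩
    ∑ᵛ W (λ (c , e) → ((M a c * M c x) * (M b e * M e y) + (M a c * M c y) * (M b e * M e x))
                    + ((M b c * M c x) * (M a e * M e y) + (M b c * M c y) * (M a e * M e x)))
      ≈⟨ ≈-trans (∑ᵛ-+ W _ _) (+-cong
           (≈-trans (∑ᵛ-+ W _ _) (+-cong (contract a x b y) (contract a y b x)))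
           (≈-trans (∑ᵛ-+ W _ _) (+-cong (contract b x a y) (contract b y a x)))) ⟩
    (d * d * (M a x * M b y) + d * d * (M a y * M b x)) + (d * d * (M b x * M a y) + d * d * (M b y * M a x))
      ≈⟨ solve 5 (λ d p q r s → (d :* d :* (p :* q) :+ d :* d :* (r :* s)) :+ (d :* d :*
           (s :* r) :+ d :* d :* (q :* p))
                             := :2 :* (d :* d) :* (p :* q :+ r :* s)) ≈-refl
           d (M a x) (M b y) (M a y) (M b x) ⟩
    2# * (d * d) * (M a x * M b y + M a y * M b x) ∎

  trM : tr V M ≈ d * d
  trM = ≈-trans (∑ᵛ-cong V diagonal) (≈-trans (∑ᵛ-one V) size≈d²)

  trT : tr V T ≈ d * d
  trT = ≈-trans (∑ᵛ-cong V λ v → ≈-trans (*-cong (diagonal v) (diagonal v)) (*-identityˡ 1#))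
                (≈-trans (∑ᵛ-one V) size≈d²)

  trY : tr W Y ≈ d * d * (d * d) + d * (d * d)
  trY = begin
    ∑ᵛ W (λ (a , b) → M a a * M b b + M a b * M b a)                     ≈⟨ ∑ᵛ-+ W _ _ ⟩
    ∑ᵛ W (λ (a , b) → M a a * M b b) + ∑ᵛ W (λ (a , b) → M a b * M b a)
      ≈⟨ +-cong (∑ᵛ-× V V (λ a → M a a) (λ b → M b b)) (∑ᵛ-⊠ V V _) ⟩
    tr V M * tr V M + tr V (M ·⟨ V ⟩ M)
      ≈⟨ +-cong (*-cong trM trM) (tr-cong V square) ⟩
    d * d * (d * d) + ∑ᵛ V (λ v → d * M v v)
      ≈⟨ +-congˡ (≈-trans (∑ᵛ-*ˡ V d _) (*-congˡ trM)) ⟩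
    d * d * (d * d) + d * (d * d)                                        ∎

  -- Cyclicity moves the trace from W to V, where the Gram matrix `Ψ* Ψ` is d² T.
  tr-XX : tr W (X ·⟨ W ⟩ X) ≈ d * d * (d * d) * tr V (T ·⟨ V ⟩ T)
  tr-XX = begin
    tr W (Ψ ·⟨ V ⟩ Ψ* ·⟨ W ⟩ X)                ≈⟨ tr-cong W (mul-assoc V W Ψ Ψ* X) ⟩
    tr W (Ψ ·⟨ V ⟩ (Ψ* ·⟨ W ⟩ X))              ≈⟨ tr-comm W V Ψ (Ψ* ·⟨ W ⟩ X) ⟩
    tr V (Ψ* ·⟨ W ⟩ X ·⟨ W ⟩ Ψ)
      ≈⟨ tr-cong V (mul-cong W (λ i y → ≈-sym (mul-assoc W V Ψ* Ψ Ψ* i y)) (λ _ _ → ≈-refl)) ⟩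
    tr V (Ψ* ·⟨ W ⟩ Ψ ·⟨ V ⟩ Ψ* ·⟨ W ⟩ Ψ)      ≈⟨ tr-cong V (mul-assoc V W (Ψ* ·⟨ W ⟩ Ψ) Ψ* Ψ) ⟩
    tr V (Ψ* ·⟨ W ⟩ Ψ ·⟨ V ⟩ (Ψ* ·⟨ W ⟩ Ψ))    ≈⟨ tr-cong V (mul-cong V Ψ*Ψ Ψ*Ψ) ⟩
    ∑ᵛ V (λ u → ∑ᵛ V λ v → (d * d * T u v) * (d * d * T v u))
      ≈⟨ ∑ᵛ-cong V (λ u → ≈-trans (∑ᵛ-cong V λ v →
           solve 3 (λ d p q → (d :* d :* p) :* (d :* d :* q) :=
                d :* d :* (d :* d) :* (p :* q)) ≈-refl d (T u v) (T v u))
           (∑ᵛ-*ˡ V (d * d * (d * d)) _)) ⟩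
    ∑ᵛ V (λ u → d * d * (d * d) * (T ·⟨ V ⟩ T) u u)    ≈⟨ ∑ᵛ-*ˡ V (d * d * (d * d)) _ ⟩
    d * d * (d * d) * tr V (T ·⟨ V ⟩ T)                ∎

  tr-YX : tr W (Y ·⟨ W ⟩ X) ≈ 2# * (d * d) * (d * d * (d * d))
  tr-YX = begin
    tr W (Y ·⟨ W ⟩ X)                        ≈⟨ tr-cong W (λ x y → ≈-sym (mul-assoc W V Y Ψ Ψ* x y)) ⟩
    tr W (Y ·⟨ W ⟩ Ψ ·⟨ V ⟩ Ψ*)              ≈⟨ tr-comm W V (Y ·⟨ W ⟩ Ψ) Ψ* ⟩
    tr V (Ψ* ·⟨ W ⟩ (Y ·⟨ W ⟩ Ψ))
      ≈⟨ ∑ᵛ-cong V (λ i → ≈-trans (∑ᵛ-cong W λ x → ≈-trans (*-congˡ (YΨ x i))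
           (solve 3 (λ c p q → p :* (c :* q) := c :* (p :* q)) ≈-refl (2# * (d * d)) (Ψ* i x) (Ψ x i)))
           (∑ᵛ-*ˡ W (2# * (d * d)) _)) ⟩
    ∑ᵛ V (λ i → 2# * (d * d) * (Ψ* ·⟨ W ⟩ Ψ) i i)  ≈⟨ ∑ᵛ-*ˡ V (2# * (d * d)) _ ⟩
    2# * (d * d) * tr V (Ψ* ·⟨ W ⟩ Ψ)
      ≈⟨ *-congˡ (≈-trans (tr-cong V Ψ*Ψ) (≈-trans (∑ᵛ-*ˡ V (d * d) _) (*-congˡ trT))) ⟩
    2# * (d * d) * (d * d * (d * d))         ∎

  tr-YY : tr W (Y ·⟨ W ⟩ Y) ≈ 2# * (d * d) * (d * d * (d * d) + d * (d * d))
  tr-YY = ≈-trans (tr-cong W YY) (≈-trans (∑ᵛ-*ˡ W (2# * (d * d)) _) (*-congˡ trY))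

  F-hermitian : ∀ x y → F y x ≈ conj (F x y)
  F-hermitian x@(a , b) y@(c , e) = ≈-sym (begin
    conj ((d + 1#) * X x y + - d * Y x y)
      ≈⟨ ≈-trans (conj-+ _ _) (+-cong (conj-* _ _) (conj-* _ _)) ⟩
    conj (d + 1#) * conj (X x y) + conj (- d) * conj (Y x y)
      ≈⟨ +-cong (*-cong (≈-trans (conj-+ d 1#) (+-cong real (conj-fromℝ _))) X-conj) (*-cong (≈-trans
           (conj-neg d) (-‿cong real)) Y-conj) ⟩
    (d + 1#) * X y x + - d * Y y x ∎)
    where
    conj-M*M : ∀ i j k l → conj (M i j * M k l) ≈ M j i * M l k
    conj-M*M i j k l = ≈-trans (conj-* _ _) (≈-sym (*-cong (hermitian i j) (hermitian k l)))
    X-conj : conj (X x y) ≈ X y x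
    X-conj = ≈-trans (conj-∑ᵛ V _) (∑ᵛ-cong V λ i → ≈-trans (conj-* _ _)
               (≈-trans (*-cong (conj-M*M a i b i) (conj-M*M i c i e)) (*-comm _ _)))
    Y-conj : conj (Y x y) ≈ Y y x
    Y-conj = ≈-trans (conj-+ _ _) (+-cong (conj-M*M a c b e)
               (≈-trans (conj-M*M a e b c) (*-comm _ _)))

  tr-FF : tr W (F ·⟨ W ⟩ F) ≈ (d + 1#) * ((d + 1#) * tr W (X ·⟨ W ⟩ X) + - d * tr W (Y ·⟨ W ⟩ X))
                            + - d * ((d + 1#) * tr W (Y ·⟨ W ⟩ X) + - d * tr W (Y ·⟨ W ⟩ Y))
  tr-FF = ≈-trans (tr-linearˡ W (d + 1#) X (- d) Y F) (+-cong (*-congˡ XF) (*-congˡ YF))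
    where
    XF : tr W (X ·⟨ W ⟩ F) ≈ (d + 1#) * tr W (X ·⟨ W ⟩ X) + - d * tr W (Y ·⟨ W ⟩ X)
    XF = ≈-trans (tr-comm W W X F) (tr-linearˡ W (d + 1#) X (- d) Y X)
    YF : tr W (Y ·⟨ W ⟩ F) ≈ (d + 1#) * tr W (Y ·⟨ W ⟩ X) + - d * tr W (Y ·⟨ W ⟩ Y)
    YF = ≈-trans (tr-comm W W Y F) (≈-trans (tr-linearˡ W (d + 1#) X (- d) Y Y) (+-congʳ (*-congˡ
         (tr-comm W W X Y))))

  -- Equality in the second-order Welch bound: the columns mᵢ ⊗ mᵢ of Ψ form a tight frame for the symmetric
  -- square, that is, F = (d + 1) Ψ Ψ* - d Y vanishes.
  module _ (equality : (d + 1#) * tr V (T ·⟨ V ⟩ T) ≈ 2# * (d * (d * d))) where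

    F≈0 : ∀ x y → F x y ≈ 0#
    F≈0 = hermitian-tr≈0 W F F-hermitian (begin
      tr W (F ·⟨ W ⟩ F)
        ≈⟨ tr-FF ⟩
      (d + 1#) * ((d + 1#) * tr W (X ·⟨ W ⟩ X) + - d * tr W (Y ·⟨ W ⟩ X))
        + - d * ((d + 1#) * tr W (Y ·⟨ W ⟩ X) + - d * tr W (Y ·⟨ W ⟩ Y))
        ≈⟨ +-cong (*-congˡ (+-cong (*-congˡ tr-XX) (*-congˡ tr-YX))) (*-congˡ (+-cong (*-congˡ tr-YX)
             (*-congˡ tr-YY))) ⟩
      (d + 1#) * ((d + 1#) * (d * d * (d * d) * t) + - d * (2# * (d * d) * (d * d * (d * d))))
        + - d * ((d + 1#) * (2# * (d * d) * (d * d * (d * d))) + - d * (2# * (d * d) * (d * d *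
             (d * d) + d * (d * d))))
        -- All terms combine to (d + 1) d⁴ times the defect in the Welch bound, which `equality`
        -- makes zero.
        ≈⟨ solve 2 (λ d t →
             (d :+ :1) :* ((d :+ :1) :* (d :* d :* (d :* d) :* t) :+ (:- d) :* (:2 :* (d :* d) :*
                  (d :* d :* (d :* d))))
             :+ (:- d) :* ((d :+ :1) :* (:2 :* (d :* d) :* (d :* d :* (d :* d))) :+ (:- d) :* (:2 :*
                  (d :* d) :* (d :* d :* (d :* d) :+ d :* (d :* d))))
             := (d :+ :1) :* (d :* d :* (d :* d)) :* ((d :+ :1) :* t :- :2 :* (d :* (d :* d)))) ≈-refl d t ⟩
      (d + 1#) * (d * d * (d * d)) * ((d + 1#) * t + - (2# * (d * (d * d))))
        ≈⟨ *-congˡ (≈⇒-≈0 equality) ⟩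
      (d + 1#) * (d * d * (d * d)) * 0#
        ≈⟨ zeroʳ _ ⟩
      0# ∎)
      where
      t : ℂ
      t = tr V (T ·⟨ V ⟩ T)

    -- This is the entry of F at ((i , i) , (k , k)): there X is the entry of T² and Y is twice that
    -- of T.
    T-square : ∀ i k → (d + 1#) * (T ·⟨ V ⟩ T) i k ≈ 2# * d * T i k
    T-square i k = -≈0⇒≈ _ _ (≈-trans
      (solve 3 (λ d x m → (d :+ :1) :* x :- :2 :* d :* (m :* m)
                       := (d :+ :1) :* x :+ (:- d) :* (m :* m :+ m :* m)) ≈-refl d ((T ·⟨ V ⟩ T) i k) (M i k))
      (F≈0 (i , i) (k , k)))

-- Frames

mul-𝕀ˡ : ∀ V {B : Set} (M : Carrier V → B → ℂ) v b → (𝕀 V ·⟨ V ⟩ M) v b ≈ M v b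
mul-𝕀ˡ V M v b = ∑ᵛ-δˡ V v (λ w → M w b)

mul-𝕀ʳ : ∀ V {A : Set} (M : A → Carrier V → ℂ) a v → (M ·⟨ V ⟩ 𝕀 V) a v ≈ M a v
mul-𝕀ʳ V M a v = ∑ᵛ-δʳ V v (M a)

tr-𝕀 : ∀ V → tr V (𝕀 V) ≈ nat (size V)
tr-𝕀 V = ≈-trans (∑ᵛ-cong V λ v → []-yes (FiniteSet._≟_ V v v) ≡.refl) (∑ᵛ-one V)

-- With a right inverse R of the synthesis matrix Φ, traces of G² can be computed both on V and on U;
-- comparing them determines the polynomial relation of G without eigenvalues or ranks.
module Frame (V U : FiniteSet) (Φ : Carrier U → Carrier V → ℂ) (Φ* : Carrier V → Carrier U → ℂ)
  (R : Carrier V → Carrier U → ℂ) (R* : Carrier U → Carrier V → ℂ) (G : Mat V) (a b : ℂ)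
  (Φ*Φ  : ∀ i j → (Φ* ·⟨ U ⟩ Φ) i j ≈ G i j)
  (ΦR   : ∀ k l → (Φ ·⟨ V ⟩ R) k l ≈ 𝕀 U k l)
  (R*Φ* : ∀ k l → (R* ·⟨ V ⟩ Φ*) k l ≈ 𝕀 U k l)
  (GG   : ∀ i j → (G ·⟨ V ⟩ G) i j ≈ a * G i j + b * 𝕀 V i j)
  (trG  : tr V G ≈ nat (size V))
  where

  R*G : ∀ k j → (R* ·⟨ V ⟩ G) k j ≈ Φ k j
  R*G k j = begin
    (R* ·⟨ V ⟩ G) k j                 ≈⟨ mul-congˡ V R* (λ i j → ≈-sym (Φ*Φ i j)) k j ⟩
    (R* ·⟨ V ⟩ (Φ* ·⟨ U ⟩ Φ)) k j     ≈⟨ mul-assoc V U R* Φ* Φ k j ⟨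
    (R* ·⟨ V ⟩ Φ* ·⟨ U ⟩ Φ) k j       ≈⟨ mul-congʳ U Φ R*Φ* k j ⟩
    (𝕀 U ·⟨ U ⟩ Φ) k j                ≈⟨ mul-𝕀ˡ U Φ k j ⟩
    Φ k j                             ∎

  GR : ∀ i l → (G ·⟨ V ⟩ R) i l ≈ Φ* i l
  GR i l = begin
    (G ·⟨ V ⟩ R) i l                  ≈⟨ mul-congʳ V R (λ i j → ≈-sym (Φ*Φ i j)) i l ⟩
    (Φ* ·⟨ U ⟩ Φ ·⟨ V ⟩ R) i l        ≈⟨ mul-assoc U V Φ* Φ R i l ⟩
    (Φ* ·⟨ U ⟩ (Φ ·⟨ V ⟩ R)) i l      ≈⟨ mul-congˡ U Φ* ΦR i l ⟩
    (Φ* ·⟨ U ⟩ 𝕀 U) i l               ≈⟨ mul-𝕀ʳ U Φ* i l ⟩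
    Φ* i l                            ∎

  rotate : ∀ A (P : Carrier V → Carrier U → ℂ) → tr V (A ·⟨ V ⟩ (P ·⟨ U ⟩ R*)) ≈ tr U (R* ·⟨ V ⟩ A ·⟨ V ⟩ P)
  rotate A P = begin
    tr V (A ·⟨ V ⟩ (P ·⟨ U ⟩ R*))    ≈⟨ tr-cong V (mul-assoc V U A P R*) ⟨
    tr V (A ·⟨ V ⟩ P ·⟨ U ⟩ R*)      ≈⟨ tr-comm V U (A ·⟨ V ⟩ P) R* ⟩
    tr U (R* ·⟨ V ⟩ (A ·⟨ V ⟩ P))    ≈⟨ tr-cong U (mul-assoc V V R* A P) ⟨
    tr U (R* ·⟨ V ⟩ A ·⟨ V ⟩ P)      ∎

  rotate-G : ∀ P → tr V (G ·⟨ V ⟩ (P ·⟨ U ⟩ R*)) ≈ tr U (Φ ·⟨ V ⟩ P)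
  rotate-G P = ≈-trans (rotate G P) (tr-cong U (mul-congʳ V P R*G))

  rotate-GG : ∀ P → tr V (G ·⟨ V ⟩ G ·⟨ V ⟩ (P ·⟨ U ⟩ R*)) ≈ tr U (Φ ·⟨ V ⟩ (G ·⟨ V ⟩ P))
  rotate-GG P = begin
    tr V (G ·⟨ V ⟩ G ·⟨ V ⟩ (P ·⟨ U ⟩ R*))        ≈⟨ rotate (G ·⟨ V ⟩ G) P ⟩
    tr U (R* ·⟨ V ⟩ (G ·⟨ V ⟩ G) ·⟨ V ⟩ P)        ≈⟨ tr-cong U (mul-congʳ V P (mul-assoc V V R* G G)) ⟨
    tr U (R* ·⟨ V ⟩ G ·⟨ V ⟩ G ·⟨ V ⟩ P)          ≈⟨ tr-cong U (mul-congʳ V P (mul-congʳ V G R*G)) ⟩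
    tr U (Φ ·⟨ V ⟩ G ·⟨ V ⟩ P)                    ≈⟨ tr-cong U (mul-assoc V V Φ G P) ⟩
    tr U (Φ ·⟨ V ⟩ (G ·⟨ V ⟩ P))                  ∎

  trΦΦ* : tr U (Φ ·⟨ V ⟩ Φ*) ≈ nat (size V)
  trΦΦ* = ≈-trans (tr-comm U V Φ Φ*) (≈-trans (tr-cong V Φ*Φ) trG)

  expand : ∀ C → tr V (G ·⟨ V ⟩ G ·⟨ V ⟩ C) ≈ a * tr V (G ·⟨ V ⟩ C) + b * tr V (𝕀 V ·⟨ V ⟩ C)
  expand C = ≈-trans (tr-cong V (mul-congʳ V C GG)) (tr-linearˡ V a G b (𝕀 V) C)

  trGG : tr V (G ·⟨ V ⟩ G) ≈ a * nat (size V) + b * nat (size V)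
  trGG = ≈-trans (tr-cong V GG) (≈-trans (∑ᵛ-linear V a _ b _) (+-cong (*-congˡ trG) (*-congˡ (tr-𝕀 V))))

  -- G² is multiplied by the oblique projection `Φ* R*`. This changes neither the trace of G nor
  -- that of G², but the identity now contributes `size U` instead of `size V`. Comparison with
  -- `trGG` isolates b.
  trGG′ : tr V (G ·⟨ V ⟩ G) ≈ a * nat (size V) + b * nat (size U)
  trGG′ = begin
    tr V (G ·⟨ V ⟩ G)                                ≈⟨ tr-cong V (mul-congʳ V G (λ i j → ≈-sym (Φ*Φ i j))) ⟩
    tr V (Φ* ·⟨ U ⟩ Φ ·⟨ V ⟩ G)                      ≈⟨ tr-cong V (mul-assoc U V Φ* Φ G) ⟩
    tr V (Φ* ·⟨ U ⟩ (Φ ·⟨ V ⟩ G))                    ≈⟨ tr-comm V U Φ* (Φ ·⟨ V ⟩ G) ⟩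
    tr U (Φ ·⟨ V ⟩ G ·⟨ V ⟩ Φ*)                      ≈⟨ tr-cong U (mul-assoc V V Φ G Φ*) ⟩
    tr U (Φ ·⟨ V ⟩ (G ·⟨ V ⟩ Φ*))                    ≈⟨ rotate-GG Φ* ⟨
    tr V (G ·⟨ V ⟩ G ·⟨ V ⟩ (Φ* ·⟨ U ⟩ R*))          ≈⟨ expand (Φ* ·⟨ U ⟩ R*) ⟩
    a * tr V (G ·⟨ V ⟩ (Φ* ·⟨ U ⟩ R*)) + b * tr V (𝕀 V ·⟨ V ⟩ (Φ* ·⟨ U ⟩ R*))
      ≈⟨ +-cong (*-congˡ (≈-trans (rotate-G Φ*) trΦΦ*))
                (*-congˡ (≈-trans (tr-cong V (mul-𝕀ˡ V (Φ* ·⟨ U ⟩ R*))) (≈-trans (tr-comm V U Φ* R*)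
                     (≈-trans (tr-cong U R*Φ*) (tr-𝕀 U))))) ⟩
    a * nat (size V) + b * nat (size U)              ∎

  constant-term : b * (nat (size V) + - nat (size U)) ≈ 0#
  constant-term = ≈-trans
    (solve 4 (λ a b n m → b :* (n :- m) :=
         (a :* n :+ b :* n) :- (a :* n :+ b :* m)) ≈-refl a b (nat (size V)) (nat (size U)))
    (≈⇒-≈0 (≈-trans (≈-sym trGG) trGG′))
    where open ℂ-Solver

  -- `R R*` serves as a generalized inverse of G: multiplied by it, G has trace `size U` and G² has
  -- trace `size V`. Hence G² = a G turns into the claimed equation.
  redundancy : b ≈ 0# → nat (size V) ≈ a * nat (size U)
  redundancy b≈0 = begin
    nat (size V)                                      ≈⟨ trΦΦ* ⟨
    tr U (Φ ·⟨ V ⟩ Φ*)                                ≈⟨ tr-cong U (mul-congˡ V Φ GR) ⟨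
    tr U (Φ ·⟨ V ⟩ (G ·⟨ V ⟩ R))                      ≈⟨ rotate-GG R ⟨
    tr V (G ·⟨ V ⟩ G ·⟨ V ⟩ (R ·⟨ U ⟩ R*))            ≈⟨ expand (R ·⟨ U ⟩ R*) ⟩
    a * tr V (G ·⟨ V ⟩ (R ·⟨ U ⟩ R*)) + b * tr V (𝕀 V ·⟨ V ⟩ (R ·⟨ U ⟩ R*))
      ≈⟨ +-cong (*-congˡ (≈-trans (rotate-G R) (≈-trans (tr-cong U ΦR) (tr-𝕀 U)))) (≈-trans (*-congʳ b≈0)
           (zeroˡ _)) ⟩
    a * nat (size U) + 0#                             ≈⟨ +-identityʳ _ ⟩
    a * nat (size U)                                  ∎

module _ {n m} (ℓ : Fin n → Line m) (φ : Fin n → ℂ^ m) (unit : UnitRepresentatives φ ℓ) where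

  ∈span-representatives : ∀ w → w ∈spanˡ ℓ → w ∈span φ
  ∈span-representatives w (c , w≈) = (λ i → c i * s i) , λ k → ≈-trans (w≈ k) (sum-cong-≋ λ i → begin
      c i * direction (ℓ i) k                                    ≈⟨ *-congˡ (*-identityˡ _) ⟨
      c i * (1# * direction (ℓ i) k)                             ≈⟨ *-congˡ (*-congʳ (unit-scale i)) ⟨
      c i * (s i * z i * direction (ℓ i) k)
        ≈⟨ solve 4 (λ c s z x → c :* (s :* z :* x) := c :* s :* (z :* x)) ≈-refl _ _ _ _ ⟩
      c i * s i * (z i * direction (ℓ i) k)                      ≈⟨ *-congˡ (φ≈ i k) ⟨
      c i * s i * φ i k                                          ∎)
    where
    open ℂ-Solver
    z : Fin n → ℂ
    z i = proj₁ (proj₁ (unit i))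
    φ≈ : ∀ i k → φ i k ≈ z i * direction (ℓ i) k
    φ≈ i = proj₂ (proj₁ (unit i))
    -- The inverse of `z i`, found without division: the norm of `φ i` being 1 says that |z|² times
    -- the squared norm of the direction is 1.
    s : Fin n → ℂ
    s i = conj (z i) * ⟪ direction (ℓ i) , direction (ℓ i) ⟫
    unit-scale : ∀ i → s i * z i ≈ 1#
    unit-scale i = begin
      conj (z i) * ⟪ direction (ℓ i) , direction (ℓ i) ⟫ * z i
        ≈⟨ solve 3 (λ c t z → c :* t :* z := z :* c :* t) ≈-refl _ _ _ ⟩
      z i * conj (z i) * ⟪ direction (ℓ i) , direction (ℓ i) ⟫
        ≈⟨ *-distribˡ-sum _ (λ k → direction (ℓ i) k * conj (direction (ℓ i) k)) ⟩
      ∑ (λ k → z i * conj (z i) * (direction (ℓ i) k * conj (direction (ℓ i) k)))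
        ≈⟨ sum-cong-≋ (λ k → ≈-trans (solve 4 (λ z c x y → z :* c :* (x :* y) :=
             z :* x :* (c :* y)) ≈-refl _ _ _ _)
             (*-cong (≈-sym (φ≈ i k)) (≈-trans (≈-sym (conj-* _ _)) (conj-cong (≈-sym (φ≈ i k)))))) ⟩
      ⟪ φ i , φ i ⟫                                              ≈⟨ proj₂ (unit i) ⟩
      1#                                                         ∎

-- Distance-regular covers and roux graphs

[]-× : ∀ {p q r} {P : Set p} {Q : Set q} {R : Set r} (P? : Dec P) (Q? : Dec Q) (R? : Dec R) →
       (P → Q → R) → (R → P × Q) → [ P? ] * [ Q? ] ≈ [ R? ]
[]-× P? Q? (yes r) _   R⇒ = ≈-trans (*-cong ([]-yes P? (proj₁ (R⇒ r))) ([]-yes Q? (proj₂ (R⇒ r))))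
                                    (*-identityˡ 1#)
[]-× (no _)  Q?      (no ¬r) ⇒R _ = zeroˡ [ Q? ]
[]-× (yes p) (no _)  (no ¬r) ⇒R _ = zeroʳ 1#
[]-× (yes p) (yes q) (no ¬r) ⇒R _ = contradiction (⇒R p q) ¬r

module DRACKN (V : FiniteSet) (G : Graph V) {n} (fibre : Carrier V → Fin n)
     (isDRACKN : Graph.IsDRACKN G fibre) where
  open Graph G
  open IsDRACKN isDRACKN
  open IsCoverOfComplete cover

  walk⇒dist : ∀ {k} u v → Walk k u v → ∃ λ k → Dist k u v
  walk⇒dist {k} u v = <-rec (λ k → Walk k u v → ∃ λ k → Dist k u v) step k
    where
    step : ∀ k → (∀ {j} → j ℕ.< k → Walk j u v → ∃ λ k → Dist k u v) → Walk k u v → ∃ λ k → Dist k u v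
    step k shorter walk with ℕ.anyUpTo? (λ j → walk? j u v) k
    ... | yes (j , j<k , walkⱼ) = shorter j<k walkⱼ
    ... | no  ¬shorter          = k , walk , λ j<k walkⱼ → ¬shorter (_ , j<k , walkⱼ)

  adj⇒dist₁ : ∀ {u v} → Adj u v → Dist 1 u v
  adj⇒dist₁ {u} {v} uv = (v , uv , ≡.refl) , λ { (s≤s z≤n) u≡v → irrefl u≡v uv }

  dist₁⇒adj : ∀ {u v} → Dist 1 u v → Adj u v
  dist₁⇒adj ((_ , uw , ≡.refl) , _) = uw

  -- The neighbour of u in the fibre of v is antipodal to v, so u is at distance at least D - 1 from v.
  nonadjacent⇒dist : ∀ {u v} → fibre u ≢ fibre v → ¬ Adj u v → Dist (pred (proj₁ antipodal)) u v
  nonadjacent⇒dist {u} {v} fu≢fv ¬uv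
    with antipodal | connected u v | matching fu≢fv u (inj₁ ≡.refl)
  ... | _ | _ | v′ , (inj₁ fv′≡fu , uv′) , _ = contradiction uv′ (independent (≡.sym fv′≡fu))
  ... | D , (≤D , _) , opposite | _ , walk | v′ , (inj₂ fv′≡fv , uv′) , _
    with walk⇒dist u v walk
  ... | k , distₖ@(walkₖ , _) = subst (λ k → Dist k u v) (cong pred k+1≡D) distₖ
    where
    v′≢v : v′ ≢ v
    v′≢v v′≡v = ¬uv (subst (Adj u) v′≡v uv′)
    k≢D : k ≢ D
    k≢D k≡D = fu≢fv (Equivalence.to (opposite u v (fu≢fv ∘ cong fibre)) (subst (λ k → Dist k u v) k≡D distₖ))
    k<D : k ℕ.< D
    k<D = ℕ.≤∧≢⇒< (≤D u v distₖ) k≢D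
    D≤k+1 : D ℕ.≤ suc k
    D≤k+1 = ℕ.≮⇒≥ λ k+1<D → proj₂ (Equivalence.from (opposite v′ v v′≢v) fv′≡fv) k+1<D (u , symm uv′ , walkₖ)
    k+1≡D : suc k ≡ D
    k+1≡D = ℕ.≤-antisym k<D D≤k+1

  intersection : ℕ → ℕ
  intersection k = proj₁ distanceRegular k 1 1

  commonNeighbours : ∀ {k} u v → Dist k u v → (adjacency ·⟨ V ⟩ adjacency) u v ≈ nat (intersection k)
  commonNeighbours u v dist = begin
    ∑ᵛ V (λ w → [ adj? u w ] * [ adj? w v ])
      ≈⟨ ∑ᵛ-cong V (λ w → []-× (adj? u w) (adj? w v) (dist? 1 u w ×-dec dist? 1 v w)
           (λ uw wv → adj⇒dist₁ uw , adj⇒dist₁ (symm wv)) (λ (uw , vw) → dist₁⇒adj uw , symm (dist₁⇒adj vw))) ⟩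
    ∑ᵛ V (λ w → [ dist? 1 u w ×-dec dist? 1 v w ])
      ≈⟨ ∑ᵛ-count V (λ w → dist? 1 u w ×-dec dist? 1 v w) ⟩
    nat (count V (λ w → dist? 1 u w ×-dec dist? 1 v w))
      ≈⟨ ≈-reflexive (cong nat (proj₂ distanceRegular u v dist 1 1)) ⟩
    nat (intersection _) ∎

  -- `c₂` belongs to the distance D - 1, at which nonadjacent vertices of different fibres lie; the
  -- name is the usual one when the diameter D is 3.
  a₁ c₂ : ℕ
  a₁ = intersection 1
  c₂ = intersection (pred (proj₁ antipodal))

  adjacency² : ∀ u v → fibre u ≢ fibre v →
               (adjacency ·⟨ V ⟩ adjacency) u v ≈ nat c₂ + (nat a₁ + - nat c₂) * adjacency u v
  adjacency² u v fu≢fv with adj? u v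
  ... | yes uv = ≈-trans (commonNeighbours u v (adj⇒dist₁ uv))
                         (solve 2 (λ a c → a := c :+ (a :- c) :* :1) ≈-refl (nat a₁) (nat c₂))
    where open ℂ-Solver
  ... | no ¬uv = ≈-trans (commonNeighbours u v (nonadjacent⇒dist fu≢fv ¬uv))
                         (≈-sym (≈-trans (+-congˡ (zeroʳ _)) (+-identityʳ _)))

-- Images of a roux under multiplicative functions

module RouxGraph (Γ : FiniteAbelianGroup) where
  open FiniteAbelianGroup Γ using (finiteSet; Element; _≟_; _∙_; ε; _⁻¹; isAbelianGroup; abelianGroup)
  open GroupAlgebra Γ
  open IsAbelianGroup isAbelianGroup using (assoc; identityʳ; inverseˡ; inverseʳ)

  open Algebra.Properties.Group (AbelianGroup.group abelianGroup) using (ε⁻¹≈ε)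

  cancelʳ : ∀ g h → (g ∙ h ⁻¹) ∙ h ≡ g
  cancelʳ g h = ≡.trans (assoc g (h ⁻¹) h) (≡.trans (cong (g ∙_) (inverseˡ h)) (identityʳ g))

  cancelʳ′ : ∀ g h → (g ∙ h) ∙ h ⁻¹ ≡ g
  cancelʳ′ g h = ≡.trans (assoc g h (h ⁻¹)) (≡.trans (cong (g ∙_) (inverseʳ h)) (identityʳ g))

  translate : Element → Element ↔ Element
  translate h = mk↔ₛ′ (_∙ h) (_∙ h ⁻¹) (λ g → cancelʳ g h) (λ g → cancelʳ′ g h)

  cayley-entry : ∀ x g h → cayley x g h ≈ x (g ∙ h ⁻¹)
  cayley-entry x g h = begin
    FiniteSet.∑ˢ finiteSet (λ k → x k * [ k ∙ h ≟ g ])   ≈⟨ ≈-reflexive (∑ˢ≡∑ᵛ finiteSet _) ⟩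
    ∑ᵛ finiteSet (λ k → x k * [ k ∙ h ≟ g ])
      ≈⟨ ∑ᵛ-cong finiteSet (λ k → *-congˡ ([]-cong (k ∙ h ≟ g) (k ≟ g ∙ h ⁻¹)
           (λ kh≡g → ≡.trans (≡.sym (cancelʳ′ k h)) (cong (_∙ h ⁻¹) kh≡g))
           (λ { ≡.refl → cancelʳ g h }))) ⟩
    ∑ᵛ finiteSet (λ k → x k * [ k ≟ g ∙ h ⁻¹ ])  ≈⟨ ∑ᵛ-δʳ finiteSet (g ∙ h ⁻¹) x ⟩
    x (g ∙ h ⁻¹)                               ∎

  module _ {n} (B : Matᴬ n) (G : Graph (⟨ n ⟩ ⊠ finiteSet)) (isRouxGraph : IsRouxGraph B G) where
    private
      N = ⟨ n ⟩
      V = ⟨ n ⟩ ⊠ finiteSet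
    open Graph G using (adjacency)

    adjacency-entry : ∀ i j g h → adjacency (i , g) (j , h) ≈ B i j (g ∙ h ⁻¹)
    adjacency-entry i j g h = ≈-trans (isRouxGraph (i , g) (j , h)) (cayley-entry (B i j) g h)

    adjacency-ε : ∀ i j g → adjacency (i , g) (j , ε) ≈ B i j g
    adjacency-ε i j g = ≈-trans (adjacency-entry i j g ε)
      (≈-reflexive (cong (B i j) (≡.trans (cong (g ∙_) ε⁻¹≈ε) (identityʳ g))))

    -- Defined for any function f rather than for a `Character`, so that a character and its
    -- pointwise square are treated alike.
    image : (Element → ℂ) → Mat N
    image f i j = ∑ᵛ finiteSet λ g → B i j g * f g

    module _ (f : Element → ℂ) (f-∙ : ∀ g h → f (g ∙ h) ≈ f g * f h) where

      -- The blocks of the adjacency matrix are Cayley matrices, for which the row of values of a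
      -- multiplicative f is an eigenvector; the eigenvalue on block (i , k) is `image f i k`.
      twist : ∀ i k x → ∑ᵛ finiteSet (λ z → f z * adjacency (i , z) (k , x)) ≈ image f i k * f x
      twist i k x = begin
        ∑ᵛ finiteSet (λ z → f z * adjacency (i , z) (k , x))
          ≈⟨ ∑ᵛ-reindex finiteSet (translate x) _ ⟩
        ∑ᵛ finiteSet (λ y → f (y ∙ x) * adjacency (i , y ∙ x) (k , x))
          ≈⟨ ∑ᵛ-cong finiteSet (λ y → *-cong (f-∙ y x)
               (≈-trans (adjacency-entry i k (y ∙ x) x) (≈-reflexive (cong (B i k) (cancelʳ′ y x))))) ⟩
        ∑ᵛ finiteSet (λ y → f y * f x * B i k y)
          ≈⟨ ∑ᵛ-cong finiteSet (λ y → solve 3 (λ p q b → p :* q :* b :=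
               b :* p :* q) ≈-refl (f y) (f x) (B i k y)) ⟩
        ∑ᵛ finiteSet (λ y → B i k y * f y * f x)
          ≈⟨ ∑ᵛ-*ʳ finiteSet (f x) _ ⟩
        image f i k * f x ∎
        where open ℂ-Solver

      -- The column (j , ε) of the squared adjacency matrix lists the coefficients of the entries of
      -- B² in column j. Applying f to them commutes with taking the square, because f is
      -- multiplicative.
      image² : ∀ i j → (image f ·⟨ N ⟩ image f) i j ≈
                       ∑ᵛ finiteSet (λ z → f z * (adjacency ·⟨ V ⟩ adjacency) (i , z) (j , ε))
      image² i j = ≈-sym (begin
        ∑ᵛ finiteSet (λ z → f z * ∑ᵛ V (λ w → adjacency (i , z) w * adjacency w (j , ε)))
          ≈⟨ ∑ᵛ-cong finiteSet (λ z → ∑ᵛ-*ˡ V (f z) _) ⟨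
        ∑ᵛ finiteSet (λ z → ∑ᵛ V (λ w → f z * (adjacency (i , z) w * adjacency w (j , ε))))
          ≈⟨ ∑ᵛ-comm finiteSet V _ ⟩
        ∑ᵛ V (λ w → ∑ᵛ finiteSet λ z → f z * (adjacency (i , z) w * adjacency w (j , ε)))
          ≈⟨ ∑ᵛ-cong V (λ w → ≈-trans (∑ᵛ-cong finiteSet λ z → ≈-sym (*-assoc _ _ _)) (∑ᵛ-*ʳ finiteSet
               (adjacency w (j , ε)) _)) ⟩
        ∑ᵛ V (λ w → ∑ᵛ finiteSet (λ z → f z * adjacency (i , z) w) * adjacency w (j , ε))
          ≈⟨ ∑ᵛ-⊠ N finiteSet _ ⟩
        ∑ᵛ N (λ k → ∑ᵛ finiteSet λ x → ∑ᵛ finiteSet (λ z → f z * adjacency (i , z) (k , x)) * adjacency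
             (k , x) (j , ε))
          ≈⟨ ∑ᵛ-cong N (λ k → ≈-trans (∑ᵛ-cong finiteSet λ x → ≈-trans (*-cong (twist i k x)
               (adjacency-ε k j x))
               (solve 3 (λ s p b → s :* p :* b := s :* (b :* p)) ≈-refl (image f i k) (f x) (B k j x)))
               (∑ᵛ-*ˡ finiteSet (image f i k) _)) ⟩
        ∑ᵛ N (λ k → image f i k * image f k j) ∎)
        where open ℂ-Solver

      module _ (isDRACKN : Graph.IsDRACKN G proj₁) where
        open DRACKN V G proj₁ isDRACKN using (a₁; c₂; adjacency²)

        image²-offDiagonal : ∀ {i j} → i ≢ j → (image f ·⟨ N ⟩ image f) i j ≈
                             nat c₂ * ∑ᵛ finiteSet f + (nat a₁ + - nat c₂) * image f i j
        image²-offDiagonal {i} {j} i≢j = begin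
          (image f ·⟨ N ⟩ image f) i j
            ≈⟨ image² i j ⟩
          ∑ᵛ finiteSet (λ z → f z * (adjacency ·⟨ V ⟩ adjacency) (i , z) (j , ε))
            ≈⟨ ∑ᵛ-cong finiteSet (λ z → *-congˡ (≈-trans (adjacency² (i , z) (j , ε) i≢j) (+-congˡ
                 (*-congˡ (adjacency-ε i j z))))) ⟩
          ∑ᵛ finiteSet (λ z → f z * (nat c₂ + (nat a₁ + - nat c₂) * B i j z))
            ≈⟨ ∑ᵛ-cong finiteSet (λ z → solve 4 (λ p c e b → p :* (c :+ e :* b) :=
                 c :* p :+ e :* (b :* p)) ≈-refl
                 (f z) (nat c₂) (nat a₁ + - nat c₂) (B i j z)) ⟩
          ∑ᵛ finiteSet (λ z → nat c₂ * f z + (nat a₁ + - nat c₂) * (B i j z * f z))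
            ≈⟨ ∑ᵛ-linear finiteSet _ _ _ _ ⟩
          nat c₂ * ∑ᵛ finiteSet f + (nat a₁ + - nat c₂) * image f i j ∎
          where open ℂ-Solver

    module _ (isRoux : IsRoux B) where
      open IsRoux isRoux

      image-diagonal : ∀ f i → image f i i ≈ 0#
      image-diagonal f i = ≈-trans
        (∑ᵛ-cong finiteSet λ g → ≈-trans (*-congʳ (zeroDiagonal i g)) (≈-trans (zeroˡ (f g)) (≈-sym
             (zeroˡ 1#))))
        (≈-trans (∑ᵛ-*ˡ finiteSet 0# (λ _ → 1#)) (zeroˡ _))

      -- The group element b is chosen before f. This order lets `image-square` compare the images
      -- under f and under its square.
      image-offDiagonal : ∀ {i j} → i ≢ j → ∃ λ b → ∀ f → image f i j ≈ f b
      image-offDiagonal i≢j with offDiagonal i≢j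
      ... | b , B≈ιb = b , λ f → ≈-trans (∑ᵛ-cong finiteSet λ g → *-congʳ (B≈ιb g)) (∑ᵛ-δˡ finiteSet b f)

      image-square : ∀ f i j → image (λ g → f g * f g) i j ≈ image f i j * image f i j
      image-square f i j = cases (i Fin.≟ j)
        where
        f² : Element → ℂ
        f² g = f g * f g
        cases : Dec (i ≡ j) → image f² i j ≈ image f i j * image f i j
        cases (yes ≡.refl) = ≈-trans (image-diagonal f² i) (≈-sym (≈-trans (*-congʳ (image-diagonal f i))
             (zeroˡ (image f i i))))
        cases (no i≢j)     = let b , value = image-offDiagonal i≢j in
          ≈-trans (value f²) (≈-sym (*-cong (value f) (value f)))

  -- Translating the sum by h multiplies it by f h.
  nontrivial⇒∑≈0 : ∀ f → (∀ g h → f (g ∙ h) ≈ f g * f h) → ∀ h → ¬ f h ≈ 1# → ∑ᵛ finiteSet f ≈ 0#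
  nontrivial⇒∑≈0 f f-∙ h fh≉1 = *-cancelˡ-≈0 (f h + - 1#) _ (fh≉1 ∘ -≈0⇒≈ _ _) (begin
    (f h + - 1#) * ∑ᵛ finiteSet f
      ≈⟨ solve 2 (λ p s → (p :- :1) :* s := s :* p :- s) ≈-refl (f h) _ ⟩
    ∑ᵛ finiteSet f * f h + - ∑ᵛ finiteSet f
      ≈⟨ ≈⇒-≈0 (≈-trans (≈-sym (∑ᵛ-*ʳ finiteSet (f h) f))
           (≈-trans (∑ᵛ-cong finiteSet λ g → ≈-sym (f-∙ g h)) (≈-sym (∑ᵛ-reindex finiteSet (translate h) f)))) ⟩
    0#                                              ∎)
    where open ℂ-Solver

  -- Equality of character values is undecidable, so the alternative holds only up to double
  -- negation. If neither side held, then no `f g` could differ from 1, and stability would make f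
  -- trivial after all.
  ∑≈0-or-trivial : ∀ f → (∀ g h → f (g ∙ h) ≈ f g * f h) → ¬ ¬ (∑ᵛ finiteSet f ≈ 0# ⊎ (∀ g → f g ≈ 1#))
  ∑≈0-or-trivial f f-∙ ¬either = ¬either (inj₂ λ g → ≈-stable (f g) 1# λ fg≉1 →
    ¬either (inj₁ (nontrivial⇒∑≈0 f f-∙ g fg≉1)))

-- Signature matrices

𝕀-diagonal : ∀ V i → 𝕀 V i i ≈ 1#
𝕀-diagonal V i = []-yes (FiniteSet._≟_ V i i) ≡.refl

𝕀-offDiagonal : ∀ V {i j} → i ≢ j → 𝕀 V i j ≈ 0#
𝕀-offDiagonal V {i} {j} i≢j = []-no (FiniteSet._≟_ V i j) i≢j

entrywise : ∀ V {M N : Mat V} → (∀ i → M i i ≈ N i i) →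
            (∀ {i j} → i ≢ j → M i j ≈ N i j) → ∀ i j → M i j ≈ N i j
entrywise V {M} {N} diagonal offDiagonal i j = cases (FiniteSet._≟_ V i j)
  where
  cases : Dec (i ≡ j) → M i j ≈ N i j
  cases (yes ≡.refl) = diagonal i
  cases (no i≢j)     = offDiagonal i≢j

𝕀-hermitian : ∀ V i j → 𝕀 V j i ≈ conj (𝕀 V i j)
𝕀-hermitian V = entrywise V
  (λ i → ≈-trans (𝕀-diagonal V i) (≈-sym (≈-trans (conj-cong (𝕀-diagonal V i)) (conj-fromℝ 1ᴿ))))
  (λ i≢j → ≈-trans (𝕀-offDiagonal V (i≢j ∘ ≡.sym)) (≈-sym (≈-trans (conj-cong (𝕀-offDiagonal V i≢j))
       (conj-fromℝ 0ᴿ))))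

𝕀+ : ∀ V → ℂ → Mat V → Mat V
𝕀+ V ν S i j = 𝕀 V i j + ν * S i j

affine-square : ∀ V ν S i j → (𝕀+ V ν S ·⟨ V ⟩ 𝕀+ V ν S) i j ≈
                𝕀 V i j + 2# * ν * S i j + ν * ν * (S ·⟨ V ⟩ S) i j
affine-square V ν S i j = begin
  ∑ᵛ V (λ k → (𝕀 V i k + ν * S i k) * (𝕀 V k j + ν * S k j))
    ≈⟨ ∑ᵛ-cong V (λ k → solve 5 (λ p q ν x y → (p :+ ν :* x) :* (q :+ ν :* y) :=
         (p :* (q :+ ν :* y) :+ ν :* (x :* q)) :+ ν :* ν :* (x :* y))
              ≈-refl (𝕀 V i k) (𝕀 V k j) ν (S i k) (S k j)) ⟩
  ∑ᵛ V (λ k → 𝕀 V i k * (𝕀 V k j + ν * S k j) + ν * (S i k * 𝕀 V k j) + ν * ν * (S i k * S k j))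
    ≈⟨ ≈-trans (∑ᵛ-+ V _ _) (+-cong (≈-trans (∑ᵛ-+ V _ _) (+-cong (∑ᵛ-δˡ V i (λ k → 𝕀 V k j + ν * S k j))
         (≈-trans (∑ᵛ-*ˡ V ν _) (*-congˡ (∑ᵛ-δʳ V j (S i)))))) (∑ᵛ-*ˡ V (ν * ν) _)) ⟩
  𝕀 V i j + ν * S i j + ν * S i j + ν * ν * (S ·⟨ V ⟩ S) i j
    ≈⟨ solve 4 (λ p ν x y → p :+ ν :* x :+ ν :* x :+ y := p :+ :2 :* ν :* x :+ y) ≈-refl
         (𝕀 V i j) ν (S i j) (ν * ν * (S ·⟨ V ⟩ S) i j) ⟩
  𝕀 V i j + 2# * ν * S i j + ν * ν * (S ·⟨ V ⟩ S) i j ∎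
  where open ℂ-Solver

module Signature (V : FiniteSet) (S : Mat V)
  (selfAdjoint  : ∀ i j → S i j ≈ conj (S j i))
  (zeroDiagonal : ∀ i → S i i ≈ 0#)
  (unimodular   : ∀ {i j} → i ≢ j → UnitModulus (S i j))
  where

  open ℂ-Solver

  N : ℂ
  N = nat (size V)

  S² : Mat V
  S² = S ·⟨ V ⟩ S

  normSquare-S : ∀ i j → S i j * S j i ≈ 1# + - 𝕀 V i j
  normSquare-S = entrywise V
    (λ i → ≈-trans (*-congʳ (zeroDiagonal i)) (≈-trans (zeroˡ (S i i))
             (≈-sym (≈-trans (+-congˡ (-‿cong (𝕀-diagonal V i))) (-‿inverseʳ 1#)))))
    (λ {i} {j} i≢j → ≈-trans (*-congˡ (selfAdjoint j i)) (≈-trans (unimodular i≢j)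
             (≈-trans (solve 0 (:1 := :1 :- :0) ≈-refl) (≈-sym (+-congˡ (-‿cong (𝕀-offDiagonal V i≢j)))))))

  S²-diagonal : ∀ i → S² i i ≈ N + - 1#
  S²-diagonal i = begin
    ∑ᵛ V (λ j → S i j * S j i)
      ≈⟨ ∑ᵛ-cong V (λ j → ≈-trans (normSquare-S i j)
           (solve 1 (λ p → :1 :- p := :1 :+ p :* (:- :1)) ≈-refl (𝕀 V i j))) ⟩
    ∑ᵛ V (λ j → 1# + 𝕀 V i j * - 1#)                ≈⟨ ∑ᵛ-+ V _ _ ⟩
    ∑ᵛ V (λ _ → 1#) + ∑ᵛ V (λ j → 𝕀 V i j * - 1#)   ≈⟨ +-cong (∑ᵛ-one V) (∑ᵛ-δˡ V i (λ _ → - 1#)) ⟩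
    N + - 1#                                        ∎

  module _ (δ : ℂ) (S²-offDiagonal : ∀ {i j} → i ≢ j → S² i j ≈ δ * S i j) where

    S²≈ : ∀ i j → S² i j ≈ (N + - 1#) * 𝕀 V i j + δ * S i j
    S²≈ = entrywise V
      (λ i → ≈-trans (S²-diagonal i) (≈-sym (≈-trans
               (+-cong (≈-trans (*-congˡ (𝕀-diagonal V i)) (*-identityʳ _)) (≈-trans (*-congˡ
                    (zeroDiagonal i)) (zeroʳ δ))) (+-identityʳ _))))
      (λ i≢j → ≈-trans (S²-offDiagonal i≢j) (≈-sym (≈-trans (+-congʳ (≈-trans (*-congˡ
           (𝕀-offDiagonal V i≢j)) (zeroʳ _))) (+-identityˡ _))))

    -- The form a G + b I is the one that the trace comparison needs. The coefficient ν is
    -- arbitrary, so that the lemma serves the Gram matrix as well as its complement.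
    gram-square : ∀ ν i j → (𝕀+ V ν S ·⟨ V ⟩ 𝕀+ V ν S) i j ≈
                  (2# + ν * δ) * 𝕀+ V ν S i j + (ν * ν * (N + - 1#) + - (1# + ν * δ)) * 𝕀 V i j
    gram-square ν i j = begin
      (𝕀+ V ν S ·⟨ V ⟩ 𝕀+ V ν S) i j             ≈⟨ affine-square V ν S i j ⟩
      𝕀 V i j + 2# * ν * S i j + ν * ν * S² i j              ≈⟨ +-congˡ (*-congˡ (S²≈ i j)) ⟩
      𝕀 V i j + 2# * ν * S i j + ν * ν * ((N + - 1#) * 𝕀 V i j + δ * S i j)
        ≈⟨ solve 5 (λ p ν x n δ → p :+ :2 :* ν :* x :+ ν :* ν :* ((n :- :1) :* p :+ δ :* x) :=
             (:2 :+ ν :* δ) :* (p :+ ν :* x) :+ (ν :* ν :* (n :- :1) :- (:1 :+ ν :* δ)) :* p) ≈-refl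
             (𝕀 V i j) ν (S i j) N δ ⟩
      (2# + ν * δ) * 𝕀+ V ν S i j + (ν * ν * (N + - 1#) + - (1# + ν * δ)) * 𝕀 V i j ∎

  S∘S : Mat V
  S∘S i j = S i j * S i j

  -- `ν²[d+1]≈1` is the angle of d² equiangular lines in dimension d. The sign of ν is left open,
  -- since it is negative in the complementary case.
  module _ (d ν : ℂ) (d-real : conj d ≈ d) (ν-real : conj ν ≈ ν) (N≈d² : N ≈ d * d)
           (ν²[d+1]≈1 : ν * ν * (d + 1#) ≈ 1#)
           (idempotent : ∀ i j → (𝕀+ V ν S ·⟨ V ⟩ 𝕀+ V ν S) i j ≈ d * 𝕀+ V ν S i j) where

    private
      M : Mat V
      M = 𝕀+ V ν S

      s : ℂ
      s = ν * ν

      M-diagonal : ∀ i → M i i ≈ 1#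
      M-diagonal i = ≈-trans (+-cong (𝕀-diagonal V i) (≈-trans (*-congˡ (zeroDiagonal i)) (zeroʳ ν)))
           (+-identityʳ 1#)

      M-hermitian : ∀ i j → M j i ≈ conj (M i j)
      M-hermitian i j = ≈-sym (≈-trans (conj-+ _ _) (+-cong (≈-sym (𝕀-hermitian V i j))
        (≈-trans (conj-* _ _) (*-cong ν-real (≈-sym (selfAdjoint j i))))))

    open Welch V M d d-real M-hermitian idempotent M-diagonal N≈d² using (T; T-square)

    private
      T-diagonal : ∀ i → T i i ≈ 1#
      T-diagonal i = ≈-trans (*-cong (M-diagonal i) (M-diagonal i)) (*-identityˡ 1#)

      T≈ : ∀ i j → T i j ≈ 𝕀+ V s S∘S i j
      T≈ = entrywise V
        (λ i → ≈-trans (T-diagonal i) (≈-sym (≈-trans (+-cong (𝕀-diagonal V i)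
                 (≈-trans (*-congˡ (≈-trans (*-congʳ (zeroDiagonal i)) (zeroˡ _))) (zeroʳ s)))
                      (+-identityʳ 1#))))
        (λ {i} {j} i≢j → begin
          M i j * M i j
            ≈⟨ *-cong (+-congʳ (𝕀-offDiagonal V i≢j)) (+-congʳ (𝕀-offDiagonal V i≢j)) ⟩
          (0# + ν * S i j) * (0# + ν * S i j)
            ≈⟨ solve 2 (λ ν x → (:0 :+ ν :* x) :* (:0 :+ ν :* x) := :0 :+ ν :* ν :* (x :* x)) ≈-refl ν (S i j) ⟩
          0# + s * S∘S i j                     ≈⟨ +-congʳ (𝕀-offDiagonal V i≢j) ⟨
          𝕀 V i j + s * S∘S i j                ∎)

      T-offDiagonal : ∀ {i j} → i ≢ j → T i j ≈ s * S∘S i j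
      T-offDiagonal {i} {j} i≢j = ≈-trans (T≈ i j) (≈-trans (+-congʳ (𝕀-offDiagonal V i≢j)) (+-identityˡ _))

      TT : ∀ i j → T i j * T j i ≈ 𝕀 V i j * (1# + - (s * s)) + s * s
      TT = entrywise V
        (λ i → begin
          T i i * T i i                               ≈⟨ *-cong (T-diagonal i) (T-diagonal i) ⟩
          1# * 1#
            ≈⟨ solve 1 (λ s → :1 :* :1 := :1 :* (:1 :- s) :+ s) ≈-refl (s * s) ⟩
          1# * (1# + - (s * s)) + s * s               ≈⟨ +-congʳ (*-congʳ (𝕀-diagonal V i)) ⟨
          𝕀 V i i * (1# + - (s * s)) + s * s          ∎)
        (λ {i} {j} i≢j → begin
          T i j * T j i
            ≈⟨ *-cong (T-offDiagonal i≢j) (T-offDiagonal (i≢j ∘ ≡.sym)) ⟩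
          s * S∘S i j * (s * S∘S j i)
            ≈⟨ solve 3 (λ s x y → s :* (x :* x) :* (s :* (y :* y)) :=
                 (x :* y) :* (x :* y) :* (s :* s)) ≈-refl s (S i j) (S j i) ⟩
          (S i j * S j i) * (S i j * S j i) * (s * s) ≈⟨ *-congʳ (*-cong (SS≈1 i≢j) (SS≈1 i≢j)) ⟩
          1# * 1# * (s * s)
            ≈⟨ solve 1 (λ s → :1 :* :1 :* s := :0 :* (:1 :- s) :+ s) ≈-refl (s * s) ⟩
          0# * (1# + - (s * s)) + s * s               ≈⟨ +-congʳ (*-congʳ (𝕀-offDiagonal V i≢j)) ⟨
          𝕀 V i j * (1# + - (s * s)) + s * s          ∎)
        where
        SS≈1 : ∀ {i j} → i ≢ j → S i j * S j i ≈ 1#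
        SS≈1 {i} {j} i≢j = ≈-trans (*-congˡ (selfAdjoint j i)) (unimodular i≢j)

      -- The diagonal entries of T are 1 and the others have squared modulus s² = 1 / (d + 1)².
      -- Hence tr T² = d² (1 + (d² - 1) / (d + 1)²) = 2 d³ / (d + 1). Rewriting s (d + 1) to 1 twice
      -- replaces the divisions.
      welch-equality : (d + 1#) * tr V (T ·⟨ V ⟩ T) ≈ 2# * (d * (d * d))
      welch-equality = begin
        (d + 1#) * tr V (T ·⟨ V ⟩ T)
          ≈⟨ *-congˡ (∑ᵛ-cong V λ i → ≈-trans (∑ᵛ-cong V (TT i)) (≈-trans (∑ᵛ-+ V _ _)
               (+-cong (∑ᵛ-δˡ V i (λ _ → 1# + - (s * s))) (∑ᵛ-const V (s * s))))) ⟩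
        (d + 1#) * ∑ᵛ V (λ _ → 1# + - (s * s) + s * s * N)
          ≈⟨ *-congˡ (∑ᵛ-const V _) ⟩
        (d + 1#) * ((1# + - (s * s) + s * s * N) * N)
          ≈⟨ *-congˡ (*-cong (+-congˡ (*-congˡ N≈d²)) N≈d²) ⟩
        (d + 1#) * ((1# + - (s * s) + s * s * (d * d)) * (d * d))
          ≈⟨ *-congˡ (*-congʳ (solve 2 (λ d s → :1 :- s :* s :+ s :* s :* (d :* d) :=
               :1 :+ s :* (s :* (d :+ :1) :* (d :- :1))) ≈-refl d s)) ⟩
        (d + 1#) * ((1# + s * (s * (d + 1#) * (d + - 1#))) * (d * d))
          ≈⟨ *-congˡ (*-congʳ (+-congˡ (*-congˡ (*-congʳ ν²[d+1]≈1)))) ⟩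
        (d + 1#) * ((1# + s * (1# * (d + - 1#))) * (d * d))
          ≈⟨ solve 2 (λ d s → (d :+ :1) :* ((:1 :+ s :* (:1 :* (d :- :1))) :* (d :* d)) :=
               (d :+ :1 :+ s :* (d :+ :1) :* (d :- :1)) :* (d :* d)) ≈-refl d s ⟩
        (d + 1# + s * (d + 1#) * (d + - 1#)) * (d * d)
          ≈⟨ *-congʳ (+-congˡ (*-congʳ ν²[d+1]≈1)) ⟩
        (d + 1# + 1# * (d + - 1#)) * (d * d)
          ≈⟨ solve 1 (λ d → (d :+ :1 :+ :1 :* (d :- :1)) :* (d :* d) := :2 :* (d :* (d :* d))) ≈-refl d ⟩
        2# * (d * (d * d)) ∎

    -- Off the diagonal, (d + 1) T² = 2 d T with T = I + s S∘S reads 2 x + s Q = 2 d s x, since s (d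
    -- + 1) = 1. Multiplication by d + 1 gives Q = 2 d x - 2 (d + 1) x = -2 x.
    schurSquare : ∀ {i j} → i ≢ j → (S∘S ·⟨ V ⟩ S∘S) i j + 2# * S∘S i j ≈ 0#
    schurSquare {i} {j} i≢j = begin
      Q + 2# * x                                         ≈⟨ +-congʳ (*-identityˡ Q) ⟨
      1# * Q + 2# * x                                    ≈⟨ +-congʳ (*-congʳ ν²[d+1]≈1) ⟨
      s * (d + 1#) * Q + 2# * x
        ≈⟨ solve 4 (λ d s x q → s :* (d :+ :1) :* q :+ :2 :* x :=
             (d :+ :1) :* (:2 :* x :+ s :* q) :- :2 :* d :* x) ≈-refl d s x Q ⟩
      (d + 1#) * (2# * x + s * Q) + - (2# * d * x)       ≈⟨ +-congʳ (*-congˡ relation) ⟩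
      (d + 1#) * (2# * d * (s * x)) + - (2# * d * x)
        ≈⟨ solve 3 (λ d s x → (d :+ :1) :* (:2 :* d :* (s :* x)) :- :2 :* d :* x :=
             (s :* (d :+ :1) :- :1) :* (:2 :* d :* x)) ≈-refl d s x ⟩
      (s * (d + 1#) + - 1#) * (2# * d * x)               ≈⟨ *-congʳ (≈⇒-≈0 ν²[d+1]≈1) ⟩
      0# * (2# * d * x)                                  ≈⟨ zeroˡ _ ⟩
      0#                                                 ∎
      where
      Q x : ℂ
      Q = (S∘S ·⟨ V ⟩ S∘S) i j
      x = S∘S i j
      relation : 2# * x + s * Q ≈ 2# * d * (s * x)
      relation = begin
        2# * x + s * Q                                 ≈⟨ *-identityˡ _ ⟨
        1# * (2# * x + s * Q)                          ≈⟨ *-congʳ ν²[d+1]≈1 ⟨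
        s * (d + 1#) * (2# * x + s * Q)
          ≈⟨ solve 4 (λ d s x q → s :* (d :+ :1) :* (:2 :* x :+ s :* q) :=
               (d :+ :1) :* (:0 :+ :2 :* s :* x :+ s :* s :* q)) ≈-refl d s x Q ⟩
        (d + 1#) * (0# + 2# * s * x + s * s * Q)       ≈⟨ *-congˡ (+-congʳ (+-congʳ (𝕀-offDiagonal V i≢j))) ⟨
        (d + 1#) * (𝕀 V i j + 2# * s * x + s * s * Q)  ≈⟨ *-congˡ (affine-square V s S∘S i j) ⟨
        (d + 1#) * (𝕀+ V s S∘S ·⟨ V ⟩ 𝕀+ V s S∘S) i j   ≈⟨ *-congˡ (mul-cong V T≈ T≈ i j) ⟨
        (d + 1#) * (T ·⟨ V ⟩ T) i j                    ≈⟨ T-square welch-equality i j ⟩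
        2# * d * T i j                                 ≈⟨ *-congˡ (T≈ i j) ⟩
        2# * d * (𝕀 V i j + s * x)
          ≈⟨ *-congˡ (≈-trans (+-congʳ (𝕀-offDiagonal V i≢j)) (+-identityˡ _)) ⟩
        2# * d * (s * x)                               ∎

-- DRACKN lines

distinct : ∀ {n} → 2 ℕ.≤ n → ∃₂ λ (i j : Fin n) → i ≢ j
distinct (s≤s (s≤s _)) = zero , suc zero , λ ()

module Lines {n m} (ℓ : Fin n → Line m) (lines : DRACKNLines ℓ) (spanning : SpanAll ℓ) where
  open DRACKNLines lines
  open FiniteAbelianGroup Γ using (finiteSet; Element; _∙_; ε)
  open GroupAlgebra Γ
  open RouxGraph Γ
  open IsRoux isRoux using (2≤n)
  open ℂ-Solver

  private
    V U : FiniteSet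
    V = ⟨ n ⟩
    U = ⟨ m ⟩

    χ χ² : Element → ℂ
    χ = Character.⟦_⟧ α
    χ² g = χ g * χ g

    χ-∙ : ∀ g h → χ (g ∙ h) ≈ χ g * χ h
    χ-∙ = MonoidMorphisms.IsMonoidHomomorphism.homo (Character.isMonoidHomomorphism α)

    χ²-∙ : ∀ g h → χ² (g ∙ h) ≈ χ² g * χ² h
    χ²-∙ g h = ≈-trans (*-cong (χ-∙ g h) (χ-∙ g h))
      (solve 2 (λ x y → (x :* y) :* (x :* y) := (x :* x) :* (y :* y)) ≈-refl (χ g) (χ h))

    S : Mat V
    S = image B G rouxGraph χ

    signature≡S : ∀ i j → applyCharacter α B i j ≡ S i j
    signature≡S i j = ∑ˢ≡∑ᵛ finiteSet (λ g → B i j g * χ g)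

    selfAdjoint : ∀ i j → S i j ≈ conj (S j i)
    selfAdjoint i j = ≡.subst₂ (λ x y → x ≈ conj y) (signature≡S i j) (signature≡S j i)
      (HasSignatureMatrix.selfAdjoint signature i j)

    zeroDiagonal : ∀ i → S i i ≈ 0#
    zeroDiagonal = image-diagonal B G rouxGraph isRoux χ

    unimodular : ∀ {i j} → i ≢ j → UnitModulus (S i j)
    unimodular {i} {j} i≢j = subst UnitModulus (signature≡S i j) (HasSignatureMatrix.unimodular signature i≢j)

  open Signature V S selfAdjoint zeroDiagonal unimodular

  μ : ℝ
  μ = proj₁ (HasSignatureMatrix.gram-eq signature)

  μ>0 : 0ᴿ <ᴿ μ
  μ>0 = proj₁ (proj₂ (HasSignatureMatrix.gram-eq signature))

  private
    gram≈ : ∀ i j → gram φ i j ≈ 𝕀+ V (fromℝ μ) S i j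
    gram≈ i j = subst (λ x → gram φ i j ≈ 𝕀 V i j + fromℝ μ * x) (signature≡S i j)
      (proj₂ (proj₂ (HasSignatureMatrix.gram-eq signature)) i j)

    Φ : Carrier U → Carrier V → ℂ
    Φ k i = φ i k

    Φ* : Carrier V → Carrier U → ℂ
    Φ* i k = conj (φ i k)

    -- The only use of the spanning hypothesis: expanding the standard basis vectors in the
    -- representatives gives the right inverse R of Φ.
    coordinates : ∀ k → (λ l → 𝕀 U l k) ∈span φ
    coordinates k = ∈span-representatives ℓ φ represent _ (spanning (λ l → 𝕀 U l k))

    R : Carrier V → Carrier U → ℂ
    R i k = proj₁ (coordinates k) i

    R* : Carrier U → Carrier V → ℂ
    R* k i = conj (R i k)

    Φ*Φ : ∀ i j → (Φ* ·⟨ U ⟩ Φ) i j ≈ 𝕀+ V (fromℝ μ) S i j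
    Φ*Φ i j = begin
      ∑ᵛ U (λ k → conj (φ i k) * φ j k)     ≈⟨ ∑ᵛ-cong U (λ k → *-comm _ _) ⟩
      ∑ᵛ U (λ k → φ j k * conj (φ i k))     ≈⟨ ≈-reflexive (∑ˢ≡∑ᵛ U _) ⟨
      gram φ i j                            ≈⟨ gram≈ i j ⟩
      𝕀+ V (fromℝ μ) S i j            ∎

    ΦR : ∀ l k → (Φ ·⟨ V ⟩ R) l k ≈ 𝕀 U l k
    ΦR l k = begin
      ∑ᵛ V (λ i → φ i l * R i k)   ≈⟨ ∑ᵛ-cong V (λ i → *-comm _ _) ⟩
      ∑ᵛ V (λ i → R i k * φ i l)   ≈⟨ ≈-reflexive (∑ˢ≡∑ᵛ V _) ⟨
      lincomb (λ i → R i k) φ l    ≈⟨ proj₂ (coordinates k) l ⟨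
      𝕀 U l k                      ∎

    R*Φ* : ∀ k l → (R* ·⟨ V ⟩ Φ*) k l ≈ 𝕀 U k l
    R*Φ* k l = begin
      ∑ᵛ V (λ i → conj (R i k) * conj (φ i l))
        ≈⟨ ∑ᵛ-cong V (λ i → ≈-trans (*-comm _ _) (≈-sym (conj-* _ _))) ⟩
      ∑ᵛ V (λ i → conj (φ i l * R i k))          ≈⟨ conj-∑ᵛ V _ ⟨
      conj ((Φ ·⟨ V ⟩ R) l k)                    ≈⟨ conj-cong (ΦR l k) ⟩
      conj (𝕀 U l k)                             ≈⟨ 𝕀-hermitian U l k ⟨
      𝕀 U k l                                    ∎

    trG : tr V (𝕀+ V (fromℝ μ) S) ≈ N
    trG = ≈-trans (∑ᵛ-cong V λ i → ≈-trans (+-cong (𝕀-diagonal V i) (≈-trans (*-congˡ (zeroDiagonal i))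
         (zeroʳ _))) (+-identityʳ 1#))
                  (∑ᵛ-one V)

  -- The parameter δ stays free: a trivial character satisfies the relation with another value, and
  -- it can be excluded only after the Welch bound has been applied to it too.
  Quadratic : ℂ → Set
  Quadratic δ = ∀ {i j} → i ≢ j → S² i j ≈ δ * S i j

  -- These equations say that the Gram matrix G satisfies G² = a G with a = n / m. The constant term
  -- b is annihilated by n - m, which is where n ≠ m enters.
  frame-parameters : ∀ δ → Quadratic δ → n ≢ m →
    1# + fromℝ μ * δ ≈ fromℝ μ * fromℝ μ * (N + - 1#) × N ≈ (2# + fromℝ μ * δ) * nat m
  frame-parameters δ quadratic n≢m = ≈-sym (-≈0⇒≈ _ _ b≈0) , F.redundancy b≈0
    where
    b : ℂ
    b = fromℝ μ * fromℝ μ * (N + - 1#) + - (1# + fromℝ μ * δ)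
    module F = Frame V U Φ Φ* R R* (𝕀+ V (fromℝ μ) S) (2# + fromℝ μ * δ) b
                 Φ*Φ ΦR R*Φ* (gram-square δ quadratic (fromℝ μ)) trG
    b≈0 : b ≈ 0#
    b≈0 = *-cancelˡ-≈0 (N + - nat m) b (n≢m ∘ nat-injective ∘ -≈0⇒≈ _ _) (≈-trans (*-comm _ _) F.constant-term)

  private
    open DRACKN (V ⊠ finiteSet) G proj₁ (proj₁ isDRACKN) using (a₁; c₂)

    trivial⇒image≈1 : ∀ f → (∀ g → f g ≈ 1#) → ∀ {i j} → i ≢ j → image B G rouxGraph f i j ≈ 1#
    trivial⇒image≈1 f f≈1 i≢j =
      let b , value = image-offDiagonal B G rouxGraph isRoux i≢j in ≈-trans (value f) (f≈1 b)

    trivial⇒∑≈size : ∀ f → (∀ g → f g ≈ 1#) → ∑ᵛ finiteSet f ≈ nat (size finiteSet)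
    trivial⇒∑≈size f f≈1 = ≈-trans (∑ᵛ-cong finiteSet f≈1) (∑ᵛ-one finiteSet)

    quadratic-nontrivial : ∑ᵛ finiteSet χ ≈ 0# → Quadratic (nat a₁ + - nat c₂)
    quadratic-nontrivial ∑≈0 i≢j = ≈-trans (image²-offDiagonal B G rouxGraph χ χ-∙ (proj₁ isDRACKN) i≢j)
      (≈-trans (+-congʳ (≈-trans (*-congˡ ∑≈0) (zeroʳ _))) (+-identityˡ _))

    -- The sum of χ no longer vanishes, but all off-diagonal entries of S are 1, so the extra
    -- constant is absorbed into δ.
    quadratic-trivial : (∀ g → χ g ≈ 1#) → Quadratic (nat c₂ * nat (size finiteSet) + (nat a₁ + - nat c₂))
    quadratic-trivial χ≈1 {i} {j} i≢j = begin
      S² i j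
        ≈⟨ image²-offDiagonal B G rouxGraph χ χ-∙ (proj₁ isDRACKN) i≢j ⟩
      nat c₂ * ∑ᵛ finiteSet χ + (nat a₁ + - nat c₂) * S i j
        ≈⟨ +-cong (*-congˡ (trivial⇒∑≈size χ χ≈1)) (*-congˡ S≈1) ⟩
      nat c₂ * nat (size finiteSet) + (nat a₁ + - nat c₂) * 1#
        ≈⟨ solve 2 (λ p q → p :+ q :* :1 := (p :+ q) :* :1) ≈-refl _ _ ⟩
      (nat c₂ * nat (size finiteSet) + (nat a₁ + - nat c₂)) * 1#
        ≈⟨ *-congˡ S≈1 ⟨
      (nat c₂ * nat (size finiteSet) + (nat a₁ + - nat c₂)) * S i j ∎
      where
      S≈1 : S i j ≈ 1#
      S≈1 = trivial⇒image≈1 χ χ≈1 i≢j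

  module _ (schur : ∀ {i j} → i ≢ j → (S∘S ·⟨ V ⟩ S∘S) i j + 2# * S∘S i j ≈ 0#) where

    private
      S′ : Mat V
      S′ = image B G rouxGraph χ²

      S′≈S∘S : ∀ i j → S′ i j ≈ S∘S i j
      S′≈S∘S = image-square B G rouxGraph isRoux χ

      relation : ∀ {i j} → i ≢ j → nat c₂ * ∑ᵛ finiteSet χ² + (nat a₁ + - nat c₂) * S′ i j + 2# * S′ i j ≈ 0#
      relation {i} {j} i≢j = begin
        nat c₂ * ∑ᵛ finiteSet χ² + (nat a₁ + - nat c₂) * S′ i j + 2# * S′ i j
          ≈⟨ +-congʳ (image²-offDiagonal B G rouxGraph χ² χ²-∙ (proj₁ isDRACKN) i≢j) ⟨
        (S′ ·⟨ V ⟩ S′) i j + 2# * S′ i j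
          ≈⟨ +-cong (mul-cong V S′≈S∘S S′≈S∘S i j) (*-congˡ (S′≈S∘S i j)) ⟩
        (S∘S ·⟨ V ⟩ S∘S) i j + 2# * S∘S i j
          ≈⟨ schur i≢j ⟩
        0# ∎

    -- For a trivial square the relation becomes c₂ r + (a₁ - c₂) + 2 = 0, where r is the order of
    -- the group. As ε witnesses r = 1 + r′, this is c₂ r′ + a₁ + 2 = 0, impossible in natural
    -- numbers.
    schur⇒nontrivial : ¬ (∀ g → χ² g ≈ 1#)
    schur⇒nontrivial χ²≈1 = absurd (size finiteSet) (Inverse.from (FiniteSet.enumeration finiteSet) ε) numbers
      where
      numbers : nat c₂ * nat (size finiteSet) + (nat a₁ + - nat c₂) * 1# + 2# * 1# ≈ 0#
      numbers = let i , j , i≢j = distinct 2≤n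
                    S′≈1 = ≈-sym (trivial⇒image≈1 χ² χ²≈1 i≢j)
        in ≈-trans (+-cong (+-cong (*-congˡ (≈-sym (trivial⇒∑≈size χ² χ²≈1))) (*-congˡ S′≈1))
             (*-congˡ S′≈1)) (relation i≢j)
      absurd : ∀ r → Fin r → ¬ nat c₂ * nat r + (nat a₁ + - nat c₂) * 1# + 2# * 1# ≈ 0#
      absurd (suc r) _ eq = contradiction (nat-injective {suc (suc (c₂ ℕ.* r ℕ.+ a₁))} {0} (begin
        nat (suc (suc (c₂ ℕ.* r ℕ.+ a₁)))
          ≈⟨ ≈-trans (nat-suc _) (+-congˡ (≈-trans (nat-suc _) (+-congˡ (≈-trans (nat-+ _ _) (+-congʳ
               (nat-* c₂ r)))))) ⟩
        1# + (1# + (nat c₂ * nat r + nat a₁))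
          ≈⟨ solve 3 (λ c r a → :1 :+ (:1 :+ (c :* r :+ a)) :=
               c :* (:1 :+ r) :+ (a :- c) :* :1 :+ :2 :* :1) ≈-refl (nat c₂) (nat r) (nat a₁) ⟩
        nat c₂ * (1# + nat r) + (nat a₁ + - nat c₂) * 1# + 2# * 1#
          ≈⟨ +-congʳ (+-congʳ (*-congˡ (nat-suc r))) ⟨
        nat c₂ * nat (suc r) + (nat a₁ + - nat c₂) * 1# + 2# * 1#
          ≈⟨ eq ⟩
        0#
          ≈⟨ nat-0 ⟨
        nat 0 ∎)) λ ()

    -- What remains of the relation is (δ + 2) x² = 0 for an off-diagonal entry x of S. Its modulus
    -- is 1, so multiplication by the square of its conjugate removes x².
    schur⇒δ≈-2 : ∑ᵛ finiteSet χ² ≈ 0# → nat a₁ + - nat c₂ ≈ - 2#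
    schur⇒δ≈-2 ∑≈0 =
      let i , j , i≢j = distinct 2≤n
          x = S i j
          x̄ = conj x
      in -≈0⇒≈ _ _ (begin
        nat a₁ + - nat c₂ + - (- 2#)
          ≈⟨ *-identityʳ _ ⟨
        (nat a₁ + - nat c₂ + - (- 2#)) * 1#
          ≈⟨ *-congˡ (≈-trans (*-cong (unimodular i≢j) (unimodular i≢j)) (*-identityˡ 1#)) ⟨
        (nat a₁ + - nat c₂ + - (- 2#)) * (x * x̄ * (x * x̄))
          ≈⟨ solve 4 (λ d t x y → (d :+ (:- (:- t))) :* (x :* y :* (x :* y)) :=
               (:0 :+ d :* (x :* x) :+ t :* (x :* x)) :* (y :* y)) ≈-refl _ _ _ _ ⟩
        (0# + (nat a₁ + - nat c₂) * S∘S i j + 2# * S∘S i j) * (x̄ * x̄)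
          ≈⟨ *-congʳ (+-cong (+-cong (≈-trans (*-congˡ ∑≈0) (zeroʳ _)) (*-congˡ (S′≈S∘S i j))) (*-congˡ
               (S′≈S∘S i j))) ⟨
        (nat c₂ * ∑ᵛ finiteSet χ² + (nat a₁ + - nat c₂) * S′ i j + 2# * S′ i j) * (x̄ * x̄)
          ≈⟨ *-congʳ (relation i≢j) ⟩
        0# * (x̄ * x̄)
          ≈⟨ zeroˡ _ ⟩
        0# ∎)

  -- The common part of both dimensions. The number d is written 2 + k, so that d - 1 is visibly a
  -- successor and can be cancelled.
  module _ (k : ℕ) (ν : ℂ) (ν-real : conj ν ≈ ν) (N≈d² : N ≈ nat (2 ℕ.+ k) * nat (2 ℕ.+ k))
    (parameters : ∀ δ → Quadratic δ →
       2# + ν * δ ≈ nat (2 ℕ.+ k) × ν * ν * (N + - 1#) ≈ nat (2 ℕ.+ k) + - 1#) where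

    private
      d : ℂ
      d = nat (2 ℕ.+ k)

      d-1 : d + - 1# ≈ nat (suc k)
      d-1 = ≈-trans (+-congʳ (nat-suc (suc k))) (solve 1 (λ x → :1 :+ x :- :1 := x) ≈-refl (nat (suc k)))

    module _ (δ : ℂ) (quadratic : Quadratic δ) where

      ν²[d+1]≈1 : ν * ν * (d + 1#) ≈ 1#
      ν²[d+1]≈1 = -≈0⇒≈ _ _ $ nat-suc-cancel k _ (begin
        nat (suc k) * (ν * ν * (d + 1#) + - 1#)
          ≈⟨ *-congʳ d-1 ⟨
        (d + - 1#) * (ν * ν * (d + 1#) + - 1#)
          ≈⟨ solve 2 (λ d s → (d :- :1) :* (s :* (d :+ :1) :- :1) :=
               s :* (d :* d :- :1) :- (d :- :1)) ≈-refl d (ν * ν) ⟩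
        ν * ν * (d * d + - 1#) + - (d + - 1#)
          ≈⟨ ≈⇒-≈0 (≈-trans (*-congˡ (+-congʳ (≈-sym N≈d²))) (proj₂ (parameters δ quadratic))) ⟩
        0# ∎)

      idempotent : ∀ i j → (𝕀+ V ν S ·⟨ V ⟩ 𝕀+ V ν S) i j ≈ d * 𝕀+ V ν S i j
      idempotent i j = begin
        (𝕀+ V ν S ·⟨ V ⟩ 𝕀+ V ν S) i j
          ≈⟨ gram-square δ quadratic ν i j ⟩
        (2# + ν * δ) * 𝕀+ V ν S i j + (ν * ν * (N + - 1#) + - (1# + ν * δ)) * 𝕀 V i j
          ≈⟨ +-cong (*-congʳ 2+νδ≈d) (≈-trans (*-congʳ constant≈0) (zeroˡ _)) ⟩
        d * 𝕀+ V ν S i j + 0#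
          ≈⟨ +-identityʳ _ ⟩
        d * 𝕀+ V ν S i j ∎
        where
        2+νδ≈d : 2# + ν * δ ≈ d
        2+νδ≈d = proj₁ (parameters δ quadratic)
        constant≈0 : ν * ν * (N + - 1#) + - (1# + ν * δ) ≈ 0#
        constant≈0 = ≈⇒-≈0 (≈-trans (proj₂ (parameters δ quadratic)) (≈-trans (+-congʳ (≈-sym 2+νδ≈d))
          (solve 1 (λ x → :2 :+ x :- :1 := :1 :+ x) ≈-refl (ν * δ))))

      schur : ∀ {i j} → i ≢ j → (S∘S ·⟨ V ⟩ S∘S) i j + 2# * S∘S i j ≈ 0#
      schur = schurSquare d ν (conj-nat (suc (suc k))) ν-real N≈d² ν²[d+1]≈1 idempotent

    -- The first equation is d = 2 - 2 ν, which is 2 + ν δ = d for δ = -2. A trivial χ has a trivial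
    -- square, so both trivial cases are refuted by `schur⇒nontrivial`.
    conclusion : ¬ ¬ (ν + (ν + nat k) ≈ 0# × ν * ν * (nat (2 ℕ.+ k) + 1#) ≈ 1#)
    conclusion ¬goal = ∑≈0-or-trivial χ χ-∙ λ
      { (inj₂ χ≈1) → schur⇒nontrivial (schur _ (quadratic-trivial χ≈1))
          λ g → ≈-trans (*-cong (χ≈1 g) (χ≈1 g)) (*-identityˡ 1#)
      ; (inj₁ ∑≈0) → let quadratic = quadratic-nontrivial ∑≈0 in
          ∑≈0-or-trivial χ² χ²-∙ λ
            { (inj₂ χ²≈1) → schur⇒nontrivial (schur _ quadratic) χ²≈1
            ; (inj₁ ∑²≈0) → ¬goal (equation (schur⇒δ≈-2 (schur _ quadratic) ∑²≈0) (proj₁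
                 (parameters _ quadratic)) , ν²[d+1]≈1 _ quadratic)
            }
      }
      where
      equation : ∀ {δ} → δ ≈ - 2# → 2# + ν * δ ≈ d → ν + (ν + nat k) ≈ 0#
      equation {δ} δ≈-2 2+νδ≈d = begin
        ν + (ν + nat k)
          ≈⟨ solve 2 (λ ν k → ν :+ (ν :+ k) := (:1 :+ (:1 :+ k)) :- (:2 :+ ν :* (:- :2))) ≈-refl ν (nat k) ⟩
        1# + (1# + nat k) + - (2# + ν * - 2#)
          ≈⟨ +-congʳ (≈-trans (+-congˡ (≈-sym (nat-suc k))) (≈-sym (nat-suc (suc k)))) ⟩
        d + - (2# + ν * - 2#)              ≈⟨ ≈⇒-≈0 (≈-trans (≈-sym 2+νδ≈d) (+-congˡ (*-congˡ δ≈-2))) ⟩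
        0#                                 ∎

-- The two dimensions d and d² - d

square-nat : ∀ d → nat (d ^ 2) ≈ nat d * nat d
square-nat d = ≈-trans (≈-reflexive (cong (λ e → nat (d ℕ.* e)) (ℕ.*-identityʳ d))) (nat-* d d)

d²≢d : ∀ k → let d = suc (suc k) in d ^ 2 ≢ d
d²≢d k d²≡d = contradiction (ℕ.*-cancelˡ-≡ (d ℕ.* 1) 1 d (≡.trans d²≡d (≡.sym (ℕ.*-identityʳ d)))) λ ()
  where d = suc (suc k)

no-DRACKN-SIC : ∀ k → let d = suc (suc k) in (ℓ : Fin (d ^ 2) → Line d) → DRACKNLines ℓ → SpanAll ℓ → ⊥
no-DRACKN-SIC k ℓ lines spanning =
  conclusion k (fromℝ μ) (conj-fromℝ μ) (square-nat d) parameters (2μ+k≉0 k μ>0 ∘ proj₁)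
  where
  d : ℕ
  d = suc (suc k)
  open Lines ℓ lines spanning
  open ℂ-Solver
  parameters : ∀ δ → Quadratic δ →
    2# + fromℝ μ * δ ≈ nat d × fromℝ μ * fromℝ μ * (nat (d ^ 2) + - 1#) ≈ nat d + - 1#
  parameters δ quadratic = 2+μδ≈d , ≈-trans (≈-sym constant) (≈-trans
      (solve 1 (λ x → :1 :+ x := :2 :+ x :- :1) ≈-refl (fromℝ μ * δ)) (+-congʳ 2+μδ≈d))
    where
    constant   = proj₁ (frame-parameters δ quadratic (d²≢d k))
    redundancy = proj₂ (frame-parameters δ quadratic (d²≢d k))
    2+μδ≈d : 2# + fromℝ μ * δ ≈ nat d
    2+μδ≈d = -≈0⇒≈ _ _ $ nat-suc-cancel (suc k) _ $ ≈-trans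
      (solve 2 (λ d x → d :* (x :- d) := x :* d :- d :* d) ≈-refl (nat d) (2# + fromℝ μ * δ))
      (≈⇒-≈0 (≈-trans (≈-sym redundancy) (square-nat d)))

-- With d = k + 2 the hypothesis is (d - 2)² (d + 1) = 4. For k at least 2 the left side is at least
-- 2 * 2 * 5 = 20.
k²[k+3]≡4⇒k≡1 : ∀ k → k ℕ.* k ℕ.* (3 ℕ.+ k) ≡ 4 → k ≡ 1
k²[k+3]≡4⇒k≡1 1 _ = ≡.refl
k²[k+3]≡4⇒k≡1 (suc (suc k)) eq = contradiction (≡.sym eq) (ℕ.<⇒≢
  (ℕ.<-≤-trans {4} {20} (ℕ.m≤m+n 5 15) (ℕ.*-mono-≤ (ℕ.*-mono-≤ {2} {2 ℕ.+ k} {2} {2 ℕ.+ k} (ℕ.m≤m+n 2 k)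
       (ℕ.m≤m+n 2 k)) (ℕ.m≤m+n 5 k))))

DRACKN-complement : ∀ k → let d = suc (suc k) in
                    (ℓ : Fin (d ^ 2) → Line (d ^ 2 ∸ d)) → DRACKNLines ℓ → SpanAll ℓ → d ≡ 3
DRACKN-complement k ℓ lines spanning = decidable-stable (d ℕ.≟ 3) λ d≢3 →
  conclusion k ν ν-real (square-nat d) parameters λ (2ν+k≈0 , ν²[d+1]≈1) →
    d≢3 (cong (2 ℕ.+_) (k²[k+3]≡4⇒k≡1 k (nat-injective (numbers 2ν+k≈0 ν²[d+1]≈1))))
  where
  d m : ℕ
  d = suc (suc k)
  m = d ^ 2 ∸ d
  open Lines ℓ lines spanning
  open ℂ-Solver

  -- The Naimark complement. Here E = d - 1 and G² = (d / E) G, so (E / d) G is a projection of rank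
  -- d² - d. The complementary projection times d is d I - E G = I - E μ S, which has unit diagonal
  -- and coefficient ν = - E μ.
  E ν : ℂ
  E = nat (suc k)
  ν = - (E * fromℝ μ)

  ν-real : conj ν ≈ ν
  ν-real = ≈-trans (conj-neg _) (-‿cong (≈-trans (conj-* _ _) (*-cong (conj-nat (suc k)) (conj-fromℝ μ))))

  m+d≡d² : m ℕ.+ d ≡ d ^ 2
  m+d≡d² = ℕ.m∸n+n≡m (ℕ.m≤m*n d (d ^ 1))

  d²≢m : d ^ 2 ≢ m
  d²≢m d²≡m = contradiction (ℕ.+-cancelˡ-≡ m d 0 (≡.trans m+d≡d² (≡.trans d²≡m (≡.sym (ℕ.+-identityʳ m))))) λ ()

  d≈1+E : nat d ≈ 1# + E
  d≈1+E = nat-suc (suc k)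

  m≈dE : nat m ≈ nat d * E
  m≈dE = -≈0⇒≈ _ _ (begin
    nat m + - (nat d * E)
      ≈⟨ solve 3 (λ m d e → m :- d :* e := (m :+ d) :- d :* (:1 :+ e)) ≈-refl (nat m) (nat d) E ⟩
    (nat m + nat d) + - (nat d * (1# + E))
      ≈⟨ ≈⇒-≈0 (≈-trans (≈-sym (nat-+ m d)) (≈-trans (≈-reflexive (cong nat m+d≡d²))
           (≈-trans (square-nat d) (*-congˡ d≈1+E)))) ⟩
    0#                                             ∎)

  parameters : ∀ δ → Quadratic δ → 2# + ν * δ ≈ nat d × ν * ν * (nat (d ^ 2) + - 1#) ≈ nat d + - 1#
  parameters δ quadratic = 2+νδ≈d , ν²[N-1]≈d-1
    where
    constant   = proj₁ (frame-parameters δ quadratic d²≢m)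
    redundancy = proj₂ (frame-parameters δ quadratic d²≢m)
    x : ℂ
    x = fromℝ μ * δ
    [2+x]E≈d : (2# + x) * E ≈ nat d
    [2+x]E≈d = -≈0⇒≈ _ _ $ nat-suc-cancel (suc k) _ $ ≈-trans
      (solve 3 (λ d e y → d :* (y :* e :- d) := y :* (d :* e) :- d :* d) ≈-refl (nat d) E (2# + x))
      (≈⇒-≈0 (≈-trans (*-congˡ (≈-sym m≈dE)) (≈-trans (≈-sym redundancy) (square-nat d))))
    2+νδ≈d : 2# + ν * δ ≈ nat d
    2+νδ≈d = begin
      2# + - (E * fromℝ μ) * δ
        ≈⟨ solve 3 (λ e m δ → :2 :+ (:- (e :* m)) :* δ :=
             :2 :+ :2 :* e :- (:2 :+ m :* δ) :* e) ≈-refl E (fromℝ μ) δ ⟩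
      2# + 2# * E + - ((2# + x) * E)          ≈⟨ +-congˡ (-‿cong (≈-trans [2+x]E≈d d≈1+E)) ⟩
      2# + 2# * E + - (1# + E)
        ≈⟨ solve 1 (λ e → :1 :+ :1 :+ :2 :* e :- (:1 :+ e) := :1 :+ e) ≈-refl E ⟩
      1# + E                                  ≈⟨ d≈1+E ⟨
      nat d                                   ∎
    ν²[N-1]≈d-1 : ν * ν * (nat (d ^ 2) + - 1#) ≈ nat d + - 1#
    ν²[N-1]≈d-1 = begin
      ν * ν * (nat (d ^ 2) + - 1#)
        ≈⟨ solve 3 (λ e m n → (:- (e :* m)) :* (:- (e :* m)) :* n :=
             e :* e :* (m :* m :* n)) ≈-refl E (fromℝ μ) _ ⟩
      E * E * (fromℝ μ * fromℝ μ * (nat (d ^ 2) + - 1#))   ≈⟨ *-congˡ constant ⟨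
      E * E * (1# + x)
        ≈⟨ solve 2 (λ e x → e :* e :* (:1 :+ x) := e :* ((:2 :+ x) :* e :- e)) ≈-refl E x ⟩
      E * ((2# + x) * E + - E)                ≈⟨ *-congˡ (+-congʳ (≈-trans [2+x]E≈d d≈1+E)) ⟩
      E * (1# + E + - E)                      ≈⟨ solve 1 (λ e → e :* (:1 :+ e :- e) := :1 :+ e :- :1) ≈-refl E ⟩
      1# + E + - 1#                           ≈⟨ +-congʳ d≈1+E ⟨
      nat d + - 1#                            ∎

  -- Substituting k = -2 ν turns k² (d + 1) into 4 ν² (d + 1) = 4; in this form the equation
  -- descends to natural numbers.
  numbers : ν + (ν + nat k) ≈ 0# → ν * ν * (nat d + 1#) ≈ 1# → nat (k ℕ.* k ℕ.* (3 ℕ.+ k)) ≈ nat 4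
  numbers 2ν+k≈0 ν²[d+1]≈1 = begin
    nat (k ℕ.* k ℕ.* (3 ℕ.+ k))
      ≈⟨ ≈-trans (nat-* (k ℕ.* k) (3 ℕ.+ k)) (*-cong (nat-* k k) (≈-trans (nat-suc (2 ℕ.+ k)) (+-comm _ _))) ⟩
    nat k * nat k * (nat d + 1#)               ≈⟨ *-congʳ (*-cong k≈-2ν k≈-2ν) ⟩
    - (ν + ν) * - (ν + ν) * (nat d + 1#)
      ≈⟨ solve 2 (λ ν d → (:- (ν :+ ν)) :* (:- (ν :+ ν)) :* (d :+ :1) :=
           :2 :* :2 :* (ν :* ν :* (d :+ :1))) ≈-refl ν (nat d) ⟩
    2# * 2# * (ν * ν * (nat d + 1#))           ≈⟨ *-cong (*-cong 2≈ 2≈) ν²[d+1]≈1 ⟩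
    nat 2 * nat 2 * 1#                         ≈⟨ *-identityʳ _ ⟩
    nat 2 * nat 2                              ≈⟨ nat-* 2 2 ⟨
    nat 4                                      ∎
    where
    2≈ : 2# ≈ nat 2
    2≈ = ≈-sym (≈-trans (nat-suc 1) (+-congˡ (≈-trans (nat-suc 0) (≈-trans (+-congˡ nat-0) (+-identityʳ 1#)))))
    k≈-2ν : nat k ≈ - (ν + ν)
    k≈-2ν = -≈0⇒≈ _ _ (≈-trans (solve 2 (λ ν k → k :- (:- (ν :+ ν)) := ν :+ (ν :+ k)) ≈-refl ν (nat k)) 2ν+k≈0)

corollary5p5 : ∀ (d : ℕ) → d ≥ 1 →
    (¬ ∃ λ (ℓ : Fin (d ^ 2) → Line d) → DRACKNLines ℓ × SpanAll ℓ)
    × ((∃ λ (ℓ : Fin (d ^ 2) → Line (d ^ 2 ∸ d)) → DRACKNLines ℓ × SpanAll ℓ) → d ≡ 3)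
-- For d = 1 there is a single line, whereas a roux has size at least 2, so both claims hold for
-- want of DRACKN lines.
corollary5p5 (suc zero) _ =
    (λ (_ , lines , _) → one-line lines)
  , (λ (_ , lines , _) → contradiction lines one-line)
  where
  one-line : ∀ {m} {ℓ : Fin 1 → Line m} → ¬ DRACKNLines ℓ
  one-line lines = contradiction (GroupAlgebra.IsRoux.2≤n (DRACKNLines.isRoux lines)) (ℕ.<⇒≱ (ℕ.n<1+n 1))
corollary5p5 (suc (suc k)) _ =
    (λ (ℓ , lines , spanning) → no-DRACKN-SIC k ℓ lines spanning)
  , (λ (ℓ , lines , spanning) → DRACKN-complement k ℓ lines spanning)
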